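{- Let $\lambda$ be an integer partition. Then $\lambda$ is $e$-positive (that is, $c_\lambda(G)\ge 0$ for every finite graph $G$ with $|\lambda|$ vertices, where $c_\lambda(G)$ is the coefficient of $e_\lambda$ in the expansion of the chromatic symmetric function $X(G)$ in the elementary symmetric basis) if and only if $\lambda$ is a hook partition (that is, $\lambda$ has at most one part larger than $1$).
   Context: Graphs are finite and simple. For a finite graph $G=(V,E)$, the chromatic symmetric function is the formal power series $X(G):=\sum_{\chi}\prod_{v\in V}x_{\chi(v)}\in\mathbb{Z}[[x_1,x_2,\ldots]]$, where $\chi$ ranges over all proper vertex colorings $\chi:V\to\{1,2,\ldots\}$ of $G$ (adjacent vertices receive different colors). It is a homogeneous symmetric function of degree $|V|$. For a positive integer $m$, $e_m:=\sum_{1\le i_1<\cdots<i_m}x_{i_1}\cdots x_{i_m}$. For an integer partition $\lambda=(\lambda_1,\ldots,\lambda_r)$ (weakly decreasing positive integers), $e_\lambda:=e_{\lambda_1}\cdots e_{\lambda_r}$. The size of $\lambda$ is $|\lambda|=\lambda_1+\cdots+\lambda_r$. The functions $e_\lambda$, for $\lambda$ ranging over the partitions of size $n$, form a basis of the homogeneous symmetric functions of degree $n$, so for every graph $G$ on $n$ vertices there are unique integers $c_\lambda(G)$ (for $\lambda$ of size $n$) with $X(G)=\sum_{\lambda}c_\lambda(G)e_\lambda$. A partition $\lambda$ is called $e$-positive if $c_\lambda(G)\ge 0$ for every graph $G$ (with $|\lambda|$ vertices). A hook partition is a partition with at most a single part larger than $1$. -}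

module Defs where

open import Data.Nat using (ℕ; zero; suc; _∸_; _≤_; _<_; _≥_; _≤?_; _<?_; _≟_; z≤n; s≤s)
open import Data.Nat.ListAction using (sum)
open import Data.Nat.Properties using (m≤m+n; +-mono-≤; suc-injective)
open import Data.Integer using (ℤ; +_; 0ℤ; 1ℤ) renaming (_+_ to _+ᶻ_; _*_ to _*ᶻ_; _≤_ to _≤ᶻ_)
open import Data.Fin using (Fin)
open import Data.Fin.Properties using (all?) renaming (_≟_ to _≟ᶠ_)
open import Data.List
  using (List; []; _∷_; map; foldr; filter; length; upTo; allFin; tabulate; concatMap; cartesianProductWith)
open import Data.List.Properties using (≡-dec; ∷-injectiveˡ; ∷-injectiveʳ)
open import Data.List.Membership.Propositional using (_∈_; find; lose)
open import Data.List.Membership.Propositional.Properties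
  using (∈-filter⁺; ∈-filter⁻; ∈-concatMap⁺; ∈-concatMap⁻; ∈-map⁺; ∈-map⁻; ∈-upTo⁺; ∈-upTo⁻)
open import Data.List.Relation.Unary.All as All using (All; []; _∷_)
open import Data.List.Relation.Unary.Any using (here; there)
open import Data.List.Relation.Unary.Linked using (Linked; []; [-]; _∷_)
open import Data.List.Relation.Binary.Disjoint.Propositional using (Disjoint)
open import Data.List.Relation.Unary.Unique.Propositional using (Unique)
open import Data.List.Relation.Unary.AllPairs as AllPairs using ([]; _∷_)
import Data.List.Relation.Unary.AllPairs.Properties as AllPairsₚ
import Data.List.Relation.Unary.All.Properties as Allₚ
import Data.List.Relation.Unary.Unique.Propositional.Properties as Uniqueₚ
open import Data.Vec using (Vec; []; _∷_; lookup; count)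
open import Data.Product using (_×_; _,_; proj₁; proj₂)
open import Function.Bundles using (_⇔_; mk⇔)
open import Level using (0ℓ)
open import Relation.Binary using (Rel; Symmetric; Irreflexive; Decidable)
open import Relation.Binary.PropositionalEquality using (_≡_; _≢_; refl; _≗_)
open import Relation.Nullary using (Dec; ¬?; _×-dec_; _→-dec_; does)
open import Data.Bool using (if_then_else_)

-- Vertices are labelled by Fin n; decidability of adjacency is automatic classically.
record Graph (n : ℕ) : Set₁ where
  field
    Adj     : Rel (Fin n) 0ℓ
    adj?    : Decidable Adj
    symm    : Symmetric Adj
    irrefl  : Irreflexive _≡_ Adj

-- The list (a₁ , … , a_k) stands for the monomial x₁^a₁ ⋯ x_k^a_k.  Trailing zeros
-- do not change the monomial; every series defined below respects this.
Monomial : Set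
Monomial = List ℕ

-- A formal power series in x₁ , x₂ , … over ℤ is given by its coefficients, so
-- equality of series is pointwise equality _≗_.
Series : Set
Series = Monomial → ℤ

∑ : List ℤ → ℤ
∑ = foldr _+ᶻ_ 0ℤ

factorisations : Monomial → List (Monomial × Monomial)
factorisations []      = ([] , []) ∷ []
factorisations (a ∷ α) =
  cartesianProductWith (λ i (β , γ) → (i ∷ β) , ((a ∸ i) ∷ γ)) (upTo (suc a)) (factorisations α)

infixl 7 _⊛_
_⊛_ : Series → Series → Series
(f ⊛ g) α = ∑ (map (λ (β , γ) → f β *ᶻ g γ) (factorisations α))

one : Series
one α = if does (All.all? (_≟ 0) α) then 1ℤ else 0ℤ

-- e_m is the sum of all squarefree monomials of degree m.
e : ℕ → Series
e m α = if does (All.all? (_≤? 1) α ×-dec (sum α ≟ m)) then 1ℤ else 0ℤ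

e[_] : List ℕ → Series
e[ μ ] = foldr (λ m f → e m ⊛ f) one μ

module _ {n : ℕ} (G : Graph n) where
  open Graph G

  Proper : ∀ {k} → Vec (Fin k) n → Set
  Proper χ = ∀ u v → Adj u v → lookup χ u ≢ lookup χ v

  proper? : ∀ {k} (χ : Vec (Fin k) n) → Dec (Proper χ)
  proper? χ = all? λ u → all? λ v → adj? u v →-dec ¬? (lookup χ u ≟ᶠ lookup χ v)

colourings : ∀ k n → List (Vec (Fin k) n)
colourings k zero    = [] ∷ []
colourings k (suc n) = cartesianProductWith _∷_ (allFin k) (colourings k n)

-- The monomial ∏_v x_{χ(v)}.
monomial : ∀ {k n} → Vec (Fin k) n → Monomial
monomial χ = tabulate λ i → count (i ≟ᶠ_) χ

-- The coefficient of a monomial in x₁ , … , x_k counts the proper colourings χ with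
-- that monomial; these can only use the first k colours.
X : ∀ {n} → Graph n → Series
X {n} G α =
  + length (filter (λ χ → proper? G χ ×-dec ≡-dec _≟_ (monomial χ) α) (colourings (length α) n))

IsPartition : List ℕ → Set
IsPartition μ = Linked _≥_ μ × All (0 <_) μ

-- Weakly decreasing lists of positive numbers with at most l entries, all at most b.
boxed : ℕ → ℕ → List (List ℕ)
boxed zero    b = [] ∷ []
boxed (suc l) b = [] ∷ concatMap (λ i → map (suc i ∷_) (boxed l (suc i))) (upTo b)

partitions : ℕ → List (List ℕ)
partitions n = filter (λ μ → sum μ ≟ n) (boxed n n)

-- c gives the coefficients of X(G) in the basis e_μ; its values on lists that are not
-- partitions of n are irrelevant.
IsExpansion : ∀ {n} → Graph n → (List ℕ → ℤ) → Set
IsExpansion {n} G c = X G ≗ λ α → ∑ (map (λ μ → c μ *ᶻ e[ μ ] α) (partitions n))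

-- The coefficients on partitions of |μ| are uniquely determined by G, so quantifying
-- over all c satisfying IsExpansion speaks about the coefficient of e_μ in X(G).
EPositive : List ℕ → Set₁
EPositive μ = (G : Graph (sum μ)) (c : List ℕ → ℤ) → IsExpansion G c → 0ℤ ≤ᶻ c μ

IsHook : List ℕ → Set
IsHook μ = length (filter (1 <?_) μ) ≤ 1

-- The enumeration `partitions n` lists every partition of n exactly once.

private
  boxed-sound : ∀ l b {μ} → μ ∈ boxed l b → IsPartition μ × Linked _≥_ (b ∷ μ)
  boxed-sound zero    b (here refl) = ([] , []) , [-]
  boxed-sound (suc l) b (here refl) = ([] , []) , [-]
  boxed-sound (suc l) b (there p)
    with i , i∈ , q ← find (∈-concatMap⁻ (λ i → map (suc i ∷_) (boxed l (suc i))) {xs = upTo b} p)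
    with ν , ν∈ , refl ← ∈-map⁻ (suc i ∷_) q
    with (_ , pos) , dec ← boxed-sound l (suc i) ν∈
    = (dec , s≤s z≤n ∷ pos) , ∈-upTo⁻ i∈ ∷ dec

  boxed-complete : ∀ l b μ → length μ ≤ l → Linked _≥_ (b ∷ μ) → All (0 <_) μ → μ ∈ boxed l b
  boxed-complete zero    b []          _       _         _         = here refl
  boxed-complete (suc l) b []          _       _         _         = here refl
  boxed-complete (suc l) b (suc i ∷ μ) (s≤s h) (i<b ∷ d) (_ ∷ pos) =
    there (∈-concatMap⁺ (λ i → map (suc i ∷_) (boxed l (suc i)))
      (lose (∈-upTo⁺ i<b) (∈-map⁺ (suc i ∷_) (boxed-complete l (suc i) μ h d pos))))

  boxed-unique : ∀ l b → Unique (boxed l b)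
  boxed-unique zero    b = [] ∷ []
  boxed-unique (suc l) b = All.tabulate []∉ ∷ Uniqueₚ.concat⁺
    (Allₚ.map⁺ (All.tabulate λ {i} _ → Uniqueₚ.map⁺ ∷-injectiveʳ (boxed-unique l (suc i))))
    (AllPairsₚ.map⁺ (AllPairs.map disjoint (Uniqueₚ.upTo⁺ b)))
    where
    block : ℕ → List (List ℕ)
    block i = map (suc i ∷_) (boxed l (suc i))
    []∉ : ∀ {ν} → ν ∈ concatMap block (upTo b) → [] ≢ ν
    []∉ p refl
      with i , _ , q ← find (∈-concatMap⁻ block {xs = upTo b} p)
      with _ , _ , () ← ∈-map⁻ (suc i ∷_) q
    disjoint : ∀ {i j} → i ≢ j → Disjoint (block i) (block j)
    disjoint {i} {j} i≢j (p , q)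
      with _ , _ , refl ← ∈-map⁻ (suc i ∷_) p
      with _ , _ , eq ← ∈-map⁻ (suc j ∷_) q = i≢j (suc-injective (∷-injectiveˡ eq))

  length≤sum : ∀ {μ} → All (0 <_) μ → length μ ≤ sum μ
  length≤sum []        = z≤n
  length≤sum (p ∷ pos) = +-mono-≤ p (length≤sum pos)

  sum-bounds : ∀ {μ} → Linked _≥_ μ → Linked _≥_ (sum μ ∷ μ)
  sum-bounds {[]}    _ = [-]
  sum-bounds {m ∷ μ} d = m≤m+n m (sum μ) ∷ d

∈-partitions : ∀ {n μ} → μ ∈ partitions n ⇔ (IsPartition μ × sum μ ≡ n)
∈-partitions {n} = mk⇔
  (λ p → let q , s = ∈-filter⁻ (λ μ → sum μ ≟ n) {xs = boxed n n} p in proj₁ (boxed-sound n n q) , s)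
  (λ { ((d , pos) , refl) →
       ∈-filter⁺ (λ μ → sum μ ≟ n) (boxed-complete n n _ (length≤sum pos) (sum-bounds d) pos) refl })

partitions-unique : ∀ n → Unique (partitions n)
partitions-unique n = Uniqueₚ.filter⁺ (λ μ → sum μ ≟ n) (boxed-unique n n)

{-# OPTIONS --safe #-}

-- Hooks are positive. Specialising ∑ e_m z^m to 1 + tz + uz^k and taking the part linear in u
-- shows that for k ≥ 2 the coefficient of e_(k, 1^d) in X(G) is ∑ (-1)^(d - i) y_i over i ≤ d,
-- where y_i is the number of pairs of a stable set I of size i and an acyclic orientation of
-- G ∖ I with a unique sink. If G has no isolated vertex, extending the orientation so that I
-- consists of sources gives ∑ y_i yⁱ = ∑ (1 + y)^s, where s is the number of sources and the
-- second sum is over the acyclic orientations of G with a unique sink; the coefficient is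
-- therefore that of y^d in ∑ (1 + y)^(s - 1), which is nonnegative. Isolated vertices only
-- contribute factors e_1. For 1^n one reads off the coefficient of x_1^n instead.
--
-- Other partitions are not positive. If a ≥ b ≥ 2 are two parts of μ, take the disjoint union
-- of the star on a + b vertices and complete graphs on μ_i vertices for the remaining parts.
-- Its series is the product of the star's with ∏ μ_i! e_(μ_i), and the star has no partition
-- into connected parts of sizes a and b, which makes its coefficient of e_a e_b negative.
module Submission where

open import Defs
open import Data.Nat as ℕ using (ℕ; zero; suc; _∸_; _≟_; _≤?_; _!; s≤s; z≤n)
  renaming (_+_ to _+ⁿ_; _*_ to _*ⁿ_; _<_ to _<ⁿ_; _≥_ to _≥ⁿ_; _≤_ to _≤ⁿ_)
import Data.Nat.Properties as ℕ
open import Data.Nat.ListAction using (sum)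
open import Data.Nat.ListAction.Properties using (sum-↭; sum-++)
open import Data.Integer using (ℤ; 0ℤ; 1ℤ; _+_; _*_; -_; _-_; _≤_; _<_; +≤+; -<+) renaming (+_ to pos)
import Data.Integer.Properties as ℤ
open import Data.Integer.Tactic.RingSolver using (solve-∀)
open import Data.Bool using (Bool; true; false; if_then_else_; not; _∧_)
open import Data.Empty using (⊥; ⊥-elim)
open import Data.Unit using (⊤; tt)
open import Data.Product using (_×_; _,_; proj₁; proj₂; ∃)
open import Data.Sum using (_⊎_; inj₁; inj₂)
open import Data.Fin using (Fin; zero; suc; splitAt; _↑ˡ_; _↑ʳ_)
open import Data.Fin.Properties using (splitAt-↑ˡ; splitAt-↑ʳ) renaming (_≟_ to _≟ᶠ_)
open import Data.Vec using (Vec; []; _∷_; count) renaming (lookup to lookupᵛ)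
open import Data.List
  using (List; []; _∷_; map; _++_; foldr; filter; length; lookup; replicate; applyUpTo; tabulate; allFin; cartesianProductWith)
open import Data.List.Properties
  using (map-++; map-∘; map-cong; map-tabulate; length-map; length-tabulate; ++-identityʳ; ≡-dec)
open import Data.List.Membership.Propositional using (_∈_; find; lose)
open import Data.List.Membership.Propositional.Properties using (∈-∃++; ∈-++⁺ʳ)
open import Data.List.Relation.Unary.All as All using (All; []; _∷_)
import Data.List.Relation.Unary.All.Properties as Allₚ
open import Data.List.Relation.Unary.AllPairs using (AllPairs; []; _∷_)
import Data.List.Relation.Unary.AllPairs.Properties as AllPairsₚ
open import Data.List.Relation.Unary.Any using (Any; here; there; any?)
open import Data.List.Relation.Unary.Linked using (Linked; []; _∷_)
open import Data.List.Relation.Unary.Sorted.TotalOrder.Properties using (↗↭↗⇒≋)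
open import Data.List.Relation.Unary.Unique.Propositional using (Unique)
open import Data.List.Relation.Binary.Pointwise using (Pointwise-≡⇒≡)
open import Data.List.Relation.Binary.Permutation.Propositional
  using (_↭_; ↭-refl; ↭-sym; ↭-trans; ↭⇒↭ₛ; prep; swap; trans; refl)
open import Data.List.Relation.Binary.Permutation.Propositional.Properties
  using (↭-length; shift; ∈-resp-↭; All-resp-↭; drop-∷; ++-comm)
open import Data.List.Relation.Ternary.Interleaving.Propositional
  using (Interleaving; []; consˡ; consʳ; toPermutation)
open import Data.List.Relation.Ternary.Interleaving.Properties using (interleave-length)
open import Function using (_∘_; id)
open import Function.Bundles using (_⇔_; mk⇔; Equivalence)
open import Relation.Binary using (DecTotalOrder)
import Relation.Binary.Construct.Flip.EqAndOrd as Flip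
open import Relation.Nullary using (Dec; yes; no; ¬_; does; ¬?)
open import Relation.Nullary.Decidable using (does-⇔; dec-true; dec-false)
open import Relation.Unary using (Decidable)
open import Relation.Binary.PropositionalEquality hiding (trans)
open import Relation.Binary.PropositionalEquality using () renaming (trans to ≡-trans)

-- Acyclic orientations never appear as objects. `AO`, `A[_]` and `a` are signed sums over
-- splittings of the vertex list, and the facts about them rest on one identity, `q*AO`: the
-- recursion by which `T` runs over compositions, read as inclusion-exclusion over sets of sinks.
-- The obstacle is that dividing by 1 + y leaves an alternating sum. Peeling off the whole set of
-- sinks removes the signs: the rest is again of the form `D`, with only neighbours of the peeled
-- set permitted as sinks. This rest may have isolated vertices although the graph had none, but
-- each of them is then a neighbour of the peeled set. Being both a permitted sink and a possible
-- member of I, it yields a factor 1 + y, and one such factor is what the division consumes. For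
-- negativity an explicit e-expansion has to be exhibited. `κ` and `ρ` give it as a functional on
-- index lists, which can be evaluated at the series `e[_]` as well as at the indicator of one
-- partition.

≥-decTotalOrder : DecTotalOrder _ _ _
≥-decTotalOrder = Flip.decTotalOrder ℕ.≤-decTotalOrder

open import Data.List.Sort ≥-decTotalOrder using (sort; sort-↭; sort-↗)

open ≡-Reasoning

-- Multiplication by elementary symmetric functions

∑-++ : ∀ xs ys → ∑ (xs ++ ys) ≡ ∑ xs + ∑ ys
∑-++ []       ys = sym (ℤ.+-identityˡ _)
∑-++ (x ∷ xs) ys = ≡-trans (cong (x +_) (∑-++ xs ys)) (sym (ℤ.+-assoc x _ _))

∑-map-0 : ∀ {a} {A : Set a} {f : A → ℤ} xs → (∀ x → f x ≡ 0ℤ) → ∑ (map f xs) ≡ 0ℤ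
∑-map-0 []       f≡0 = refl
∑-map-0 (x ∷ xs) f≡0 = cong₂ _+_ (f≡0 x) (∑-map-0 xs f≡0)

indicator : Bool → ℤ
indicator b = if b then 1ℤ else 0ℤ

-- Defined by recursion so that `δ (suc m) (suc n)` reduces to `δ m n`: taking one vertex out of a
-- block and lowering the exponent by one agree definitionally.
δ : ℕ → ℕ → ℤ
δ zero    zero    = 1ℤ
δ zero    (suc _) = 0ℤ
δ (suc _) zero    = 0ℤ
δ (suc m) (suc n) = δ m n

∂ : ℕ → Series → Series
∂ i f α = f (i ∷ α)

-- Multiplication by e_m: a squarefree monomial contains each variable at most once.
E : ℕ → Series → Series
E zero    f α           = f α
E (suc m) f []          = 0ℤ
E (suc m) f (zero  ∷ α) = E (suc m) (∂ 0 f) α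
E (suc m) f (suc i ∷ α) = E (suc m) (∂ (suc i) f) α + E m (∂ i f) α

E-cong : ∀ m {f g} → f ≗ g → E m f ≗ E m g
E-cong zero    f≗g α           = f≗g α
E-cong (suc m) f≗g []          = refl
E-cong (suc m) f≗g (zero  ∷ α) = E-cong (suc m) (f≗g ∘ (0 ∷_)) α
E-cong (suc m) f≗g (suc i ∷ α) =
  cong₂ _+_ (E-cong (suc m) (f≗g ∘ (suc i ∷_)) α) (E-cong m (f≗g ∘ (i ∷_)) α)

E-linear : ∀ m x f g → E m (λ α → x * f α + g α) ≗ λ α → x * E m f α + E m g α
E-linear zero    x f g α           = refl
E-linear (suc m) x f g []          = sym (≡-trans (ℤ.+-identityʳ _) (ℤ.*-zeroʳ x))
E-linear (suc m) x f g (zero  ∷ α) = E-linear (suc m) x (∂ 0 f) (∂ 0 g) α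
E-linear (suc m) x f g (suc i ∷ α)
  rewrite E-linear (suc m) x (∂ (suc i) f) (∂ (suc i) g) α | E-linear m x (∂ i f) (∂ i g) α
  = rearrange x _ _ _ _
  where
  rearrange : ∀ x a b c d → (x * a + b) + (x * c + d) ≡ x * (a + c) + (b + d)
  rearrange = solve-∀

E-+ : ∀ m f g → E m (λ α → f α + g α) ≗ λ α → E m f α + E m g α
E-+ m f g α = begin
  E m (λ α → f α + g α) α        ≡⟨ E-cong m (λ β → cong₂ _+_ (sym (ℤ.*-identityˡ (f β))) refl) α ⟩
  E m (λ α → 1ℤ * f α + g α) α   ≡⟨ E-linear m 1ℤ f g α ⟩
  1ℤ * E m f α + E m g α         ≡⟨ cong₂ _+_ (ℤ.*-identityˡ (E m f α)) refl ⟩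
  E m f α + E m g α              ∎

-- Both sides expand according to which of the two factors use the first variable; the terms where
-- exactly one does change places. An exponent 1 cannot serve both factors, hence the case split on
-- `i`.
E-comm : ∀ m n f → E m (E n f) ≗ E n (E m f)
E-comm zero    n       f α           = refl
E-comm (suc m) zero    f α           = refl
E-comm (suc m) (suc n) f []          = refl
E-comm (suc m) (suc n) f (zero  ∷ α) = E-comm (suc m) (suc n) (∂ 0 f) α
E-comm (suc m) (suc n) f (suc i ∷ α)
  rewrite E-+ (suc m) (E (suc n) (∂ (suc i) f)) (E n (∂ i f)) α
        | E-+ (suc n) (E (suc m) (∂ (suc i) f)) (E m (∂ i f)) α
        | E-comm (suc m) (suc n) (∂ (suc i) f) α
        | E-comm (suc m) n (∂ i f) α
  with i
... | zero  rewrite E-comm m (suc n) (∂ 0 f) α = exchange (E (suc n) (E (suc m) (∂ 1 f)) α) _ (E (suc n) (E m (∂ 0 f)) α)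
  where
  exchange : ∀ x y z → (x + y) + z ≡ (x + z) + y
  exchange = solve-∀
... | suc i
  rewrite E-+ m (E (suc n) (∂ (suc i) f)) (E n (∂ i f)) α
        | E-+ n (E (suc m) (∂ (suc i) f)) (E m (∂ i f)) α
        | E-comm m (suc n) (∂ (suc i) f) α
        | E-comm m n (∂ i f) α
  = exchange (E (suc n) (E (suc m) (∂ (suc (suc i)) f)) α) (E n (E (suc m) (∂ (suc i) f)) α) _ (E n (E m (∂ i f)) α)
  where
  exchange : ∀ x y z w → (x + y) + (z + w) ≡ (x + z) + (y + w)
  exchange = solve-∀

e-zero : e 0 ≗ one
e-zero []          = refl
e-zero (zero  ∷ α) = e-zero α
e-zero (suc zero ∷ α) with does (All.all? (_≤? 1) α)
... | true = refl
... | false = refl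
e-zero (suc (suc i) ∷ α) = refl

private
  convolve : (Monomial → Monomial → ℤ) → List (Monomial × Monomial) → ℤ
  convolve Φ ps = ∑ (map (λ (β , γ) → Φ β γ) ps)

  convolve-× : ∀ Φ a (g : ℕ → ℕ) ps n →
    convolve Φ (cartesianProductWith (λ i (β , γ) → (i ∷ β) , ((a ∸ i) ∷ γ)) (applyUpTo g n) ps)
    ≡ ∑ (applyUpTo (λ i → convolve (λ β γ → Φ (g i ∷ β) ((a ∸ g i) ∷ γ)) ps) n)
  convolve-× Φ a g ps zero    = refl
  convolve-× Φ a g ps (suc n) = begin
    ∑ (map _ (map _ ps ++ _))
      ≡⟨ cong ∑ (map-++ _ (map _ ps) _) ⟩
    ∑ (map _ (map _ ps) ++ _)
      ≡⟨ ∑-++ (map _ (map _ ps)) _ ⟩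
    ∑ (map _ (map _ ps)) + _
      ≡⟨ cong₂ _+_ (cong ∑ (sym (map-∘ ps))) (convolve-× Φ a (g ∘ suc) ps n) ⟩
    _ ∎

⊛-∷ : ∀ f g a α →
  (f ⊛ g) (a ∷ α) ≡ ∑ (applyUpTo (λ i → (∂ i f ⊛ ∂ (a ∸ i) g) α) (suc a))
⊛-∷ f g a α = convolve-× (λ β γ → f β * g γ) a id (factorisations α) (suc a)

⊛-zeroˡ : ∀ {f} g → (∀ β → f β ≡ 0ℤ) → ∀ α → (f ⊛ g) α ≡ 0ℤ
⊛-zeroˡ g f≡0 α =
  ∑-map-0 (factorisations α) λ (β , γ) → ≡-trans (cong (_* g γ) (f≡0 β)) (ℤ.*-zeroˡ (g γ))

⊛-congˡ : ∀ {f f′} g → f ≗ f′ → f ⊛ g ≗ f′ ⊛ g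
⊛-congˡ g f≗f′ α = cong ∑ (map-cong (λ (β , γ) → cong (_* g γ) (f≗f′ β)) (factorisations α))

∑-applyUpTo-0 : ∀ (f : ℕ → ℤ) n → (∀ i → f i ≡ 0ℤ) → ∑ (applyUpTo f n) ≡ 0ℤ
∑-applyUpTo-0 f zero    f≡0 = refl
∑-applyUpTo-0 f (suc n) f≡0 = cong₂ _+_ (f≡0 0) (∑-applyUpTo-0 (f ∘ suc) n (f≡0 ∘ suc))

one-⊛ : ∀ f → one ⊛ f ≗ f
one-⊛ f []      = ≡-trans (ℤ.+-identityʳ _) (ℤ.*-identityˡ _)
one-⊛ f (a ∷ α) = begin
  (one ⊛ f) (a ∷ α)  ≡⟨ ⊛-∷ one f a α ⟩
  (one ⊛ ∂ a f) α + _ ≡⟨ cong₂ _+_ (one-⊛ (∂ a f) α) (∑-applyUpTo-0 _ a λ i → ⊛-zeroˡ (∂ (a ∸ suc i) f) (λ _ → refl) α) ⟩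
  f (a ∷ α) + 0ℤ      ≡⟨ ℤ.+-identityʳ _ ⟩
  f (a ∷ α)           ∎

-- In the Cauchy product over the exponent of the first variable only 0 and 1 survive, because `e m`
-- vanishes on larger exponents.
E-⊛ : ∀ m f → e m ⊛ f ≗ E m f
E-⊛ zero    f α        = ≡-trans (⊛-congˡ f e-zero α) (one-⊛ f α)
E-⊛ (suc m) f []       = refl
E-⊛ (suc m) f (zero ∷ α) = begin
  (e (suc m) ⊛ f) (0 ∷ α)         ≡⟨ ⊛-∷ (e (suc m)) f 0 α ⟩
  (e (suc m) ⊛ ∂ 0 f) α + 0ℤ      ≡⟨ ℤ.+-identityʳ _ ⟩
  (e (suc m) ⊛ ∂ 0 f) α           ≡⟨ E-⊛ (suc m) (∂ 0 f) α ⟩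
  E (suc m) (∂ 0 f) α             ∎
E-⊛ (suc m) f (suc a ∷ α) = begin
  (e (suc m) ⊛ f) (suc a ∷ α)
    ≡⟨ ⊛-∷ (e (suc m)) f (suc a) α ⟩
  (e (suc m) ⊛ ∂ (suc a) f) α + ((e m ⊛ ∂ a f) α + _)
    ≡⟨ cong₂ _+_ (E-⊛ (suc m) (∂ (suc a) f) α) (cong₂ _+_ (E-⊛ m (∂ a f) α)
         (∑-applyUpTo-0 _ a λ i → ⊛-zeroˡ (∂ (a ∸ suc i) f) (λ _ → refl) α)) ⟩
  E (suc m) (∂ (suc a) f) α + (E m (∂ a f) α + 0ℤ)
    ≡⟨ cong (λ z → E (suc m) (∂ (suc a) f) α + z) (ℤ.+-identityʳ _) ⟩
  E (suc m) f (suc a ∷ α) ∎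

e[]-∷ : ∀ m μ → e[ m ∷ μ ] ≗ E m e[ μ ]
e[]-∷ m μ = E-⊛ m e[ μ ]

-- Functionals extracting coefficients of the e-expansion

e[]-↭ : ∀ {μ ν} → μ ↭ ν → e[ μ ] ≗ e[ ν ]
e[]-↭ refl α = refl
e[]-↭ {m ∷ μ} {_ ∷ ν} (prep m p) α = begin
  e[ m ∷ μ ] α   ≡⟨ e[]-∷ m μ α ⟩
  E m e[ μ ] α   ≡⟨ E-cong m (e[]-↭ p) α ⟩
  E m e[ ν ] α   ≡⟨ e[]-∷ m ν α ⟨
  e[ m ∷ ν ] α   ∎
e[]-↭ {m ∷ n ∷ μ} {_ ∷ _ ∷ ν} (swap m n p) α = begin
  e[ m ∷ n ∷ μ ] α    ≡⟨ e[]-∷ m (n ∷ μ) α ⟩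
  E m e[ n ∷ μ ] α    ≡⟨ E-cong m (e[]-∷ n μ) α ⟩
  E m (E n e[ μ ]) α  ≡⟨ E-cong m (E-cong n (e[]-↭ p)) α ⟩
  E m (E n e[ ν ]) α  ≡⟨ E-comm m n e[ ν ] α ⟩
  E n (E m e[ ν ]) α  ≡⟨ E-cong n (e[]-∷ m ν) α ⟨
  E n e[ m ∷ ν ] α    ≡⟨ e[]-∷ n (m ∷ ν) α ⟨
  e[ n ∷ m ∷ ν ] α    ∎
e[]-↭ (trans p q) α = ≡-trans (e[]-↭ p α) (e[]-↭ q α)

-- `T` evaluates series at compositions, but `E` can lower an exponent 1 to 0. Deleting that zero
-- leads back to a composition.
record ZeroInsensitive (g : Series) : Set where
  constructor zeroInsensitive
  field delete-zero : ∀ β α → g (β ++ 0 ∷ α) ≡ g (β ++ α)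

open ZeroInsensitive

∂-zeroInsensitive : ∀ {g} i → ZeroInsensitive g → ZeroInsensitive (∂ i g)
∂-zeroInsensitive i z .delete-zero β = delete-zero z (i ∷ β)

*-zeroInsensitive : ∀ x {g} → ZeroInsensitive g → ZeroInsensitive (λ α → x * g α)
*-zeroInsensitive x z .delete-zero β α = cong (λ y → x * y) (delete-zero z β α)

E-zeroInsensitive : ∀ m {g} → ZeroInsensitive g → ZeroInsensitive (E m g)
E-zeroInsensitive zero    z .delete-zero β           α = delete-zero z β α
E-zeroInsensitive (suc m) z .delete-zero []          α = E-cong (suc m) (delete-zero z []) α
E-zeroInsensitive (suc m) z .delete-zero (zero  ∷ β) α =
  delete-zero (E-zeroInsensitive (suc m) (∂-zeroInsensitive 0 z)) β α
E-zeroInsensitive (suc m) z .delete-zero (suc i ∷ β) α = cong₂ _+_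
  (delete-zero (E-zeroInsensitive (suc m) (∂-zeroInsensitive (suc i) z)) β α)
  (delete-zero (E-zeroInsensitive m (∂-zeroInsensitive i z)) β α)

zeroInsensitive-≗ : ∀ {f g} → f ≗ g → ZeroInsensitive g → ZeroInsensitive f
zeroInsensitive-≗ f≗g z .delete-zero β α =
  ≡-trans (f≗g (β ++ 0 ∷ α)) (≡-trans (delete-zero z β α) (sym (f≗g (β ++ α))))

one-zeroInsensitive : ZeroInsensitive one
one-zeroInsensitive = zeroInsensitive go
  where
  go : ∀ β α → one (β ++ 0 ∷ α) ≡ one (β ++ α)
  go []          α = refl
  go (zero ∷ β)  α = go β α
  go (suc _ ∷ β) α = refl

e[]-zeroInsensitive : ∀ μ → ZeroInsensitive e[ μ ]
e[]-zeroInsensitive []      = one-zeroInsensitive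
e[]-zeroInsensitive (m ∷ μ) =
  zeroInsensitive-≗ (e[]-∷ m μ) (E-zeroInsensitive m (e[]-zeroInsensitive μ))

E-* : ∀ m x f → E m (λ α → x * f α) ≗ λ α → x * E m f α
E-* zero    x f α           = refl
E-* (suc m) x f []          = sym (ℤ.*-zeroʳ x)
E-* (suc m) x f (zero  ∷ α) = E-* (suc m) x (∂ 0 f) α
E-* (suc m) x f (suc i ∷ α) = ≡-trans
  (cong₂ _+_ (E-* (suc m) x (∂ (suc i) f) α) (E-* m x (∂ i f) α))
  (sym (ℤ.*-distribˡ-+ x (E (suc m) (∂ (suc i) f) α) (E m (∂ i f) α)))

-- T n g = ∑ (-1)^(n - ℓ(α)) g(α) over the compositions α of n; it maps e_n to 1.
-- R n φ = ∑ (-1)^j T (n - j) (φ j) over 0 ≤ j ≤ n, where j + 1 is the first part.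
T : ℕ → Series → ℤ
R : ℕ → (ℕ → Series) → ℤ
T zero    g = g []
T (suc n) g = R n (λ j → ∂ (suc j) g)
R zero    φ = T 0 (φ 0)
R (suc n) φ = T (suc n) (φ 0) - R n (φ ∘ suc)

T-cong : ∀ n {f g} → f ≗ g → T n f ≡ T n g
R-cong : ∀ n {φ ψ} → (∀ j → φ j ≗ ψ j) → R n φ ≡ R n ψ
T-cong zero    f≗g = f≗g []
T-cong (suc n) f≗g = R-cong n λ j α → f≗g (suc j ∷ α)
R-cong zero    φ≗ψ = φ≗ψ 0 []
R-cong (suc n) φ≗ψ = cong₂ _-_ (T-cong (suc n) (φ≗ψ 0)) (R-cong n (φ≗ψ ∘ suc))

T-linear : ∀ n x f g → T n (λ α → x * f α + g α) ≡ x * T n f + T n g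
R-linear : ∀ n x φ ψ → R n (λ j α → x * φ j α + ψ j α) ≡ x * R n φ + R n ψ
T-linear zero    x f g = refl
T-linear (suc n) x f g = R-linear n x (λ j → ∂ (suc j) f) (λ j → ∂ (suc j) g)
R-linear zero    x φ ψ = refl
R-linear (suc n) x φ ψ = ≡-trans
  (cong₂ _-_ (T-linear (suc n) x (φ 0) (ψ 0)) (R-linear n x (φ ∘ suc) (ψ ∘ suc)))
  (rearrange x (T (suc n) (φ 0)) (T (suc n) (ψ 0)) (R n (φ ∘ suc)) (R n (ψ ∘ suc)))
  where
  rearrange : ∀ x a b c d → (x * a + b) - (x * c + d) ≡ x * (a - c) + (b - d)
  rearrange = solve-∀

R-+ : ∀ n φ ψ → R n (λ j α → φ j α + ψ j α) ≡ R n φ + R n ψ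
R-+ n φ ψ = begin
  R n (λ j α → φ j α + ψ j α)       ≡⟨ R-cong n (λ j α → cong (_+ ψ j α) (sym (ℤ.*-identityˡ (φ j α)))) ⟩
  R n (λ j α → 1ℤ * φ j α + ψ j α)  ≡⟨ R-linear n 1ℤ φ ψ ⟩
  1ℤ * R n φ + R n ψ                ≡⟨ cong (_+ R n ψ) (ℤ.*-identityˡ (R n φ)) ⟩
  R n φ + R n ψ                     ∎

R-0 : ∀ n → R n (λ _ _ → 0ℤ) ≡ 0ℤ
R-0 zero          = refl
R-0 (suc n) rewrite R-0 n = refl

-- Multiplication of the generating function of `s` by z^m, which is what multiplication by e_m
-- becomes under e_m ↦ z^m.
delay : ℕ → (ℕ → ℤ) → ℕ → ℤ
delay zero    s n       = s n
delay (suc m) s zero    = 0ℤ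
delay (suc m) s (suc n) = delay m s n

private
  delay-cong : ∀ m {s t} → s ≗ t → delay m s ≗ delay m t
  delay-cong zero    s≗t n       = s≗t n
  delay-cong (suc m) s≗t zero    = refl
  delay-cong (suc m) s≗t (suc n) = delay-cong m s≗t n

  delay-0 : ∀ m {s t} → s 0 ≡ t 0 → delay m s 0 ≡ delay m t 0
  delay-0 zero    p = p
  delay-0 (suc m) p = refl

  delay-minus : ∀ m s t u → s 0 ≡ t 0 → (∀ n → s (suc n) ≡ t (suc n) - u n) →
            ∀ n → delay m s (suc n) ≡ delay m t (suc n) - delay m u n
  delay-minus zero    s t u p q n       = q n
  delay-minus (suc m) s t u p q zero    = ≡-trans (delay-0 m {s} {t} p) (sym (ℤ.+-identityʳ _))
  delay-minus (suc m) s t u p q (suc n) = delay-minus m s t u p q n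

  delay-suc : ∀ m s n → delay (suc m) (s ∘ suc) n + delay m (λ n → s 0 * δ 0 n) n ≡ delay m s n
  delay-suc zero    s zero    = ≡-trans (ℤ.+-identityˡ _) (ℤ.*-identityʳ (s 0))
  delay-suc zero    s (suc n) =
    ≡-trans (cong (λ z → s (suc n) + z) (ℤ.*-zeroʳ (s 0))) (ℤ.+-identityʳ _)
  delay-suc (suc m) s zero    = refl
  delay-suc (suc m) s (suc n) = delay-suc m s n

  delay-neg : ∀ m s u x → s 0 ≡ x → (∀ n → s (suc n) ≡ - u n) →
              ∀ n → delay (suc m) u n + delay m s n ≡ x * δ m n
  delay-neg zero    s u x p q zero    =
    ≡-trans (ℤ.+-identityˡ (s 0)) (≡-trans p (sym (ℤ.*-identityʳ x)))
  delay-neg zero    s u x p q (suc n) =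
    ≡-trans (cong (λ z → u n + z) (q n)) (≡-trans (ℤ.+-inverseʳ (u n)) (sym (ℤ.*-zeroʳ x)))
  delay-neg (suc m) s u x p q zero    = sym (ℤ.*-zeroʳ x)
  delay-neg (suc m) s u x p q (suc n) = delay-neg m s u x p q n

-- A first part 0 can be deleted and gives `T` of `g`; the positive first parts give the same value
-- with the opposite sign, since the index has moved by one.
R-∂ : ∀ g → ZeroInsensitive g → ∀ n → R n (λ j → ∂ j g) ≡ g [] * δ 0 n
R-∂ g z zero    = ≡-trans (delete-zero z [] []) (sym (ℤ.*-identityʳ (g [])))
R-∂ g z (suc n) = begin
  T (suc n) (∂ 0 g) - T (suc n) g  ≡⟨ cong (_- T (suc n) g) (T-cong (suc n) (delete-zero z [])) ⟩
  T (suc n) g - T (suc n) g        ≡⟨ ℤ.+-inverseʳ (T (suc n) g) ⟩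
  0ℤ                               ≡⟨ ℤ.*-zeroʳ (g []) ⟨
  g [] * 0ℤ                        ∎

-- The variable of the first part is either skipped or used by e_m. By `R-∂` the second case leaves
-- only the constant term `g []`, which is the initial value that the shifted sequence of the first
-- case lacks.
T-E : ∀ m n g → ZeroInsensitive g → T n (E m g) ≡ delay m (λ n → T n g) n
R-E : ∀ m n φ → (∀ j → ZeroInsensitive (φ j)) → R n (λ j → E m (φ j)) ≡ delay m (λ n → R n φ) n
T-E zero    n       g z = refl
T-E (suc m) zero    g z = refl
T-E (suc m) (suc n) g z = begin
  R n (λ j α → E (suc m) (∂ (suc j) g) α + E m (∂ j g) α)
    ≡⟨ R-+ n (λ j → E (suc m) (∂ (suc j) g)) (λ j → E m (∂ j g)) ⟩
  R n (λ j → E (suc m) (∂ (suc j) g)) + R n (λ j → E m (∂ j g))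
    ≡⟨ cong₂ _+_ (R-E (suc m) n (λ j → ∂ (suc j) g) (λ j → ∂-zeroInsensitive (suc j) z))
                 (R-E m n (λ j → ∂ j g) (λ j → ∂-zeroInsensitive j z)) ⟩
  delay (suc m) (λ n → T (suc n) g) n + delay m (λ n → R n (λ j → ∂ j g)) n
    ≡⟨ cong (λ w → delay (suc m) (λ n → T (suc n) g) n + w) (delay-cong m (R-∂ g z) n) ⟩
  delay (suc m) (λ n → T (suc n) g) n + delay m (λ n → g [] * δ 0 n) n
    ≡⟨ delay-suc m (λ n → T n g) n ⟩
  delay m (λ n → T n g) n ∎
R-E zero    n       φ z = refl
R-E (suc m) zero    φ z = refl
R-E (suc m) (suc n) φ z = ≡-trans
  (cong₂ _-_ (T-E (suc m) (suc n) (φ 0) (z 0)) (R-E (suc m) n (φ ∘ suc) (z ∘ suc)))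
  (sym (delay-minus (suc m) (λ n → R n φ) (λ n → T n (φ 0)) (λ n → R n (φ ∘ suc)) refl (λ _ → refl) n))

-- ∑ (-1)^(n - ℓ(α)) α₁ g(α) over the compositions α of n: the coefficient of e_n in g.
M : ℕ → Series → ℤ
M zero    f = 0ℤ
M (suc n) f = R n (λ j α → pos (suc j) * f (suc j ∷ α))

M-cong : ∀ n {f g} → f ≗ g → M n f ≡ M n g
M-cong zero    f≗g = refl
M-cong (suc n) f≗g = R-cong n λ j α → cong (λ z → pos (suc j) * z) (f≗g (suc j ∷ α))

M-linear : ∀ n x f g → M n (λ α → x * f α + g α) ≡ x * M n f + M n g
M-linear zero    x f g = sym (≡-trans (ℤ.+-identityʳ _) (ℤ.*-zeroʳ x))
M-linear (suc n) x f g = ≡-trans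
  (R-cong n λ j α → rearrange (pos (suc j)) x (f (suc j ∷ α)) (g (suc j ∷ α)))
  (R-linear n x (λ j α → pos (suc j) * f (suc j ∷ α)) (λ j α → pos (suc j) * g (suc j ∷ α)))
  where
  rearrange : ∀ p x a b → p * (x * a + b) ≡ x * (p * a) + p * b
  rearrange = solve-∀

M-+ : ∀ n f g → M n (λ α → f α + g α) ≡ M n f + M n g
M-+ n f g = begin
  M n (λ α → f α + g α)       ≡⟨ M-cong n (λ α → cong (_+ g α) (sym (ℤ.*-identityˡ (f α)))) ⟩
  M n (λ α → 1ℤ * f α + g α)  ≡⟨ M-linear n 1ℤ f g ⟩
  1ℤ * M n f + M n g          ≡⟨ cong (_+ M n g) (ℤ.*-identityˡ (M n f)) ⟩
  M n f + M n g               ∎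

-- If e_(m+1) uses the variable of the first part, the weight `suc j` exceeds the remaining exponent
-- `j` by one. The share `j` of the weight cancels the case where the variable is skipped; the
-- excess 1 collapses by `R-∂` to `g []`.
M-E : ∀ m N g → ZeroInsensitive g → M N (E (suc m) g) ≡ g [] * δ (suc m) N
M-E m zero    g z = sym (ℤ.*-zeroʳ (g []))
M-E m (suc n) g z = begin
  R n (λ j α → pos (suc j) * (E (suc m) (∂ (suc j) g) α + E m (∂ j g) α))
    ≡⟨ R-cong n (λ j α → ≡-trans (ℤ.*-distribˡ-+ (pos (suc j)) (E (suc m) (∂ (suc j) g) α) (E m (∂ j g) α))
         (sym (cong₂ _+_ (E-* (suc m) (pos (suc j)) (∂ (suc j) g) α) (E-* m (pos (suc j)) (∂ j g) α)))) ⟩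
  R n (λ j α → E (suc m) (φ j) α + E m (ψ j) α)
    ≡⟨ R-+ n (λ j → E (suc m) (φ j)) (λ j → E m (ψ j)) ⟩
  R n (λ j → E (suc m) (φ j)) + R n (λ j → E m (ψ j))
    ≡⟨ cong₂ _+_ (R-E (suc m) n φ (λ j → *-zeroInsensitive (pos (suc j)) (∂-zeroInsensitive (suc j) z)))
                 (R-E m n ψ (λ j → *-zeroInsensitive (pos (suc j)) (∂-zeroInsensitive j z))) ⟩
  delay (suc m) (λ n → R n φ) n + delay m (λ n → R n ψ) n
    ≡⟨ delay-neg m (λ n → R n ψ) (λ n → R n φ) (g []) Rψ-zero Rψ-suc n ⟩
  g [] * δ m n ∎
  where
  φ ψ : ℕ → Series
  φ j α = pos (suc j) * g (suc j ∷ α)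
  ψ j α = pos (suc j) * g (j ∷ α)
  Rψ : ∀ n → R n ψ ≡ R n (λ j α → pos j * g (j ∷ α)) + g [] * δ 0 n
  Rψ n = begin
    R n ψ ≡⟨ R-cong n (λ j α → ≡-trans (cong (_* g (j ∷ α)) (ℤ.+-comm 1ℤ (pos j)))
               (≡-trans (ℤ.*-distribʳ-+ (g (j ∷ α)) (pos j) 1ℤ)
                 (cong (λ w → pos j * g (j ∷ α) + w) (ℤ.*-identityˡ (g (j ∷ α)))))) ⟩
    R n (λ j α → pos j * g (j ∷ α) + g (j ∷ α))
      ≡⟨ R-+ n (λ j α → pos j * g (j ∷ α)) (λ j → ∂ j g) ⟩
    R n (λ j α → pos j * g (j ∷ α)) + R n (λ j → ∂ j g)
      ≡⟨ cong (λ w → R n (λ j α → pos j * g (j ∷ α)) + w) (R-∂ g z n) ⟩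
    R n (λ j α → pos j * g (j ∷ α)) + g [] * δ 0 n ∎
  Rψ-zero : R 0 ψ ≡ g []
  Rψ-zero = ≡-trans (ℤ.*-identityˡ (g (0 ∷ []))) (delete-zero z [] [])
  Rψ-suc : ∀ n → R (suc n) ψ ≡ - R n φ
  Rψ-suc n = begin
    R (suc n) ψ
      ≡⟨ Rψ (suc n) ⟩
    (T (suc n) (λ α → 0ℤ) - R n φ) + g [] * 0ℤ
      ≡⟨ cong₂ _+_ (cong (_- R n φ) (R-0 n)) (ℤ.*-zeroʳ (g [])) ⟩
    (0ℤ - R n φ) + 0ℤ
      ≡⟨ ≡-trans (ℤ.+-identityʳ (0ℤ - R n φ)) (ℤ.+-identityˡ (- R n φ)) ⟩
    - R n φ ∎

-- For k ≥ 2, the coefficient of e_(k, 1^d) in a symmetric function of degree k + d: the part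
-- linear in u under ∑ e_m z^m ↦ 1 + tz + uz^k. One variable specialises to t, its exponent
-- i ≤ d being extracted by ∂; the remaining ones enter through M (k + d - i).
L : ℕ → ℕ → Series → ℤ
L k zero    f = M k (∂ 0 f)
L k (suc d) f = M k (∂ (suc d) f) - L (suc k) d f

L-cong : ∀ k d {f g} → f ≗ g → L k d f ≡ L k d g
L-cong k zero    f≗g = M-cong k (f≗g ∘ (0 ∷_))
L-cong k (suc d) f≗g = cong₂ _-_ (M-cong k (f≗g ∘ (suc d ∷_))) (L-cong (suc k) d f≗g)

L-linear : ∀ k d x f g → L k d (λ α → x * f α + g α) ≡ x * L k d f + L k d g
L-linear k zero    x f g = M-linear k x (∂ 0 f) (∂ 0 g)
L-linear k (suc d) x f g = ≡-trans
  (cong₂ _-_ (M-linear k x (∂ (suc d) f) (∂ (suc d) g)) (L-linear (suc k) d x f g))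
  (rearrange x (M k (∂ (suc d) f)) (M k (∂ (suc d) g)) (L (suc k) d f) (L (suc k) d g))
  where
  rearrange : ∀ x a b c d → (x * a + b) - (x * c + d) ≡ x * (a - c) + (b - d)
  rearrange = solve-∀

M-0 : ∀ n → M n (λ _ → 0ℤ) ≡ 0ℤ
M-0 zero    = refl
M-0 (suc n) = ≡-trans (R-cong n λ j _ → ℤ.*-zeroʳ (pos (suc j))) (R-0 n)

L-0 : ∀ k d → L k d (λ _ → 0ℤ) ≡ 0ℤ
L-0 k zero    = M-0 k
L-0 k (suc d) = cong₂ _-_ (M-0 k) (L-0 (suc k) d)

L-∑ : ∀ {a} {A : Set a} k d (c : A → ℤ) (f : A → Series) xs →
      L k d (λ α → ∑ (map (λ x → c x * f x α) xs)) ≡ ∑ (map (λ x → c x * L k d (f x)) xs)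
L-∑ k d c f []       = L-0 k d
L-∑ k d c f (x ∷ xs) = ≡-trans
  (L-linear k d (c x) (f x) (λ α → ∑ (map (λ x → c x * f x α) xs)))
  (cong (λ z → c x * L k d (f x) + z) (L-∑ k d c f xs))

-- Either e_(m+2) uses the variable specialised to t or it does not. The used part of each term
-- cancels against the rest of the alternating sum, leaving the leading term, where the whole power
-- t^d comes from `g`.
L-E : ∀ k d m g → ZeroInsensitive g →
      L (suc k) d (E (suc (suc m)) g) ≡ g (d ∷ []) * δ (suc (suc m)) (suc k)
L-E k zero    m g z = M-E (suc m) (suc k) (∂ 0 g) (∂-zeroInsensitive 0 z)
L-E k (suc d) m g z = begin
  M (suc k) (λ α → E (suc (suc m)) (∂ (suc d) g) α + E (suc m) (∂ d g) α)
    - L (suc (suc k)) d (E (suc (suc m)) g)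
    ≡⟨ cong₂ _-_ (≡-trans (M-+ (suc k) (E (suc (suc m)) (∂ (suc d) g)) (E (suc m) (∂ d g)))
         (cong₂ _+_ (M-E (suc m) (suc k) (∂ (suc d) g) (∂-zeroInsensitive (suc d) z))
                    (M-E m (suc k) (∂ d g) (∂-zeroInsensitive d z))))
         (L-E (suc k) d m g z) ⟩
  (g (suc d ∷ []) * δ (suc m) k + g (d ∷ []) * δ m k) - g (d ∷ []) * δ m k
    ≡⟨ cancel (g (suc d ∷ []) * δ (suc m) k) (g (d ∷ []) * δ m k) ⟩
  g (suc d ∷ []) * δ (suc m) k ∎
  where
  cancel : ∀ a b → (a + b) - b ≡ a
  cancel = solve-∀

M-E₁ : ∀ k g → ZeroInsensitive g → M (suc (suc k)) (E 1 g) ≡ 0ℤ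
M-E₁ k g z = ≡-trans (M-E 0 (suc (suc k)) g z) (ℤ.*-zeroʳ (g []))

L-E₁-zero : ∀ k g → ZeroInsensitive g → L (suc (suc k)) 0 (E 1 g) ≡ 0ℤ
L-E₁-zero k g z = M-E₁ k (∂ 0 g) (∂-zeroInsensitive 0 z)

-- `M` in degree at least 2 kills multiples of e_1, so the factor e_1 must take the variable
-- specialised to t; this shifts the alternating sum by one place.
L-E₁-suc : ∀ k d g → ZeroInsensitive g → L (suc (suc k)) (suc d) (E 1 g) ≡ L (suc (suc k)) d g
L-E₁-suc k d g z = begin
  M (suc (suc k)) (λ α → E 1 (∂ (suc d) g) α + g (d ∷ α)) - L (suc (suc (suc k))) d (E 1 g)
    ≡⟨ cong (_- L (suc (suc (suc k))) d (E 1 g))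
         (≡-trans (M-+ (suc (suc k)) (E 1 (∂ (suc d) g)) (∂ d g))
           (cong (_+ M (suc (suc k)) (∂ d g)) (M-E₁ k (∂ (suc d) g) (∂-zeroInsensitive (suc d) z)))) ⟩
  (0ℤ + M (suc (suc k)) (∂ d g)) - L (suc (suc (suc k))) d (E 1 g)
    ≡⟨ cong (_- L (suc (suc (suc k))) d (E 1 g)) (ℤ.+-identityˡ (M (suc (suc k)) (∂ d g))) ⟩
  M (suc (suc k)) (∂ d g) - L (suc (suc (suc k))) d (E 1 g)
    ≡⟨ rest d ⟩
  L (suc (suc k)) d g ∎
  where
  rest : ∀ d → M (suc (suc k)) (∂ d g) - L (suc (suc (suc k))) d (E 1 g) ≡ L (suc (suc k)) d g
  rest zero    = ≡-trans (cong (λ w → M (suc (suc k)) (∂ 0 g) - w) (L-E₁-zero (suc k) g z))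
                         (ℤ.+-identityʳ (M (suc (suc k)) (∂ 0 g)))
  rest (suc d) = cong (λ w → M (suc (suc k)) (∂ (suc d) g) - w) (L-E₁-suc (suc k) d g z)

M-one : ∀ k → M k one ≡ 0ℤ
M-one zero    = refl
M-one (suc k) = M-0 (suc k)

L-one : ∀ k d → L k d one ≡ 0ℤ
L-one k zero    = M-one k
L-one k (suc d) = cong₂ _-_ (M-0 k) (L-one (suc k) d)

e[1^d]-single : ∀ d → e[ replicate d 1 ] (d ∷ []) ≡ 1ℤ
e[1^d]-single zero    = refl
e[1^d]-single (suc d) = begin
  e[ 1 ∷ replicate d 1 ] (suc d ∷ [])   ≡⟨ e[]-∷ 1 (replicate d 1) (suc d ∷ []) ⟩
  0ℤ + e[ replicate d 1 ] (d ∷ [])      ≡⟨ ℤ.+-identityˡ _ ⟩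
  e[ replicate d 1 ] (d ∷ [])           ≡⟨ e[1^d]-single d ⟩
  1ℤ                                    ∎

-- No factor e_m with m > 1 has a term in a single variable.
e[]-single : ∀ d {μ} → All (0 <ⁿ_) μ → μ ≢ replicate d 1 → e[ μ ] (d ∷ []) ≡ 0ℤ
e[]-single zero    {[]}    _ μ≢ = ⊥-elim (μ≢ refl)
e[]-single (suc d) {[]}    _ _  = refl
e[]-single d       {zero ∷ μ}  (() ∷ _) _
e[]-single zero    {suc m ∷ μ} _ _ = e[]-∷ (suc m) μ (0 ∷ [])
e[]-single (suc d) {suc zero ∷ μ} (_ ∷ μ>0) μ≢ = begin
  e[ 1 ∷ μ ] (suc d ∷ [])   ≡⟨ e[]-∷ 1 μ (suc d ∷ []) ⟩
  0ℤ + e[ μ ] (d ∷ [])      ≡⟨ ℤ.+-identityˡ _ ⟩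
  e[ μ ] (d ∷ [])           ≡⟨ e[]-single d μ>0 (λ eq → μ≢ (cong (1 ∷_) eq)) ⟩
  0ℤ                        ∎
e[]-single (suc d) {suc (suc m) ∷ μ} _ _ = e[]-∷ (suc (suc m)) μ (suc d ∷ [])

δ-refl : ∀ n → δ n n ≡ 1ℤ
δ-refl zero    = refl
δ-refl (suc n) = δ-refl n

δ-≢ : ∀ {m n} → m ≢ n → δ m n ≡ 0ℤ
δ-≢ {zero}  {zero}  m≢n = ⊥-elim (m≢n refl)
δ-≢ {zero}  {suc n} _   = refl
δ-≢ {suc m} {zero}  _   = refl
δ-≢ {suc m} {suc n} m≢n = δ-≢ (m≢n ∘ cong suc)

L-e[hook] : ∀ k d → L (suc (suc k)) d e[ suc (suc k) ∷ replicate d 1 ] ≡ 1ℤ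
L-e[hook] k d = begin
  L (suc (suc k)) d e[ suc (suc k) ∷ replicate d 1 ]
    ≡⟨ L-cong (suc (suc k)) d (e[]-∷ (suc (suc k)) (replicate d 1)) ⟩
  L (suc (suc k)) d (E (suc (suc k)) e[ replicate d 1 ])
    ≡⟨ L-E (suc k) d k e[ replicate d 1 ] (e[]-zeroInsensitive (replicate d 1)) ⟩
  e[ replicate d 1 ] (d ∷ []) * δ k k
    ≡⟨ cong₂ _*_ (e[1^d]-single d) (δ-refl k) ⟩
  1ℤ ∎

private
  ones : ∀ {μ} → Linked _≥ⁿ_ (1 ∷ μ) → All (0 <ⁿ_) μ → ∀ k d → L (suc (suc k)) d e[ μ ] ≡ 0ℤ
  ones {[]}    _ _ k d = L-one (suc (suc k)) d
  ones {suc zero ∷ μ} (_ ∷ dec) (_ ∷ μ>0) k zero =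
    ≡-trans (L-cong (suc (suc k)) 0 (e[]-∷ 1 μ)) (L-E₁-zero k e[ μ ] (e[]-zeroInsensitive μ))
  ones {suc zero ∷ μ} (_ ∷ dec) (_ ∷ μ>0) k (suc d) =
    ≡-trans (L-cong (suc (suc k)) (suc d) (e[]-∷ 1 μ))
      (≡-trans (L-E₁-suc k d e[ μ ] (e[]-zeroInsensitive μ)) (ones dec μ>0 k d))
  ones {suc (suc m) ∷ μ} (s≤s () ∷ _) _ k d

-- The largest part comes first. If it is at least 2, `L-E` reduces the claim to separate tests of
-- head and tail; if it is 1, all parts are 1 and are stripped one by one.
L-e[≢hook] : ∀ k d {μ} → IsPartition μ → μ ≢ suc (suc k) ∷ replicate d 1 →
             L (suc (suc k)) d e[ μ ] ≡ 0ℤ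
L-e[≢hook] k d {[]} _ _ = L-one (suc (suc k)) d
L-e[≢hook] k d {zero ∷ μ} (_ , () ∷ _) _
L-e[≢hook] k d {suc zero ∷ μ} (dec , μ>0) _ = ones (s≤s z≤n ∷ dec) μ>0 k d
L-e[≢hook] k d {suc (suc m) ∷ μ} (dec , _ ∷ μ>0) μ≢ = begin
  L (suc (suc k)) d e[ suc (suc m) ∷ μ ]
    ≡⟨ L-cong (suc (suc k)) d (e[]-∷ (suc (suc m)) μ) ⟩
  L (suc (suc k)) d (E (suc (suc m)) e[ μ ])
    ≡⟨ L-E (suc k) d m e[ μ ] (e[]-zeroInsensitive μ) ⟩
  e[ μ ] (d ∷ []) * δ m k
    ≡⟨ vanish ⟩
  0ℤ ∎
  where
  vanish : e[ μ ] (d ∷ []) * δ m k ≡ 0ℤ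
  vanish with m ℕ.≟ k
  ... | yes refl = cong (_* δ m k) (e[]-single d μ>0 (μ≢ ∘ cong (suc (suc m) ∷_)))
  ... | no m≢k   = ≡-trans (cong (λ z → e[ μ ] (d ∷ []) * z) (δ-≢ m≢k)) (ℤ.*-zeroʳ (e[ μ ] (d ∷ [])))

-- Sums over the splittings of a list into two sublists

+-interchange : ∀ a b c d → (a + b) + (c + d) ≡ (a + c) + (b + d)
+-interchange = solve-∀

+-rotate : ∀ x y z → x + (y + z) ≡ y + (x + z)
+-rotate = solve-∀

*-rotate : ∀ x y z → x * (y * z) ≡ y * (x * z)
*-rotate = solve-∀

-- Conditions are kept as integers 0 and 1, so that conjunction is multiplication and the sums below
-- can be rearranged by ring identities.
Bit : ℤ → Set
Bit x = x ≡ 0ℤ ⊎ x ≡ 1ℤ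

indicator-bit : ∀ b → Bit (indicator b)
indicator-bit true  = inj₂ refl
indicator-bit false = inj₁ refl

*-bit : ∀ {x y} → Bit x → Bit y → Bit (x * y)
*-bit         (inj₁ refl) _ = inj₁ refl
*-bit {y = y} (inj₂ refl) b = subst Bit (sym (ℤ.*-identityˡ y)) b

bit-nonneg : ∀ {x} → Bit x → 0ℤ ≤ x
bit-nonneg (inj₁ refl) = ℤ.≤-refl
bit-nonneg (inj₂ refl) = +≤+ z≤n

bits-*≡1 : ∀ {x y} → Bit x → Bit y → x * y ≡ 1ℤ → x ≡ 1ℤ × y ≡ 1ℤ
bits-*≡1 (inj₂ refl) (inj₂ refl) _ = refl , refl
bits-*≡1 (inj₂ refl) (inj₁ refl) ()
bits-*≡1 (inj₁ refl) _           ()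

*-nonneg : ∀ {x y} → 0ℤ ≤ x → 0ℤ ≤ y → 0ℤ ≤ x * y
*-nonneg {pos m} {pos n} _ _ = subst (0ℤ ≤_) (ℤ.pos-* m n) (+≤+ z≤n)

sign : ℕ → ℤ
sign zero    = 1ℤ
sign (suc n) = - sign n

module _ {A : Set} where

  -- Lists stand for vertex sets, and this is the convolution of set functions. Both sublists keep
  -- the order of the list, so independence of the order is a separate fact, `∑⊔-↭`.
  ∑⊔ : (List A → List A → ℤ) → List A → ℤ
  ∑⊔ Φ []      = Φ [] []
  ∑⊔ Φ (v ∷ U) = ∑⊔ (λ B Q → Φ (v ∷ B) Q) U + ∑⊔ (λ B Q → Φ B (v ∷ Q)) U

  ∑⊔-cong : ∀ {Φ Ψ} U → (∀ {B Q} → Interleaving B Q U → Φ B Q ≡ Ψ B Q) → ∑⊔ Φ U ≡ ∑⊔ Ψ U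
  ∑⊔-cong []      Φ≡Ψ = Φ≡Ψ []
  ∑⊔-cong (v ∷ U) Φ≡Ψ = cong₂ _+_ (∑⊔-cong U (λ i → Φ≡Ψ (consˡ i))) (∑⊔-cong U (λ i → Φ≡Ψ (consʳ i)))

  ∑⊔-+ : ∀ Φ Ψ U → ∑⊔ (λ B Q → Φ B Q + Ψ B Q) U ≡ ∑⊔ Φ U + ∑⊔ Ψ U
  ∑⊔-+ Φ Ψ []      = refl
  ∑⊔-+ Φ Ψ (v ∷ U) = ≡-trans
    (cong₂ _+_ (∑⊔-+ (λ B Q → Φ (v ∷ B) Q) (λ B Q → Ψ (v ∷ B) Q) U)
               (∑⊔-+ (λ B Q → Φ B (v ∷ Q)) (λ B Q → Ψ B (v ∷ Q)) U))
    (+-interchange (∑⊔ (λ B Q → Φ (v ∷ B) Q) U) (∑⊔ (λ B Q → Ψ (v ∷ B) Q) U)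
                   (∑⊔ (λ B Q → Φ B (v ∷ Q)) U) (∑⊔ (λ B Q → Ψ B (v ∷ Q)) U))

  ∑⊔-* : ∀ x Φ U → ∑⊔ (λ B Q → x * Φ B Q) U ≡ x * ∑⊔ Φ U
  ∑⊔-* x Φ []      = refl
  ∑⊔-* x Φ (v ∷ U) = ≡-trans
    (cong₂ _+_ (∑⊔-* x (λ B Q → Φ (v ∷ B) Q) U) (∑⊔-* x (λ B Q → Φ B (v ∷ Q)) U))
    (sym (ℤ.*-distribˡ-+ x (∑⊔ (λ B Q → Φ (v ∷ B) Q) U) (∑⊔ (λ B Q → Φ B (v ∷ Q)) U)))

  ∑⊔-neg : ∀ Φ U → ∑⊔ (λ B Q → - Φ B Q) U ≡ - ∑⊔ Φ U
  ∑⊔-neg Φ []      = refl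
  ∑⊔-neg Φ (v ∷ U) = ≡-trans
    (cong₂ _+_ (∑⊔-neg (λ B Q → Φ (v ∷ B) Q) U) (∑⊔-neg (λ B Q → Φ B (v ∷ Q)) U))
    (sym (ℤ.neg-distrib-+ (∑⊔ (λ B Q → Φ (v ∷ B) Q) U) (∑⊔ (λ B Q → Φ B (v ∷ Q)) U)))

  ∑⊔-0 : ∀ {Φ} U → (∀ {B Q} → Interleaving B Q U → Φ B Q ≡ 0ℤ) → ∑⊔ Φ U ≡ 0ℤ
  ∑⊔-0 []      Φ≡0 = Φ≡0 []
  ∑⊔-0 (v ∷ U) Φ≡0 = cong₂ _+_ (∑⊔-0 U (λ i → Φ≡0 (consˡ i))) (∑⊔-0 U (λ i → Φ≡0 (consʳ i)))

  ∑⊔-[] : ∀ {Φ} U → (∀ {b B Q} → Interleaving (b ∷ B) Q U → Φ (b ∷ B) Q ≡ 0ℤ) → ∑⊔ Φ U ≡ Φ [] U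
  ∑⊔-[] []          _   = refl
  ∑⊔-[] {Φ} (v ∷ U) Φ≡0 = ≡-trans
    (cong₂ _+_ (∑⊔-0 {λ B Q → Φ (v ∷ B) Q} U (λ i → Φ≡0 (consˡ i)))
               (∑⊔-[] {λ B Q → Φ B (v ∷ Q)} U (λ i → Φ≡0 (consʳ i))))
    (ℤ.+-identityˡ (Φ [] (v ∷ U)))

  ∑⊔-nonneg : ∀ {Φ} U → (∀ {B Q} → Interleaving B Q U → 0ℤ ≤ Φ B Q) → 0ℤ ≤ ∑⊔ Φ U
  ∑⊔-nonneg []      Φ≥0 = Φ≥0 []
  ∑⊔-nonneg (v ∷ U) Φ≥0 = ℤ.+-mono-≤ (∑⊔-nonneg U (λ i → Φ≥0 (consˡ i))) (∑⊔-nonneg U (λ i → Φ≥0 (consʳ i)))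

  ∑⊔-↭ : ∀ {Φ} → (∀ {B B′ Q Q′} → B ↭ B′ → Q ↭ Q′ → Φ B Q ≡ Φ B′ Q′) →
         ∀ {U U′} → U ↭ U′ → ∑⊔ Φ U ≡ ∑⊔ Φ U′
  ∑⊔-↭ Φ-↭ refl = refl
  ∑⊔-↭ Φ-↭ (prep v p) = cong₂ _+_
    (∑⊔-↭ (λ b q → Φ-↭ (prep v b) q) p) (∑⊔-↭ (λ b q → Φ-↭ b (prep v q)) p)
  ∑⊔-↭ {Φ} Φ-↭ {U = u ∷ v ∷ U} {U′ = _ ∷ _ ∷ U′} (swap u v p) = ≡-trans
    (cong₂ _+_
      (cong₂ _+_ (≡-trans (∑⊔-↭ {λ B Q → Φ (u ∷ v ∷ B) Q} (λ b q → Φ-↭ (prep u (prep v b)) q) p)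
                          (∑⊔-cong U′ (λ _ → Φ-↭ (swap u v ↭-refl) ↭-refl)))
                 (∑⊔-↭ {λ B Q → Φ (u ∷ B) (v ∷ Q)} (λ b q → Φ-↭ (prep u b) (prep v q)) p))
      (cong₂ _+_ (∑⊔-↭ {λ B Q → Φ (v ∷ B) (u ∷ Q)} (λ b q → Φ-↭ (prep v b) (prep u q)) p)
                 (≡-trans (∑⊔-↭ {λ B Q → Φ B (u ∷ v ∷ Q)} (λ b q → Φ-↭ b (prep u (prep v q))) p)
                          (∑⊔-cong U′ (λ _ → Φ-↭ ↭-refl (swap u v ↭-refl))))))
    (+-interchange (∑⊔ (λ B Q → Φ (v ∷ u ∷ B) Q) U′) (∑⊔ (λ B Q → Φ (u ∷ B) (v ∷ Q)) U′)
                   (∑⊔ (λ B Q → Φ (v ∷ B) (u ∷ Q)) U′) (∑⊔ (λ B Q → Φ B (v ∷ u ∷ Q)) U′))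
  ∑⊔-↭ Φ-↭ (trans p q) = ≡-trans (∑⊔-↭ Φ-↭ p) (∑⊔-↭ Φ-↭ q)

  ∑⊔-swap : ∀ (Φ : List A → List A → List A → ℤ) U →
            ∑⊔ (λ B P → ∑⊔ (λ C Q → Φ B C Q) P) U ≡ ∑⊔ (λ C P → ∑⊔ (λ B Q → Φ B C Q) P) U
  ∑⊔-swap Φ []      = refl
  ∑⊔-swap Φ (v ∷ U) = begin
    x + ∑⊔ (λ B P → ∑⊔ (λ C Q → Φ B (v ∷ C) Q) P + ∑⊔ (λ C Q → Φ B C (v ∷ Q)) P) U
      ≡⟨ cong (λ w → x + w) (∑⊔-+ (λ B P → ∑⊔ (λ C Q → Φ B (v ∷ C) Q) P) (λ B P → ∑⊔ (λ C Q → Φ B C (v ∷ Q)) P) U) ⟩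
    x + (y + z)
      ≡⟨ +-rotate x y z ⟩
    y + (x + z)
      ≡⟨ cong₂ _+_ (∑⊔-swap (λ B C Q → Φ B (v ∷ C) Q) U)
           (cong₂ _+_ (∑⊔-swap (λ B C Q → Φ (v ∷ B) C Q) U) (∑⊔-swap (λ B C Q → Φ B C (v ∷ Q)) U)) ⟩
    y′ + (x′ + z′)
      ≡⟨ cong (λ w → y′ + w) (∑⊔-+ (λ C P → ∑⊔ (λ B Q → Φ (v ∷ B) C Q) P) (λ C P → ∑⊔ (λ B Q → Φ B C (v ∷ Q)) P) U) ⟨
    y′ + ∑⊔ (λ C P → ∑⊔ (λ B Q → Φ (v ∷ B) C Q) P + ∑⊔ (λ B Q → Φ B C (v ∷ Q)) P) U ∎
    where
    x = ∑⊔ (λ B P → ∑⊔ (λ C Q → Φ (v ∷ B) C Q) P) U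
    y = ∑⊔ (λ B P → ∑⊔ (λ C Q → Φ B (v ∷ C) Q) P) U
    z = ∑⊔ (λ B P → ∑⊔ (λ C Q → Φ B C (v ∷ Q)) P) U
    x′ = ∑⊔ (λ C P → ∑⊔ (λ B Q → Φ (v ∷ B) C Q) P) U
    y′ = ∑⊔ (λ C P → ∑⊔ (λ B Q → Φ B (v ∷ C) Q) P) U
    z′ = ∑⊔ (λ C P → ∑⊔ (λ B Q → Φ B C (v ∷ Q)) P) U

  ∑⊔-assoc : ∀ (Φ : List A → List A → List A → ℤ) U →
             ∑⊔ (λ P Q → ∑⊔ (λ B C → Φ B C Q) P) U ≡ ∑⊔ (λ B P → ∑⊔ (λ C Q → Φ B C Q) P) U
  ∑⊔-assoc Φ []      = refl
  ∑⊔-assoc Φ (v ∷ U) = begin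
    ∑⊔ (λ P Q → ∑⊔ (λ B C → Φ (v ∷ B) C Q) P + ∑⊔ (λ B C → Φ B (v ∷ C) Q) P) U + z
      ≡⟨ cong (_+ z) (∑⊔-+ (λ P Q → ∑⊔ (λ B C → Φ (v ∷ B) C Q) P) (λ P Q → ∑⊔ (λ B C → Φ B (v ∷ C) Q) P) U) ⟩
    (x + y) + z
      ≡⟨ ℤ.+-assoc x y z ⟩
    x + (y + z)
      ≡⟨ cong₂ _+_ (∑⊔-assoc (λ B C Q → Φ (v ∷ B) C Q) U)
           (cong₂ _+_ (∑⊔-assoc (λ B C Q → Φ B (v ∷ C) Q) U) (∑⊔-assoc (λ B C Q → Φ B C (v ∷ Q)) U)) ⟩
    x′ + (y′ + z′)
      ≡⟨ cong (λ w → x′ + w) (∑⊔-+ (λ B P → ∑⊔ (λ C Q → Φ B (v ∷ C) Q) P) (λ B P → ∑⊔ (λ C Q → Φ B C (v ∷ Q)) P) U) ⟨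
    x′ + ∑⊔ (λ B P → ∑⊔ (λ C Q → Φ B (v ∷ C) Q) P + ∑⊔ (λ C Q → Φ B C (v ∷ Q)) P) U ∎
    where
    x = ∑⊔ (λ P Q → ∑⊔ (λ B C → Φ (v ∷ B) C Q) P) U
    y = ∑⊔ (λ P Q → ∑⊔ (λ B C → Φ B (v ∷ C) Q) P) U
    z = ∑⊔ (λ P Q → ∑⊔ (λ B C → Φ B C (v ∷ Q)) P) U
    x′ = ∑⊔ (λ B P → ∑⊔ (λ C Q → Φ (v ∷ B) C Q) P) U
    y′ = ∑⊔ (λ B P → ∑⊔ (λ C Q → Φ B (v ∷ C) Q) P) U
    z′ = ∑⊔ (λ B P → ∑⊔ (λ C Q → Φ B C (v ∷ Q)) P) U

  -- The factor `h` may depend on the set `C` that is split off: once the sinks are peeled off, they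
  -- determine which sinks are permitted in the rest.
  ∑⊔-convolve : ∀ (f Φ : List A → ℤ) (h : List A → List A → ℤ) U →
                ∑⊔ (λ B P → f B * ∑⊔ (λ C Q → Φ C * h C Q) P) U
                ≡ ∑⊔ (λ C P → Φ C * ∑⊔ (λ B Q → f B * h C Q) P) U
  ∑⊔-convolve f Φ h U = begin
    ∑⊔ (λ B P → f B * ∑⊔ (λ C Q → Φ C * h C Q) P) U
      ≡⟨ ∑⊔-cong U (λ {B} {P} _ → sym (∑⊔-* (f B) (λ C Q → Φ C * h C Q) P)) ⟩
    ∑⊔ (λ B P → ∑⊔ (λ C Q → f B * (Φ C * h C Q)) P) U
      ≡⟨ ∑⊔-swap (λ B C Q → f B * (Φ C * h C Q)) U ⟩
    ∑⊔ (λ C P → ∑⊔ (λ B Q → f B * (Φ C * h C Q)) P) U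
      ≡⟨ ∑⊔-cong U (λ {C} {P} _ → ≡-trans
           (∑⊔-cong P (λ {B} {Q} _ → *-rotate (f B) (Φ C) (h C Q)))
           (∑⊔-* (Φ C) (λ B Q → f B * h C Q) P)) ⟩
    ∑⊔ (λ C P → Φ C * ∑⊔ (λ B Q → f B * h C Q) P) U ∎

  ∑₁ : (A → List A → ℤ) → List A → ℤ
  ∑₁ Θ []      = 0ℤ
  ∑₁ Θ (v ∷ U) = Θ v U + ∑₁ (λ u P → Θ u (v ∷ P)) U

  ∑₁-cong : ∀ {Θ Ξ} U → (∀ v P → v ∷ P ↭ U → Θ v P ≡ Ξ v P) → ∑₁ Θ U ≡ ∑₁ Ξ U
  ∑₁-cong []      _   = refl
  ∑₁-cong (v ∷ U) Θ≡Ξ = cong₂ _+_ (Θ≡Ξ v U refl)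
    (∑₁-cong U (λ u P p → Θ≡Ξ u (v ∷ P) (↭-trans (swap u v refl) (prep v p))))

  ∑₁-+ : ∀ Θ Ξ U → ∑₁ (λ v P → Θ v P + Ξ v P) U ≡ ∑₁ Θ U + ∑₁ Ξ U
  ∑₁-+ Θ Ξ []      = refl
  ∑₁-+ Θ Ξ (v ∷ U) = ≡-trans
    (cong (λ z → (Θ v U + Ξ v U) + z) (∑₁-+ (λ u P → Θ u (v ∷ P)) (λ u P → Ξ u (v ∷ P)) U))
    (+-interchange (Θ v U) (Ξ v U) (∑₁ (λ u P → Θ u (v ∷ P)) U) (∑₁ (λ u P → Ξ u (v ∷ P)) U))

  ∑₁-* : ∀ x Θ U → ∑₁ (λ v P → x * Θ v P) U ≡ x * ∑₁ Θ U
  ∑₁-* x Θ []      = sym (ℤ.*-zeroʳ x)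
  ∑₁-* x Θ (v ∷ U) = ≡-trans
    (cong (λ z → x * Θ v U + z) (∑₁-* x (λ u P → Θ u (v ∷ P)) U))
    (sym (ℤ.*-distribˡ-+ x (Θ v U) (∑₁ (λ u P → Θ u (v ∷ P)) U)))

  ∑₁-nonneg : ∀ {Θ} U → (∀ v P → v ∷ P ↭ U → 0ℤ ≤ Θ v P) → 0ℤ ≤ ∑₁ Θ U
  ∑₁-nonneg []      _   = ℤ.≤-refl
  ∑₁-nonneg (v ∷ U) Θ≥0 = ℤ.+-mono-≤ (Θ≥0 v U refl)
    (∑₁-nonneg U (λ u P p → Θ≥0 u (v ∷ P) (↭-trans (swap u v refl) (prep v p))))

  ∑⊔-∑₁ : ∀ (Φ : List A → A → List A → ℤ) U →
          ∑⊔ (λ B P → ∑₁ (λ v Q → Φ B v Q) P) U ≡ ∑₁ (λ v P → ∑⊔ (λ B Q → Φ B v Q) P) U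
  ∑⊔-∑₁ Φ []      = refl
  ∑⊔-∑₁ Φ (v ∷ U) = begin
    x + ∑⊔ (λ B P → Φ B v P + ∑₁ (λ u Q → Φ B u (v ∷ Q)) P) U
      ≡⟨ cong (λ w → x + w) (∑⊔-+ (λ B P → Φ B v P) (λ B P → ∑₁ (λ u Q → Φ B u (v ∷ Q)) P) U) ⟩
    x + (y + z)
      ≡⟨ +-rotate x y z ⟩
    y + (x + z)
      ≡⟨ cong (λ w → y + w) (cong₂ _+_ (∑⊔-∑₁ (λ B u Q → Φ (v ∷ B) u Q) U) (∑⊔-∑₁ (λ B u Q → Φ B u (v ∷ Q)) U)) ⟩
    y + (∑₁ (λ u P → ∑⊔ (λ B Q → Φ (v ∷ B) u Q) P) U + ∑₁ (λ u P → ∑⊔ (λ B Q → Φ B u (v ∷ Q)) P) U)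
      ≡⟨ cong (λ w → y + w) (∑₁-+ (λ u P → ∑⊔ (λ B Q → Φ (v ∷ B) u Q) P) (λ u P → ∑⊔ (λ B Q → Φ B u (v ∷ Q)) P) U) ⟨
    y + ∑₁ (λ u P → ∑⊔ (λ B Q → Φ (v ∷ B) u Q) P + ∑⊔ (λ B Q → Φ B u (v ∷ Q)) P) U ∎
    where
    x = ∑⊔ (λ B P → ∑₁ (λ u Q → Φ (v ∷ B) u Q) P) U
    y = ∑⊔ (λ B P → Φ B v P) U
    z = ∑⊔ (λ B P → ∑₁ (λ u Q → Φ B u (v ∷ Q)) P) U

  -- The weight counts the choices of a distinguished element of `B`; symmetry of `Φ` allows it to
  -- be moved to the front.
  ∑⊔-pointed : ∀ (Φ : List A → List A → ℤ) → (∀ {B B′} Q → B ↭ B′ → Φ B Q ≡ Φ B′ Q) → ∀ U →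
               ∑⊔ (λ B Q → pos (length B) * Φ B Q) U ≡ ∑₁ (λ v P → ∑⊔ (λ B Q → Φ (v ∷ B) Q) P) U
  ∑⊔-pointed Φ Φ-↭ []      = refl
  ∑⊔-pointed Φ Φ-↭ (v ∷ U) = begin
    ∑⊔ (λ B Q → pos (suc (length B)) * Φ (v ∷ B) Q) U + z
      ≡⟨ cong (_+ z) (∑⊔-cong U (λ {B} {Q} _ → suc-* (pos (length B)) (Φ (v ∷ B) Q))) ⟩
    ∑⊔ (λ B Q → Φ (v ∷ B) Q + pos (length B) * Φ (v ∷ B) Q) U + z
      ≡⟨ cong (_+ z) (∑⊔-+ (λ B Q → Φ (v ∷ B) Q) (λ B Q → pos (length B) * Φ (v ∷ B) Q) U) ⟩
    (x + y) + z
      ≡⟨ ℤ.+-assoc x y z ⟩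
    x + (y + z)
      ≡⟨ cong (λ w → x + w) (cong₂ _+_
           (≡-trans (∑⊔-pointed (λ B Q → Φ (v ∷ B) Q) (λ Q b → Φ-↭ Q (prep v b)) U)
                    (∑₁-cong U (λ u P _ → ∑⊔-cong P (λ {_} {Q} _ → Φ-↭ Q (swap v u ↭-refl)))))
           (∑⊔-pointed (λ B Q → Φ B (v ∷ Q)) (λ Q b → Φ-↭ (v ∷ Q) b) U)) ⟩
    x + (∑₁ (λ u P → ∑⊔ (λ B Q → Φ (u ∷ v ∷ B) Q) P) U + ∑₁ (λ u P → ∑⊔ (λ B Q → Φ (u ∷ B) (v ∷ Q)) P) U)
      ≡⟨ cong (λ w → x + w) (∑₁-+ (λ u P → ∑⊔ (λ B Q → Φ (u ∷ v ∷ B) Q) P) (λ u P → ∑⊔ (λ B Q → Φ (u ∷ B) (v ∷ Q)) P) U) ⟨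
    x + ∑₁ (λ u P → ∑⊔ (λ B Q → Φ (u ∷ v ∷ B) Q) P + ∑⊔ (λ B Q → Φ (u ∷ B) (v ∷ Q)) P) U ∎
    where
    x = ∑⊔ (λ B Q → Φ (v ∷ B) Q) U
    y = ∑⊔ (λ B Q → pos (length B) * Φ (v ∷ B) Q) U
    z = ∑⊔ (λ B Q → pos (length B) * Φ B (v ∷ Q)) U
    suc-* : ∀ n x → (1ℤ + n) * x ≡ x + n * x
    suc-* = solve-∀

  ∏ : (A → ℤ) → List A → ℤ
  ∏ g []      = 1ℤ
  ∏ g (v ∷ U) = g v * ∏ g U

  ∏-cong : ∀ {g h} U → g ≗ h → ∏ g U ≡ ∏ h U
  ∏-cong []      g≗h = refl
  ∏-cong (v ∷ U) g≗h = cong₂ _*_ (g≗h v) (∏-cong U g≗h)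

  ∏-* : ∀ g h U → ∏ (λ v → g v * h v) U ≡ ∏ g U * ∏ h U
  ∏-* g h []      = refl
  ∏-* g h (v ∷ U) = ≡-trans (cong (λ z → g v * h v * z) (∏-* g h U)) (interchange (g v) (h v) (∏ g U) (∏ h U))
    where
    interchange : ∀ a b c d → (a * b) * (c * d) ≡ (a * c) * (b * d)
    interchange = solve-∀

  ∏-1 : ∀ U → ∏ (λ _ → 1ℤ) U ≡ 1ℤ
  ∏-1 []      = refl
  ∏-1 (v ∷ U) = ≡-trans (ℤ.*-identityˡ (∏ (λ _ → 1ℤ) U)) (∏-1 U)

  ∏-bit : ∀ {g} → (∀ v → Bit (g v)) → ∀ U → Bit (∏ g U)
  ∏-bit b []      = inj₂ refl
  ∏-bit b (v ∷ U) = *-bit (b v) (∏-bit b U)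

  ∏-↭ : ∀ g {U U′} → U ↭ U′ → ∏ g U ≡ ∏ g U′
  ∏-↭ g refl       = refl
  ∏-↭ g (prep v p) = cong (λ z → g v * z) (∏-↭ g p)
  ∏-↭ g {u ∷ v ∷ U} (swap u v p) = ≡-trans (cong (λ z → g u * (g v * z)) (∏-↭ g p)) (*-rotate (g u) (g v) _)
  ∏-↭ g (trans p q) = ≡-trans (∏-↭ g p) (∏-↭ g q)

  ∏-interleaving : ∀ g {B Q U} → Interleaving B Q U → ∏ g U ≡ ∏ g B * ∏ g Q
  ∏-interleaving g []                       = refl
  ∏-interleaving g {v ∷ B} {Q} (consˡ i)    =
    ≡-trans (cong (λ z → g v * z) (∏-interleaving g i)) (sym (ℤ.*-assoc (g v) (∏ g B) (∏ g Q)))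
  ∏-interleaving g {B} {v ∷ Q} (consʳ i)    =
    ≡-trans (cong (λ z → g v * z) (∏-interleaving g i)) (*-rotate (g v) (∏ g B) (∏ g Q))

  ∏-∈ : ∀ {g} → (∀ v → Bit (g v)) → ∀ {U w} → ∏ g U ≡ 1ℤ → w ∈ U → g w ≡ 1ℤ
  ∏-∈ {g} b {v ∷ U} p (here refl) = proj₁ (bits-*≡1 (b v) (∏-bit b U) p)
  ∏-∈ {g} b {v ∷ U} p (there w∈) = ∏-∈ b (proj₂ (bits-*≡1 (b v) (∏-bit b U) p)) w∈

R-∑⊔ : ∀ {A : Set} n (Φ : List A → List A → ℕ → Series) U →
       R n (λ j α → ∑⊔ (λ B Q → Φ B Q j α) U) ≡ ∑⊔ (λ B Q → R n (Φ B Q)) U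
R-∑⊔ n Φ []      = refl
R-∑⊔ n Φ (v ∷ U) = ≡-trans
  (R-+ n (λ j α → ∑⊔ (λ B Q → Φ (v ∷ B) Q j α) U) (λ j α → ∑⊔ (λ B Q → Φ B (v ∷ Q) j α) U))
  (cong₂ _+_ (R-∑⊔ n (λ B Q → Φ (v ∷ B) Q) U) (R-∑⊔ n (λ B Q → Φ B (v ∷ Q)) U))

M-∑⊔ : ∀ {A : Set} n (Φ : List A → List A → Series) U →
       M n (λ α → ∑⊔ (λ B Q → Φ B Q α) U) ≡ ∑⊔ (λ B Q → M n (Φ B Q)) U
M-∑⊔ n Φ []      = refl
M-∑⊔ n Φ (v ∷ U) = ≡-trans
  (M-+ n (λ α → ∑⊔ (λ B Q → Φ (v ∷ B) Q α) U) (λ α → ∑⊔ (λ B Q → Φ B (v ∷ Q) α) U))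
  (cong₂ _+_ (M-∑⊔ n (λ B Q → Φ (v ∷ B) Q) U) (M-∑⊔ n (λ B Q → Φ B (v ∷ Q)) U))

T-* : ∀ n x f → T n (λ α → x * f α) ≡ x * T n f
T-* zero    x f = refl
T-* (suc n) x f = begin
  R n (λ j α → x * f (suc j ∷ α))        ≡⟨ R-cong n (λ j α → ℤ.+-identityʳ (x * f (suc j ∷ α))) ⟨
  R n (λ j α → x * f (suc j ∷ α) + 0ℤ)   ≡⟨ R-linear n x (λ j → ∂ (suc j) f) (λ _ _ → 0ℤ) ⟩
  x * T (suc n) f + R n (λ _ _ → 0ℤ)     ≡⟨ cong (λ z → x * T (suc n) f + z) (R-0 n) ⟩
  x * T (suc n) f + 0ℤ                   ≡⟨ ℤ.+-identityʳ _ ⟩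
  x * T (suc n) f                        ∎

M-* : ∀ n x f → M n (λ α → x * f α) ≡ x * M n f
M-* n x f = begin
  M n (λ α → x * f α)              ≡⟨ M-cong n (λ α → ℤ.+-identityʳ (x * f α)) ⟨
  M n (λ α → x * f α + 0ℤ)         ≡⟨ M-linear n x f (λ _ → 0ℤ) ⟩
  x * M n f + M n (λ _ → 0ℤ)       ≡⟨ cong (λ z → x * M n f + z) (M-0 n) ⟩
  x * M n f + 0ℤ                   ≡⟨ ℤ.+-identityʳ _ ⟩
  x * M n f                        ∎

R-δ : ∀ i r {n} f → i +ⁿ r ≡ n → R n (λ j α → δ i j * f α) ≡ sign i * T r f
R-δ zero    zero    f refl = refl
R-δ zero    (suc r) f refl = begin
  T (suc r) (λ α → 1ℤ * f α) - R r (λ _ _ → 0ℤ)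
    ≡⟨ cong₂ _-_ (T-* (suc r) 1ℤ f) (R-0 r) ⟩
  1ℤ * T (suc r) f - 0ℤ
    ≡⟨ ℤ.+-identityʳ _ ⟩
  1ℤ * T (suc r) f ∎
R-δ (suc i) r f refl = begin
  T (suc (i +ⁿ r)) (λ _ → 0ℤ) - R (i +ⁿ r) (λ j α → δ i j * f α)
    ≡⟨ cong₂ _-_ (R-0 (i +ⁿ r)) (R-δ i r f refl) ⟩
  0ℤ - sign i * T r f
    ≡⟨ ℤ.+-identityˡ _ ⟩
  - (sign i * T r f)
    ≡⟨ ℤ.neg-distribˡ-* (sign i) (T r f) ⟩
  - sign i * T r f ∎

-- Ordered stable partitions and acyclic orientations

∈⇒↭ : ∀ {A : Set} {w : A} {U} → w ∈ U → ∃ λ U′ → U ↭ w ∷ U′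
∈⇒↭ w∈U with xs , ys , refl ← ∈-∃++ w∈U = xs ++ ys , shift _ xs ys

δ-select : ∀ (f : ℕ → ℤ) i j → f j * δ i j ≡ f i * δ i j
δ-select f i j with i ℕ.≟ j
... | yes refl = refl
... | no i≢j rewrite δ-≢ i≢j = ≡-trans (ℤ.*-zeroʳ (f j)) (sym (ℤ.*-zeroʳ (f i)))

module StablePartitions {A : Set} (adj : A → A → Bool)
  (adj-sym : ∀ u v → adj u v ≡ adj v u) (adj-irrefl : ∀ v → adj v v ≡ false) where

  nadj : A → A → ℤ
  nadj u v = indicator (not (adj u v))

  nadj-bit : ∀ u v → Bit (nadj u v)
  nadj-bit u v = indicator-bit (not (adj u v))

  nadj-sym : ∀ u v → nadj u v ≡ nadj v u
  nadj-sym u v = cong (indicator ∘ not) (adj-sym u v)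

  nadj-refl : ∀ v → nadj v v ≡ 1ℤ
  nadj-refl v = cong (indicator ∘ not) (adj-irrefl v)

  free : List A → A → ℤ
  free B v = ∏ (λ u → nadj u v) B

  free-bit : ∀ B v → Bit (free B v)
  free-bit B v = ∏-bit (λ u → nadj-bit u v) B

  st : List A → ℤ
  st []      = 1ℤ
  st (v ∷ B) = free B v * st B

  st-bit : ∀ B → Bit (st B)
  st-bit []      = inj₂ refl
  st-bit (v ∷ B) = *-bit (free-bit B v) (st-bit B)

  ∏-nadj : ∀ v B → ∏ (nadj v) B ≡ free B v
  ∏-nadj v B = ∏-cong B (nadj-sym v)

  -- The cross factor, absence of edges between the two parts, becomes the new restriction `free S`
  -- on sinks in `A-rec`.
  st-interleaving : ∀ {B Q U} → Interleaving B Q U → st U ≡ st B * (st Q * ∏ (free B) Q)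
  st-interleaving []                             = refl
  st-interleaving {v ∷ B} {Q} {_ ∷ U} (consˡ i) = begin
    free U v * st U
      ≡⟨ cong₂ _*_ (∏-interleaving (λ u → nadj u v) i) (st-interleaving i) ⟩
    (free B v * free Q v) * (st B * (st Q * ∏ (free B) Q))
      ≡⟨ rearrange (free B v) (free Q v) (st B) (st Q) (∏ (free B) Q) ⟩
    (free B v * st B) * (st Q * (free Q v * ∏ (free B) Q))
      ≡⟨ cong (λ z → (free B v * st B) * (st Q * z)) (≡-trans (cong (_* ∏ (free B) Q) (sym (∏-nadj v Q)))
           (sym (∏-* (nadj v) (free B) Q))) ⟩
    (free B v * st B) * (st Q * ∏ (free (v ∷ B)) Q) ∎
    where
    rearrange : ∀ a b c d e → (a * b) * (c * (d * e)) ≡ (a * c) * (d * (b * e))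
    rearrange = solve-∀
  st-interleaving {B} {v ∷ Q} {_ ∷ U} (consʳ i) = begin
    free U v * st U
      ≡⟨ cong₂ _*_ (∏-interleaving (λ u → nadj u v) i) (st-interleaving i) ⟩
    (free B v * free Q v) * (st B * (st Q * ∏ (free B) Q))
      ≡⟨ rearrange (free B v) (free Q v) (st B) (st Q) (∏ (free B) Q) ⟩
    st B * ((free Q v * st Q) * (free B v * ∏ (free B) Q)) ∎
    where
    rearrange : ∀ a b c d e → (a * b) * (c * (d * e)) ≡ c * ((b * d) * (a * e))
    rearrange = solve-∀

  st-↭ : ∀ {B B′} → B ↭ B′ → st B ≡ st B′
  st-↭ refl = refl
  st-↭ (prep v p) = cong₂ _*_ (∏-↭ (λ u → nadj u v) p) (st-↭ p)
  st-↭ {u ∷ v ∷ B} {_ ∷ _ ∷ B′} (swap u v p)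
    rewrite ∏-↭ (λ w → nadj w u) p | ∏-↭ (λ w → nadj w v) p | st-↭ p | nadj-sym v u
    = rearrange (nadj u v) (free B′ u) (free B′ v) (st B′)
    where
    rearrange : ∀ a b c d → (a * b) * (c * d) ≡ (a * c) * (b * d)
    rearrange = solve-∀
  st-↭ (trans p q) = ≡-trans (st-↭ p) (st-↭ q)

  st-free : ∀ {U w} → st U ≡ 1ℤ → w ∈ U → free U w ≡ 1ℤ
  st-free {v ∷ U} {w} p w∈ with free≡1 , st≡1 ← bits-*≡1 (free-bit U v) (st-bit U) p = go w∈
    where
    go : w ∈ v ∷ U → free (v ∷ U) w ≡ 1ℤ
    go (here refl) = cong₂ _*_ (nadj-refl v) free≡1
    go (there w∈U) = cong₂ _*_
      (≡-trans (nadj-sym v w) (∏-∈ (λ u → nadj-bit u v) free≡1 w∈U)) (st-free st≡1 w∈U)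

  ε : List A → ℤ
  ε []      = 1ℤ
  ε (_ ∷ _) = 0ℤ

  -- N U α counts the ordered partitions of U into stable sets of sizes α₁, α₂, …
  N : List A → Series
  N U []      = ε U
  N U (a ∷ α) = ∑⊔ (λ B Q → δ (length B) a * (st B * N Q α)) U

  N-↭ : ∀ {U U′} → U ↭ U′ → N U ≗ N U′
  N-↭ {U} {U′} p [] = empty (↭-length p)
    where
    empty : ∀ {U U′} → length U ≡ length U′ → N U [] ≡ N U′ []
    empty {[]}    {[]}    _ = refl
    empty {_ ∷ _} {_ ∷ _} _ = refl
  N-↭ p (a ∷ α) = ∑⊔-↭
    (λ b q → cong₂ _*_ (cong (λ n → δ n a) (↭-length b)) (cong₂ _*_ (st-↭ b) (N-↭ q α))) p

  -- By a theorem of Stanley, the number of acyclic orientations of the graph on U.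
  AO : List A → ℤ
  AO U = T (length U) (N U)

  AO-↭ : ∀ {U U′} → U ↭ U′ → AO U ≡ AO U′
  AO-↭ {U} {U′} p = ≡-trans (cong (λ n → T n (N U)) (↭-length p)) (T-cong (length U′) (N-↭ p))

  -- The convolution inverse of `AO`, and the weight of a set in inclusion-exclusion over sinks.
  q : List A → ℤ
  q B = sign (length B) * st B

  q-↭ : ∀ {B B′} → B ↭ B′ → q B ≡ q B′
  q-↭ p = cong₂ _*_ (cong sign (↭-length p)) (st-↭ p)

  -- Parts of a composition are positive, so the first block is nonempty; `h 0 ≡ 0ℤ` discards the
  -- empty block on the right. Weight 1 on positive sizes gives the recursion of `AO`, and `pos`
  -- gives the value of `M`.
  R-N : ∀ (h : ℕ → ℤ) → h 0 ≡ 0ℤ → ∀ U n → length U ≡ suc n →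
        R n (λ j α → h (suc j) * N U (suc j ∷ α)) ≡ ∑⊔ (λ B Q → h (length B) * - (q B * AO Q)) U
  R-N h h0 U n |U| = begin
    R n (λ j α → h (suc j) * N U (suc j ∷ α))
      ≡⟨ R-cong n (λ j α → sym (∑⊔-* (h (suc j)) (λ B Q → δ (length B) (suc j) * (st B * N Q α)) U)) ⟩
    R n (λ j α → ∑⊔ (λ B Q → h (suc j) * (δ (length B) (suc j) * (st B * N Q α))) U)
      ≡⟨ R-∑⊔ n (λ B Q j α → h (suc j) * (δ (length B) (suc j) * (st B * N Q α))) U ⟩
    ∑⊔ (λ B Q → R n (λ j α → h (suc j) * (δ (length B) (suc j) * (st B * N Q α)))) U
      ≡⟨ ∑⊔-cong U part ⟩
    ∑⊔ (λ B Q → h (length B) * - (q B * AO Q)) U ∎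
    where
    part : ∀ {B Q} → Interleaving B Q U →
           R n (λ j α → h (suc j) * (δ (length B) (suc j) * (st B * N Q α)))
           ≡ h (length B) * - (q B * AO Q)
    part {[]} {Q} _ = ≡-trans
      (≡-trans (R-cong n (λ j α → ℤ.*-zeroʳ (h (suc j)))) (R-0 n))
      (sym (cong (_* - (q [] * AO Q)) h0))
    part {b ∷ B} {Q} i = begin
      R n (λ j α → h (suc j) * (δ (length B) j * (st (b ∷ B) * N Q α)))
        ≡⟨ R-cong n (λ j α → ≡-trans (sym (ℤ.*-assoc (h (suc j)) (δ (length B) j) (st (b ∷ B) * N Q α)))
             (≡-trans (cong (_* (st (b ∷ B) * N Q α)) (δ-select (h ∘ suc) (length B) j))
               (rearrange (h (suc (length B))) (δ (length B) j) (st (b ∷ B)) (N Q α)))) ⟩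
      R n (λ j α → δ (length B) j * ((h (suc (length B)) * st (b ∷ B)) * N Q α))
        ≡⟨ R-δ (length B) (length Q) _ (ℕ.suc-injective (≡-trans (sym (interleave-length i)) |U|)) ⟩
      sign (length B) * T (length Q) (λ α → (h (suc (length B)) * st (b ∷ B)) * N Q α)
        ≡⟨ cong (λ z → sign (length B) * z) (T-* (length Q) (h (suc (length B)) * st (b ∷ B)) (N Q)) ⟩
      sign (length B) * ((h (suc (length B)) * st (b ∷ B)) * AO Q)
        ≡⟨ collect (sign (length B)) (h (suc (length B))) (st (b ∷ B)) (AO Q) ⟩
      h (suc (length B)) * - (- sign (length B) * st (b ∷ B) * AO Q) ∎
      where
      rearrange : ∀ h d s n → h * d * (s * n) ≡ d * ((h * s) * n)
      rearrange = solve-∀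
      collect : ∀ x h s a → x * ((h * s) * a) ≡ h * - (- x * s * a)
      collect = solve-∀

  -- Combinatorially, a nonempty acyclic orientation has a sink. Formally, the terms with nonempty
  -- `B` add up to minus the first-block recursion of `AO`, and the term with empty `B` is `AO`
  -- itself.
  q*AO : ∀ U → ∑⊔ (λ B Q → q B * AO Q) U ≡ ε U
  q*AO []      = refl
  q*AO (v ∷ U) = begin
    ∑⊔ (λ B Q → q B * AO Q) (v ∷ U)
      ≡⟨ ∑⊔-cong (v ∷ U) (λ {B} {Q} _ → split (length B) (q B * AO Q)) ⟩
    ∑⊔ (λ B Q → δ 0 (length B) * (q B * AO Q) + - (h (length B) * - (q B * AO Q))) (v ∷ U)
      ≡⟨ ∑⊔-+ (λ B Q → δ 0 (length B) * (q B * AO Q)) (λ B Q → - (h (length B) * - (q B * AO Q))) (v ∷ U) ⟩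
    ∑⊔ (λ B Q → δ 0 (length B) * (q B * AO Q)) (v ∷ U) + ∑⊔ (λ B Q → - (h (length B) * - (q B * AO Q))) (v ∷ U)
      ≡⟨ cong₂ _+_
           (≡-trans (∑⊔-[] {Φ = λ B Q → δ 0 (length B) * (q B * AO Q)} (v ∷ U) (λ _ → refl)) (unit (AO (v ∷ U))))
           (≡-trans (∑⊔-neg (λ B Q → h (length B) * - (q B * AO Q)) (v ∷ U)) (cong -_ (sym AO-rec))) ⟩
    AO (v ∷ U) - AO (v ∷ U)
      ≡⟨ ℤ.+-inverseʳ (AO (v ∷ U)) ⟩
    0ℤ ∎
    where
    h : ℕ → ℤ
    h zero    = 0ℤ
    h (suc _) = 1ℤ
    split : ∀ n x → x ≡ δ 0 n * x + - (h n * - x)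
    split zero    = solve-∀
    split (suc n) = solve-∀
    unit : ∀ x → 1ℤ * (1ℤ * 1ℤ * x) ≡ x
    unit = solve-∀
    AO-rec : AO (v ∷ U) ≡ ∑⊔ (λ B Q → h (length B) * - (q B * AO Q)) (v ∷ U)
    AO-rec = ≡-trans (R-cong (length U) (λ j α → sym (ℤ.*-identityˡ (N (v ∷ U) (suc j ∷ α)))))
                     (R-N h refl (v ∷ U) (length U) refl)

  -- If g is the indicator of the complement of W, then A g U is the number of acyclic
  -- orientations of the graph on U all of whose sinks lie in W (inclusion–exclusion).
  A[_] : (A → ℤ) → List A → ℤ
  A[ g ] U = ∑⊔ (λ B Q → q B * ∏ g B * AO Q) U

  -- Expand the product of the factors - g v = (1 - g v) + (-1) over the elements of `I`.
  ∏-sign-split : ∀ g I → sign (length I) * ∏ g I ≡ ∑⊔ (λ S J → ∏ (λ v → 1ℤ - g v) S * sign (length J)) I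
  ∏-sign-split g []      = refl
  ∏-sign-split g (v ∷ I) = begin
    - s * (g v * p)
      ≡⟨ expand s (g v) p ⟩
    (1ℤ - g v) * (s * p) + - (s * p)
      ≡⟨ cong (λ z → (1ℤ - g v) * z + - z) (∏-sign-split g I) ⟩
    (1ℤ - g v) * ∑⊔ Φ I + - ∑⊔ Φ I
      ≡⟨ cong₂ _+_ (∑⊔-* (1ℤ - g v) Φ I) (∑⊔-neg Φ I) ⟨
    ∑⊔ (λ S J → (1ℤ - g v) * (c S * sign (length J))) I + ∑⊔ (λ S J → - (c S * sign (length J))) I
      ≡⟨ cong₂ _+_ (∑⊔-cong I (λ {S} {J} _ → sym (ℤ.*-assoc (1ℤ - g v) (c S) (sign (length J)))))
                   (∑⊔-cong I (λ {S} {J} _ → ℤ.neg-distribʳ-* (c S) (sign (length J)))) ⟩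
    ∑⊔ (λ S J → c (v ∷ S) * sign (length J)) I + ∑⊔ (λ S J → c S * - sign (length J)) I ∎
    where
    s = sign (length I)
    p = ∏ g I
    c : List A → ℤ
    c = ∏ (λ v → 1ℤ - g v)
    Φ : List A → List A → ℤ
    Φ S J = c S * sign (length J)
    expand : ∀ s x p → - s * (x * p) ≡ (1ℤ - x) * (s * p) + - (s * p)
    expand = solve-∀

  sinks : (A → ℤ) → List A → ℤ
  sinks g S = st S * ∏ (λ v → 1ℤ - g v) S

  -- Orientations are grouped by their exact set `S` of sinks. After its removal every new sink must
  -- have a neighbour in `S`, so the forbidden sinks of the rest are those marked by `free S`.
  A-rec : ∀ g U → A[ g ] U ≡ ∑⊔ (λ S P → sinks g S * A[ free S ] P) U
  A-rec g U = begin
    ∑⊔ (λ I Q → q I * ∏ g I * AO Q) U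
      ≡⟨ ∑⊔-cong U (λ {I} {Q} _ → expand I Q) ⟩
    ∑⊔ (λ I Q → ∑⊔ (λ S J → sinks g S * (q J * ∏ (free S) J * AO Q)) I) U
      ≡⟨ ∑⊔-assoc (λ S J Q → sinks g S * (q J * ∏ (free S) J * AO Q)) U ⟩
    ∑⊔ (λ S P → ∑⊔ (λ J Q → sinks g S * (q J * ∏ (free S) J * AO Q)) P) U
      ≡⟨ ∑⊔-cong U (λ {S} {P} _ → ∑⊔-* (sinks g S) (λ J Q → q J * ∏ (free S) J * AO Q) P) ⟩
    ∑⊔ (λ S P → sinks g S * A[ free S ] P) U ∎
    where
    expand : ∀ I Q → q I * ∏ g I * AO Q ≡ ∑⊔ (λ S J → sinks g S * (q J * ∏ (free S) J * AO Q)) I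
    expand I Q = begin
      sign (length I) * st I * ∏ g I * AO Q
        ≡⟨ rearrange₁ (sign (length I)) (st I) (∏ g I) (AO Q) ⟩
      (st I * AO Q) * (sign (length I) * ∏ g I)
        ≡⟨ cong (λ z → (st I * AO Q) * z) (∏-sign-split g I) ⟩
      (st I * AO Q) * ∑⊔ (λ S J → ∏ (λ v → 1ℤ - g v) S * sign (length J)) I
        ≡⟨ ∑⊔-* (st I * AO Q) (λ S J → ∏ (λ v → 1ℤ - g v) S * sign (length J)) I ⟨
      ∑⊔ (λ S J → (st I * AO Q) * (∏ (λ v → 1ℤ - g v) S * sign (length J))) I
        ≡⟨ ∑⊔-cong I (λ {S} {J} i → ≡-trans
             (cong (λ z → (z * AO Q) * (∏ (λ v → 1ℤ - g v) S * sign (length J))) (st-interleaving i))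
             (rearrange₂ (st S) (st J) (∏ (free S) J) (AO Q) (∏ (λ v → 1ℤ - g v) S) (sign (length J)))) ⟩
      ∑⊔ (λ S J → sinks g S * (q J * ∏ (free S) J * AO Q)) I ∎
      where
      rearrange₁ : ∀ x s p a → x * s * p * a ≡ (s * a) * (x * p)
      rearrange₁ = solve-∀
      rearrange₂ : ∀ s t f a w x → (s * (t * f)) * a * (w * x) ≡ (s * w) * (x * t * f * a)
      rearrange₂ = solve-∀

  -- `free []` forbids every sink, and only the empty graph has an orientation without sinks.
  A-1 : ∀ U → A[ free [] ] U ≡ ε U
  A-1 U = ≡-trans
    (∑⊔-cong U (λ {B} {Q} _ → cong (_* AO Q) (≡-trans (cong (λ z → q B * z) (∏-1 B)) (ℤ.*-identityʳ (q B)))))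
    (q*AO U)

  A-↭ : ∀ g {U U′} → U ↭ U′ → A[ g ] U ≡ A[ g ] U′
  A-↭ g = ∑⊔-↭ (λ b c → cong₂ _*_ (cong₂ _*_ (q-↭ b) (∏-↭ g b)) (AO-↭ c))

  -- For stable `I`, the coefficient of y^d in y^|I| / (1 + y): it is (-1)^(d - |I|) if |I| ≤ d, and
  -- 0 otherwise.
  ω : ℕ → List A → ℤ
  ω zero    I = δ (length I) 0 * st I
  ω (suc d) I = δ (length I) (suc d) * st I - ω d I

  ω-↭ : ∀ d {I I′} → I ↭ I′ → ω d I ≡ ω d I′
  ω-↭ zero    p = cong₂ _*_ (cong (λ n → δ n 0) (↭-length p)) (st-↭ p)
  ω-↭ (suc d) p = cong₂ _-_ (cong₂ _*_ (cong (λ n → δ n (suc d)) (↭-length p)) (st-↭ p)) (ω-↭ d p)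

  ω-large : ∀ d {I} → d <ⁿ length I → ω d I ≡ 0ℤ
  ω-large zero    {_ ∷ _} _ = refl
  ω-large (suc d) {I} d<I
    rewrite δ-≢ {length I} {suc d} (λ eq → ℕ.<-irrefl (sym eq) d<I) | ω-large d {I} (ℕ.<-trans (ℕ.n<1+n d) d<I)
    = refl

  ω-unstable : ∀ d {I} → st I ≡ 0ℤ → ω d I ≡ 0ℤ
  ω-unstable zero    {I} p rewrite p = ℤ.*-zeroʳ (δ (length I) 0)
  ω-unstable (suc d) {I} p rewrite ω-unstable d {I} p | p | ℤ.*-zeroʳ (δ (length I) (suc d)) = refl

  -- D d g U = ∑ (-1)^(d - i) y_i over i ≤ d, where y_i counts the pairs of a stable set I
  -- of size i and an acyclic orientation of U ∖ I as in A[ g ]. Making the elements of I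
  -- sources turns ∑ y_i yⁱ into ∑ (1 + y)^(number of sources), and D d g U is the
  -- coefficient of y^d in its quotient by 1 + y.
  D : ℕ → (A → ℤ) → List A → ℤ
  D d g U = ∑⊔ (λ I P → ω d I * A[ g ] P) U

  D-rec : ∀ d g U → D d g U ≡ ∑⊔ (λ S P → sinks g S * D d (free S) P) U
  D-rec d g U = ≡-trans
    (∑⊔-cong U (λ {I} {P} _ → cong (λ z → ω d I * z) (A-rec g P)))
    (∑⊔-convolve (ω d) (sinks g) (λ S → A[ free S ]) U)

  D-1 : ∀ d U → D d (free []) U ≡ ω d U
  D-1 d U = begin
    ∑⊔ (λ I P → ω d I * A[ free [] ] P) U   ≡⟨ ∑⊔-cong U (λ {I} {P} _ → cong (λ z → ω d I * z) (A-1 P)) ⟩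
    ∑⊔ (λ I P → ω d I * ε P) U              ≡⟨ go (ω d) U ⟩
    ω d U                                   ∎
    where
    go : ∀ (f : List A → ℤ) U → ∑⊔ (λ I P → f I * ε P) U ≡ f U
    go f []      = ℤ.*-identityʳ (f [])
    go f (v ∷ U) = ≡-trans
      (cong₂ _+_ (go (f ∘ (v ∷_)) U) (∑⊔-0 U (λ {I} _ → ℤ.*-zeroʳ (f I))))
      (ℤ.+-identityʳ (f (v ∷ U)))

  D-↭ : ∀ d g {U U′} → U ↭ U′ → D d g U ≡ D d g U′
  D-↭ d g = ∑⊔-↭ (λ b c → cong₂ _*_ (ω-↭ d b) (A-↭ g c))

  free-interleavingˡ : ∀ {w B Q U} → free U w ≡ 1ℤ → Interleaving B Q U → free B w ≡ 1ℤ
  free-interleavingˡ {w} {B} {Q} p i = proj₁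
    (bits-*≡1 (free-bit B w) (free-bit Q w) (≡-trans (sym (∏-interleaving (λ u → nadj u w) i)) p))

  free-interleavingʳ : ∀ {w B Q U} → free U w ≡ 1ℤ → Interleaving B Q U → free Q w ≡ 1ℤ
  free-interleavingʳ {w} {B} {Q} p i = proj₂
    (bits-*≡1 (free-bit B w) (free-bit Q w) (≡-trans (sym (∏-interleaving (λ u → nadj u w) i)) p))

  q-isolated : ∀ {w B} → free B w ≡ 1ℤ → q (w ∷ B) ≡ - q B
  q-isolated {w} {B} p rewrite p = rearrange (sign (length B)) (st B)
    where
    rearrange : ∀ x s → - x * (1ℤ * s) ≡ - (x * s)
    rearrange = solve-∀

  -- Since `q (w ∷ B)` is `- q B`, the identity `q*AO` for `w ∷ U` says that the convolution of `q`
  -- with the difference `AO (w ∷ Q) - AO Q` is 0. By induction the difference vanishes for all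
  -- shorter `Q`, so only the term with empty `B` is left.
  AO-isolated : ∀ n {w} U → length U ≤ⁿ n → free U w ≡ 1ℤ → AO (w ∷ U) ≡ AO U
  AO-isolated n {w} U |U|≤n p = ℤ.i-j≡0⇒i≡j (AO (w ∷ U)) (AO U) (begin
    AO (w ∷ U) - AO U
      ≡⟨ ℤ.*-identityˡ (AO (w ∷ U) - AO U) ⟨
    1ℤ * (AO (w ∷ U) - AO U)
      ≡⟨ ∑⊔-[] {Φ = λ B Q → q B * (AO (w ∷ Q) - AO Q)} U shorter ⟨
    ∑⊔ (λ B Q → q B * (AO (w ∷ Q) - AO Q)) U
      ≡⟨ ∑⊔-cong U (λ {B} {Q} i → ≡-trans (rearrange (q B) (AO (w ∷ Q)) (AO Q))
           (cong (λ z → z * AO Q + q B * AO (w ∷ Q)) (sym (q-isolated {w} {B} (free-interleavingˡ p i))))) ⟩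
    ∑⊔ (λ B Q → q (w ∷ B) * AO Q + q B * AO (w ∷ Q)) U
      ≡⟨ ∑⊔-+ (λ B Q → q (w ∷ B) * AO Q) (λ B Q → q B * AO (w ∷ Q)) U ⟩
    ∑⊔ (λ B Q → q B * AO Q) (w ∷ U)
      ≡⟨ q*AO (w ∷ U) ⟩
    0ℤ ∎)
    where
    rearrange : ∀ x a b → x * (a - b) ≡ - x * b + x * a
    rearrange = solve-∀
    shorter : ∀ {b B Q} → Interleaving (b ∷ B) Q U → q (b ∷ B) * (AO (w ∷ Q) - AO Q) ≡ 0ℤ
    shorter {b} {B} {Q} i = go n (ℕ.≤-trans (ℕ.≤-reflexive (sym (interleave-length i))) |U|≤n)
      where
      go : ∀ n → suc (length B +ⁿ length Q) ≤ⁿ n → q (b ∷ B) * (AO (w ∷ Q) - AO Q) ≡ 0ℤ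
      go (suc n) (s≤s le) = ≡-trans
        (cong (λ z → q (b ∷ B) * z) (ℤ.i≡j⇒i-j≡0 {AO (w ∷ Q)} {AO Q}
          (AO-isolated n Q (ℕ.≤-trans (ℕ.m≤n+m (length Q) (length B)) le) (free-interleavingʳ p i))))
        (ℤ.*-zeroʳ (q (b ∷ B)))

  A-isolated : ∀ g {w U} → free U w ≡ 1ℤ → g w ≡ 0ℤ → A[ g ] (w ∷ U) ≡ A[ g ] U
  A-isolated g {w} {U} p gw = ≡-trans
    (cong₂ _+_
      (∑⊔-0 U (λ {B} {Q} _ → cong (_* AO Q) (≡-trans (cong (λ z → q (w ∷ B) * (z * ∏ g B)) gw) (ℤ.*-zeroʳ (q (w ∷ B))))))
      (∑⊔-cong U (λ {B} {Q} i → cong (λ z → q B * ∏ g B * z) (AO-isolated (length Q) Q ℕ.≤-refl (free-interleavingʳ p i)))))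
    (ℤ.+-identityˡ (A[ g ] U))

  ω-isolated : ∀ d {w I} → free I w ≡ 1ℤ → ω (suc d) (w ∷ I) ≡ ω d I
  ω-isolated zero    {w} {I} p = begin
    δ (length I) 0 * (free I w * st I) - 0ℤ   ≡⟨ ℤ.+-identityʳ _ ⟩
    δ (length I) 0 * (free I w * st I)        ≡⟨ cong (λ z → δ (length I) 0 * z) (≡-trans (cong (_* st I) p) (ℤ.*-identityˡ (st I))) ⟩
    δ (length I) 0 * st I                     ∎
  ω-isolated (suc d) {w} {I} p = cong₂ _-_
    (cong (λ z → δ (length I) (suc d) * z) (≡-trans (cong (_* st I) p) (ℤ.*-identityˡ (st I))))
    (ω-isolated d {w} {I} p)

  D-isolated-zero : ∀ g {w U} → free U w ≡ 1ℤ → g w ≡ 0ℤ → D 0 g (w ∷ U) ≡ D 0 g U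
  D-isolated-zero g {w} {U} p gw = ≡-trans
    (cong₂ _+_ (∑⊔-0 {Φ = λ I P → ω 0 (w ∷ I) * A[ g ] P} U (λ _ → refl))
      (∑⊔-cong U (λ {I} {Q} i → cong (λ z → ω 0 I * z) (A-isolated g {w} {Q} (free-interleavingʳ p i) gw))))
    (ℤ.+-identityˡ (D 0 g U))

  -- The factor 1 + y: the vertex either joins `I` or stays as a permitted sink, without affecting
  -- anything else.
  D-isolated-suc : ∀ d g {w U} → free U w ≡ 1ℤ → g w ≡ 0ℤ →
                   D (suc d) g (w ∷ U) ≡ D d g U + D (suc d) g U
  D-isolated-suc d g {w} {U} p gw = cong₂ _+_
    (∑⊔-cong U (λ {I} {P} i → cong (_* A[ g ] P) (ω-isolated d {w} {I} (free-interleavingˡ p i))))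
    (∑⊔-cong U (λ {I} {Q} i → cong (λ z → ω (suc d) I * z) (A-isolated g {w} {Q} (free-interleavingʳ p i) gw)))

  -- The polynomial of one permitted vertex is 1 + y, so the quotient is 1.
  D-singleton : ∀ d g {w} → g w ≡ 0ℤ → 0ℤ ≤ D d g (w ∷ [])
  D-singleton zero    g {w} gw = subst (0ℤ ≤_) (sym (D-isolated-zero g {w} {[]} refl gw)) (+≤+ z≤n)
  D-singleton (suc d) g {w} gw = ℤ.≤-reflexive (sym (≡-trans (D-isolated-suc d g {w} {[]} refl gw) (cancel (ω d []))))
    where
    cancel : ∀ x → x * 1ℤ + (0ℤ - x) * 1ℤ ≡ 0ℤ
    cancel = solve-∀

  -- An isolated vertex forbidden as a sink would have to lie in I and contribute y instead of 1 +
  -- y; already y / (1 + y) has negative coefficients. Hence the condition on isolated vertices,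
  -- which peeling off sinks preserves. Permitted isolated vertices are removed as factors 1 + y;
  -- once none is left, `U` is not stable, so only splittings into two nonempty parts contribute.
  D-nonneg : ∀ n d g U → length U ≤ⁿ n → 0 <ⁿ length U → (∀ v → Bit (g v)) →
             (∀ {w} → w ∈ U → free U w ≡ 1ℤ → g w ≡ 0ℤ) → 0ℤ ≤ D d g U
  D-nonneg zero    d g (u ∷ U) () _ _ _
  D-nonneg (suc n) d g U |U|≤n U≢[] g-bit isolated⇒ with any? (λ w → free U w ℤ.≟ 1ℤ) U
  ... | yes ∃isolated
    with w , w∈U , w-isolated ← find ∃isolated
    with U′ , p ← ∈⇒↭ w∈U
    = subst (0ℤ ≤_) (sym (D-↭ d g p))
        (remove d U′ p (ℕ.≤-pred (subst (_≤ⁿ suc n) (↭-length p) |U|≤n)))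
    where
    gw : g w ≡ 0ℤ
    gw = isolated⇒ w∈U w-isolated
    remove : ∀ d U′ → U ↭ w ∷ U′ → length U′ ≤ⁿ n → 0ℤ ≤ D d g (w ∷ U′)
    remove d []        p _  = D-singleton d g gw
    remove d (u ∷ U′) p le = go d
      where
      w-free : free (u ∷ U′) w ≡ 1ℤ
      w-free = proj₂ (bits-*≡1 (nadj-bit w w) (free-bit (u ∷ U′) w)
        (≡-trans (sym (∏-↭ (λ x → nadj x w) p)) w-isolated))
      IH : ∀ d → 0ℤ ≤ D d g (u ∷ U′)
      IH d = D-nonneg n d g (u ∷ U′) le (s≤s z≤n) g-bit λ {x} x∈ x-free →
        isolated⇒ (∈-resp-↭ (↭-sym p) (there x∈)) (≡-trans (∏-↭ (λ y → nadj y x) p)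
          (cong₂ _*_ (≡-trans (nadj-sym w x) (∏-∈ (λ y → nadj-bit y w) w-free x∈)) x-free))
      go : ∀ d → 0ℤ ≤ D d g (w ∷ u ∷ U′)
      go zero    = subst (0ℤ ≤_) (sym (D-isolated-zero g {w} {u ∷ U′} w-free gw)) (IH 0)
      go (suc d) = subst (0ℤ ≤_) (sym (D-isolated-suc d g {w} {u ∷ U′} w-free gw)) (ℤ.+-mono-≤ (IH d) (IH (suc d)))
  ... | no ∄isolated = subst (0ℤ ≤_) (sym (D-rec d g U)) (∑⊔-nonneg U term)
    where
    unstable : st U ≡ 0ℤ
    unstable with st-bit U
    ... | inj₁ st≡0 = st≡0
    ... | inj₂ st≡1 = ⊥-elim (∄isolated (pick U U≢[] (λ w∈ → st-free st≡1 w∈)))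
      where
      pick : ∀ V → 0 <ⁿ length V → (∀ {w} → w ∈ V → free U w ≡ 1ℤ) → Any (λ w → free U w ≡ 1ℤ) V
      pick (v ∷ V) _ f = here (f (here refl))
    sinks-nonneg : ∀ S → 0ℤ ≤ sinks g S
    sinks-nonneg S = bit-nonneg (*-bit (st-bit S) (∏-bit (λ v → complement (g-bit v)) S))
      where
      complement : ∀ {x} → Bit x → Bit (1ℤ - x)
      complement (inj₁ refl) = inj₂ refl
      complement (inj₂ refl) = inj₁ refl
    term : ∀ {S P} → Interleaving S P U → 0ℤ ≤ sinks g S * D d (free S) P
    term {S} {[]} i = ℤ.≤-reflexive (sym (cong (λ z → z * ∏ (λ v → 1ℤ - g v) S * D d (free S) []) st-S))
      where
      st-S : st S ≡ 0ℤ
      st-S = ≡-trans (st-↭ (↭-sym (subst (U ↭_) (++-identityʳ S) (toPermutation i)))) unstable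
    -- With no sink peeled off, `D-1` leaves only the choice of all of `U` as I, which is not
    -- stable.
    term {[]} {P@(_ ∷ _)} i = ℤ.≤-reflexive (sym (≡-trans (cong (λ z → 1ℤ * z) (≡-trans (D-1 d P) (ω-unstable d st-P))) refl))
      where
      st-P : st P ≡ 0ℤ
      st-P = ≡-trans (st-↭ (↭-sym (toPermutation i))) unstable
    term {S@(s ∷ S′)} {P@(_ ∷ _)} i = *-nonneg (sinks-nonneg S)
      (D-nonneg n d (free S) P
        (ℕ.≤-trans (ℕ.m≤n+m (length P) (length S′))
          (ℕ.≤-pred (subst (_≤ⁿ suc n) (interleave-length i) |U|≤n)))
        (s≤s z≤n) (free-bit S) λ {w} w∈P w-free → not-free w∈P w-free (free-bit S w))
      where
      not-free : ∀ {w} → w ∈ P → free P w ≡ 1ℤ → Bit (free S w) → free S w ≡ 0ℤ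
      not-free w∈P w-free (inj₁ eq) = eq
      -- A vertex isolated in `P` without a neighbour in `S` would be isolated in `U`.
      not-free {w} w∈P w-free (inj₂ eq) = ⊥-elim (∄isolated (lose
        (∈-resp-↭ (↭-sym (toPermutation i)) (∈-++⁺ʳ S w∈P))
        (≡-trans (∏-interleaving (λ u → nadj u w) i) (cong₂ _*_ eq w-free))))

  -- The number of acyclic orientations of the graph on U with exactly one sink.
  a : List A → ℤ
  a U = ∑⊔ (λ B Q → pos (length B) * - (q B * AO Q)) U

  a-↭ : ∀ {U U′} → U ↭ U′ → a U ≡ a U′
  a-↭ = ∑⊔-↭ (λ b c → cong₂ _*_ (cong pos (↭-length b)) (cong -_ (cong₂ _*_ (q-↭ b) (AO-↭ c))))

  M-N : ∀ n U → length U ≡ n → M n (N U) ≡ a U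
  M-N zero    []      _   = refl
  M-N (suc n) U       |U| = R-N pos refl U n |U|

  -- Removing the unique sink `v` leaves an orientation all of whose sinks are neighbours of `v`.
  -- Formally, the weight |B| marks `v` in `B`, and its nonadjacency to the rest of `B` supplies the
  -- factor `nadj v`.
  a-∑₁ : ∀ U → a U ≡ ∑₁ (λ v P → A[ nadj v ] P) U
  a-∑₁ U = ≡-trans
    (∑⊔-pointed (λ B Q → - (q B * AO Q)) (λ Q b → cong (λ z → - (z * AO Q)) (q-↭ b)) U)
    (∑₁-cong U (λ v P _ → ∑⊔-cong P (λ {B} {Q} _ → ≡-trans
      (rearrange (sign (length B)) (free B v) (st B) (AO Q))
      (cong (λ z → sign (length B) * st B * z * AO Q) (sym (∏-nadj v B))))))
    where
    rearrange : ∀ x f s a → - (- x * (f * s) * a) ≡ x * s * f * a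
    rearrange = solve-∀

  -- The isolated vertex is a sink, and the nonempty rest has another one.
  a-isolated : ∀ {w c U} → free (c ∷ U) w ≡ 1ℤ → a (w ∷ c ∷ U) ≡ 0ℤ
  a-isolated {w} {c} {U} p = begin
    ∑⊔ (λ B Q → pos (suc (length B)) * - (q (w ∷ B) * AO Q)) V + ∑⊔ (λ B Q → pos (length B) * - (q B * AO (w ∷ Q))) V
      ≡⟨ ∑⊔-+ (λ B Q → pos (suc (length B)) * - (q (w ∷ B) * AO Q)) (λ B Q → pos (length B) * - (q B * AO (w ∷ Q))) V ⟨
    ∑⊔ (λ B Q → pos (suc (length B)) * - (q (w ∷ B) * AO Q) + pos (length B) * - (q B * AO (w ∷ Q))) V
      ≡⟨ ∑⊔-cong V (λ {B} {Q} i → ≡-trans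
           (cong₂ (λ x y → pos (suc (length B)) * - (x * AO Q) + pos (length B) * - (q B * y))
             (q-isolated {w} {B} (free-interleavingˡ p i)) (AO-isolated (length Q) Q ℕ.≤-refl (free-interleavingʳ p i)))
           (cancel (pos (length B)) (q B) (AO Q))) ⟩
    ∑⊔ (λ B Q → q B * AO Q) V
      ≡⟨ q*AO V ⟩
    0ℤ ∎
    where
    V = c ∷ U
    cancel : ∀ n x y → (1ℤ + n) * - (- x * y) + n * - (x * y) ≡ x * y
    cancel = solve-∀

  -- The value of `L` on `N U`, by `L-N`: the variable specialised to t takes the stable set `I`,
  -- and `M` of the remaining vertices is `a`.
  P : ℕ → List A → ℤ
  P d U = ∑⊔ (λ I C → ω d I * a C) U

  P-↭ : ∀ d {U U′} → U ↭ U′ → P d U ≡ P d U′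
  P-↭ d = ∑⊔-↭ (λ b c → cong₂ _*_ (ω-↭ d b) (a-↭ c))

  P-∑₁ : ∀ d U → P d U ≡ ∑₁ (λ v V → D d (nadj v) V) U
  P-∑₁ d U = ≡-trans
    (∑⊔-cong U (λ {I} {C} _ → ≡-trans (cong (λ z → ω d I * z) (a-∑₁ C))
      (sym (∑₁-* (ω d I) (λ v V → A[ nadj v ] V) C))))
    (∑⊔-∑₁ (λ I v V → ω d I * A[ nadj v ] V) U)

  private
    ω-a-isolated : ∀ d {w I C} → d <ⁿ length I +ⁿ length C → free C w ≡ 1ℤ → ω d I * a (w ∷ C) ≡ 0ℤ
    ω-a-isolated d {w} {I} {[]} d< _ =
      cong (_* a (w ∷ [])) (ω-large d (subst (d <ⁿ_) (ℕ.+-identityʳ (length I)) d<))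
    ω-a-isolated d {w} {I} {c ∷ C} _ p =
      ≡-trans (cong (λ z → ω d I * z) (a-isolated {w} {c} {C} p)) (ℤ.*-zeroʳ (ω d I))

  P-isolated-zero : ∀ {w U} → free U w ≡ 1ℤ → 0 <ⁿ length U → P 0 (w ∷ U) ≡ 0ℤ
  P-isolated-zero {w} {U} p d< = cong₂ _+_
    (∑⊔-0 {Φ = λ I C → ω 0 (w ∷ I) * a C} U (λ _ → refl))
    (∑⊔-0 U (λ {I} {C} i → ω-a-isolated 0 {w} {I} {C} (subst (0 <ⁿ_) (interleave-length i) d<) (free-interleavingʳ p i)))

  -- Outside `I` the isolated vertex would have to be the only one, but then `I` is too large for
  -- `ω`. So it lies in `I`, which corresponds to cancelling a factor e_1.
  P-isolated-suc : ∀ d {w U} → free U w ≡ 1ℤ → suc d <ⁿ length U → P (suc d) (w ∷ U) ≡ P d U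
  P-isolated-suc d {w} {U} p d< = ≡-trans
    (cong₂ _+_
      (∑⊔-cong U (λ {I} {C} i → cong (_* a C) (ω-isolated d {w} {I} (free-interleavingˡ p i))))
      (∑⊔-0 U (λ {I} {C} i → ω-a-isolated (suc d) {w} {I} {C} (subst (suc d <ⁿ_) (interleave-length i) d<) (free-interleavingʳ p i))))
    (ℤ.+-identityʳ (P d U))

  P-nonneg : ∀ d k U → length U ≡ suc (suc k) +ⁿ d → 0ℤ ≤ P d U
  P-nonneg d k U |U| with any? (λ w → free U w ℤ.≟ 1ℤ) U
  -- For each unique sink `v`, a vertex isolated in the rest must be a neighbour of `v`, hence a
  -- permitted sink.
  ... | no ∄isolated = subst (0ℤ ≤_) (sym (P-∑₁ d U)) (∑₁-nonneg U λ v V p →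
    D-nonneg (length V) d (nadj v) V ℕ.≤-refl
      (subst (0 <ⁿ_) (sym (ℕ.suc-injective (≡-trans (↭-length p) |U|))) (s≤s z≤n))
      (nadj-bit v) λ {w} w∈V w-free → not-free v V p w∈V w-free (nadj-bit v w))
    where
    not-free : ∀ v V → v ∷ V ↭ U → ∀ {w} → w ∈ V → free V w ≡ 1ℤ → Bit (nadj v w) → nadj v w ≡ 0ℤ
    not-free v V p w∈V w-free (inj₁ eq) = eq
    not-free v V p {w} w∈V w-free (inj₂ eq) = ⊥-elim (∄isolated (lose
      (∈-resp-↭ p (there w∈V)) (≡-trans (sym (∏-↭ (λ u → nadj u w) p)) (cong₂ _*_ eq w-free))))
  ... | yes ∃isolated
    with w , w∈U , w-isolated ← find ∃isolated
    with U′ , p ← ∈⇒↭ w∈U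
    = subst (0ℤ ≤_) (sym (P-↭ d p)) (remove d (ℕ.suc-injective (≡-trans (sym (↭-length p)) |U|)))
    where
    w-free : free U′ w ≡ 1ℤ
    w-free = proj₂ (bits-*≡1 (nadj-bit w w) (free-bit U′ w)
      (≡-trans (sym (∏-↭ (λ x → nadj x w) p)) w-isolated))
    remove : ∀ d → length U′ ≡ suc (k +ⁿ d) → 0ℤ ≤ P d (w ∷ U′)
    -- For `d = 0` the hook has no part 1 that could account for the factor e_1 of the isolated
    -- vertex.
    remove zero    |U′| = ℤ.≤-reflexive (sym (P-isolated-zero {w} {U′} w-free (subst (0 <ⁿ_) (sym |U′|) (s≤s z≤n))))
    remove (suc d) |U′| = subst (0ℤ ≤_)
      (sym (P-isolated-suc d {w} {U′} w-free (subst (suc d <ⁿ_) (sym |U′|) (s≤s (ℕ.m≤n+m (suc d) k)))))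
      (P-nonneg d k U′ (≡-trans |U′| (cong suc (ℕ.+-suc k d))))

  M-∂-N : ∀ k i U → length U ≡ i +ⁿ k → M k (∂ i (N U)) ≡ ∑⊔ (λ B C → δ (length B) i * st B * a C) U
  M-∂-N k i U |U| = begin
    M k (λ α → ∑⊔ (λ B C → δ (length B) i * (st B * N C α)) U)
      ≡⟨ M-∑⊔ k (λ B C α → δ (length B) i * (st B * N C α)) U ⟩
    ∑⊔ (λ B C → M k (λ α → δ (length B) i * (st B * N C α))) U
      ≡⟨ ∑⊔-cong U part ⟩
    ∑⊔ (λ B C → δ (length B) i * st B * a C) U ∎
    where
    part : ∀ {B C} → Interleaving B C U →
           M k (λ α → δ (length B) i * (st B * N C α)) ≡ δ (length B) i * st B * a C
    part {B} {C} j = begin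
      M k (λ α → δ (length B) i * (st B * N C α))
        ≡⟨ M-cong k (λ α → sym (ℤ.*-assoc (δ (length B) i) (st B) (N C α))) ⟩
      M k (λ α → δ (length B) i * st B * N C α)
        ≡⟨ M-* k (δ (length B) i * st B) (N C) ⟩
      δ (length B) i * st B * M k (N C)
        ≡⟨ eq ⟩
      δ (length B) i * st B * a C ∎
      where
      eq : δ (length B) i * st B * M k (N C) ≡ δ (length B) i * st B * a C
      eq with length B ℕ.≟ i
      ... | yes refl = cong (λ z → δ i i * st B * z)
        (M-N k C (ℕ.+-cancelˡ-≡ i _ _ (≡-trans (sym (interleave-length j)) |U|)))
      ... | no |B|≢i rewrite δ-≢ |B|≢i = refl

  L-N : ∀ k d U → length U ≡ k +ⁿ d → L k d (N U) ≡ P d U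
  L-N k zero    U |U| = M-∂-N k 0 U (≡-trans |U| (ℕ.+-identityʳ k))
  L-N k (suc d) U |U| = begin
    M k (∂ (suc d) (N U)) - L (suc k) d (N U)
      ≡⟨ cong₂ _-_ (M-∂-N k (suc d) U (≡-trans |U| (ℕ.+-comm k (suc d))))
                   (L-N (suc k) d U (≡-trans |U| (ℕ.+-suc k d))) ⟩
    ∑⊔ (λ B C → δ (length B) (suc d) * st B * a C) U - P d U
      ≡⟨ cong (λ z → ∑⊔ (λ B C → δ (length B) (suc d) * st B * a C) U + z) (∑⊔-neg (λ B C → ω d B * a C) U) ⟨
    ∑⊔ (λ B C → δ (length B) (suc d) * st B * a C) U + ∑⊔ (λ B C → - (ω d B * a C)) U
      ≡⟨ ∑⊔-+ (λ B C → δ (length B) (suc d) * st B * a C) (λ B C → - (ω d B * a C)) U ⟨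
    ∑⊔ (λ B C → δ (length B) (suc d) * st B * a C + - (ω d B * a C)) U
      ≡⟨ ∑⊔-cong U (λ {B} {C} _ → collect (δ (length B) (suc d) * st B) (ω d B) (a C)) ⟩
    P (suc d) U ∎
    where
    collect : ∀ x y a → x * a + - (y * a) ≡ (x - y) * a
    collect = solve-∀

-- Chromatic symmetric functions as counts of ordered stable partitions

indicator-∧ : ∀ a b → indicator (a ∧ b) ≡ indicator a * indicator b
indicator-∧ true  true  = refl
indicator-∧ true  false = refl
indicator-∧ false _     = refl

indicator≡1⇒ : ∀ {P : Set} (P? : Dec P) → indicator (does P?) ≡ 1ℤ → P
indicator≡1⇒ (yes p) _ = p
indicator≡1⇒ (no _)  ()

length-filter : ∀ {A : Set} {P : A → Set} (P? : Decidable P) xs →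
                pos (length (filter P? xs)) ≡ ∑ (map (λ x → indicator (does (P? x))) xs)
length-filter P? []       = refl
length-filter P? (x ∷ xs) with does (P? x)
... | true  = cong (λ z → 1ℤ + z) (length-filter P? xs)
... | false = ≡-trans (length-filter P? xs) (sym (ℤ.+-identityˡ _))

∑ᶠ ∏ᶠ : ∀ k → (Fin k → ℤ) → ℤ
∑ᶠ zero    f = 0ℤ
∑ᶠ (suc k) f = f zero + ∑ᶠ k (f ∘ suc)
∏ᶠ zero    f = 1ℤ
∏ᶠ (suc k) f = f zero * ∏ᶠ k (f ∘ suc)

∑-tabulate : ∀ k f → ∑ (tabulate f) ≡ ∑ᶠ k f
∑-tabulate zero    f = refl
∑-tabulate (suc k) f = cong (λ z → f zero + z) (∑-tabulate k (f ∘ suc))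

∑ᶠ-cong : ∀ k {f g} → f ≗ g → ∑ᶠ k f ≡ ∑ᶠ k g
∑ᶠ-cong zero    f≗g = refl
∑ᶠ-cong (suc k) f≗g = cong₂ _+_ (f≗g zero) (∑ᶠ-cong k (f≗g ∘ suc))

∑ᶠ-* : ∀ k x f → ∑ᶠ k (λ i → x * f i) ≡ x * ∑ᶠ k f
∑ᶠ-* zero    x f = sym (ℤ.*-zeroʳ x)
∑ᶠ-* (suc k) x f = ≡-trans (cong (λ z → x * f zero + z) (∑ᶠ-* k x (f ∘ suc)))
  (sym (ℤ.*-distribˡ-+ x (f zero) (∑ᶠ k (f ∘ suc))))

∑ᶠ-∑⊔ : ∀ {A : Set} k (Φ : Fin k → List A → List A → ℤ) U →
        ∑ᶠ k (λ i → ∑⊔ (Φ i) U) ≡ ∑⊔ (λ B Q → ∑ᶠ k (λ i → Φ i B Q)) U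
∑ᶠ-∑⊔ zero    Φ U = sym (∑⊔-0 U (λ _ → refl))
∑ᶠ-∑⊔ (suc k) Φ U = ≡-trans (cong (λ z → ∑⊔ (Φ zero) U + z) (∑ᶠ-∑⊔ k (Φ ∘ suc) U))
  (sym (∑⊔-+ (Φ zero) (λ B Q → ∑ᶠ k (λ i → Φ (suc i) B Q)) U))

∏ᶠ-cong : ∀ k {f g} → f ≗ g → ∏ᶠ k f ≡ ∏ᶠ k g
∏ᶠ-cong zero    f≗g = refl
∏ᶠ-cong (suc k) f≗g = cong₂ _*_ (f≗g zero) (∏ᶠ-cong k (f≗g ∘ suc))

∏ᶠ-* : ∀ k f g → ∏ᶠ k (λ i → f i * g i) ≡ ∏ᶠ k f * ∏ᶠ k g
∏ᶠ-* zero    f g = refl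
∏ᶠ-* (suc k) f g = ≡-trans (cong (λ z → f zero * g zero * z) (∏ᶠ-* k (f ∘ suc) (g ∘ suc)))
  (interchange (f zero) (g zero) (∏ᶠ k (f ∘ suc)) (∏ᶠ k (g ∘ suc)))
  where
  interchange : ∀ a b c d → (a * b) * (c * d) ≡ (a * c) * (b * d)
  interchange = solve-∀

∏ᶠ-bit : ∀ k {f} → (∀ i → Bit (f i)) → Bit (∏ᶠ k f)
∏ᶠ-bit zero    b = inj₂ refl
∏ᶠ-bit (suc k) b = *-bit (b zero) (∏ᶠ-bit k (b ∘ suc))

∏ᶠ≡1⁺ : ∀ k {f} → (∀ i → f i ≡ 1ℤ) → ∏ᶠ k f ≡ 1ℤ
∏ᶠ≡1⁺ zero    f≡1 = refl
∏ᶠ≡1⁺ (suc k) f≡1 = cong₂ _*_ (f≡1 zero) (∏ᶠ≡1⁺ k (f≡1 ∘ suc))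

∏ᶠ≡1⁻ : ∀ k {f} → (∀ i → Bit (f i)) → ∏ᶠ k f ≡ 1ℤ → ∀ i → f i ≡ 1ℤ
∏ᶠ≡1⁻ (suc k) b p i with p₀ , p₁ ← bits-*≡1 (b zero) (∏ᶠ-bit k (b ∘ suc)) p with i
... | zero  = p₀
... | suc i = ∏ᶠ≡1⁻ k (b ∘ suc) p₁ i

bits-≡ : ∀ {x y} → Bit x → Bit y → (x ≡ 1ℤ → y ≡ 1ℤ) → (y ≡ 1ℤ → x ≡ 1ℤ) → x ≡ y
bits-≡ (inj₂ refl) _           f g = sym (f refl)
bits-≡ (inj₁ refl) (inj₂ refl) f g = g refl
bits-≡ (inj₁ refl) (inj₁ refl) f g = refl

indicator-≟ : ∀ m n → indicator (does (m ≟ n)) ≡ δ m n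
indicator-≟ zero    zero    = refl
indicator-≟ zero    (suc n) = refl
indicator-≟ (suc m) zero    = refl
indicator-≟ (suc m) (suc n) = indicator-≟ m n

indicator-≡-dec : ∀ α (m : Fin (length α) → ℕ) →
                  indicator (does (≡-dec _≟_ (tabulate m) α)) ≡ ∏ᶠ (length α) (λ j → δ (m j) (lookup α j))
indicator-≡-dec []      m = refl
indicator-≡-dec (a ∷ α) m = ≡-trans
  (indicator-∧ (does (m zero ≟ a)) (does (≡-dec _≟_ (tabulate (m ∘ suc)) α)))
  (cong₂ _*_ (indicator-≟ (m zero) a) (indicator-≡-dec α (m ∘ suc)))

module _ {A : Set} where

  class : ∀ {k n} → Fin k → (Fin n → A) → Vec (Fin k) n → List A
  class j f []      = []
  class j f (i ∷ χ) = if does (j ≟ᶠ i) then f zero ∷ class j (f ∘ suc) χ else class j (f ∘ suc) χ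

  length-class : ∀ {k n} (j : Fin k) f (χ : Vec (Fin k) n) → length (class j f χ) ≡ count (j ≟ᶠ_) χ
  length-class j f []      = refl
  length-class j f (i ∷ χ) with does (j ≟ᶠ i)
  ... | true  = cong suc (length-class j (f ∘ suc) χ)
  ... | false = length-class j (f ∘ suc) χ

  ∈-class⁺ : ∀ {k n} (j : Fin k) f (χ : Vec (Fin k) n) v → lookupᵛ χ v ≡ j → f v ∈ class j f χ
  ∈-class⁺ j f (i ∷ χ) v       eq with j ≟ᶠ i
  ∈-class⁺ j f (i ∷ χ) zero    eq | yes _   = here refl
  ∈-class⁺ j f (i ∷ χ) (suc v) eq | yes _   = there (∈-class⁺ j (f ∘ suc) χ v eq)
  ∈-class⁺ j f (i ∷ χ) zero    eq | no j≢i  = ⊥-elim (j≢i (sym eq))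
  ∈-class⁺ j f (i ∷ χ) (suc v) eq | no _    = ∈-class⁺ j (f ∘ suc) χ v eq

  ∈-class⁻ : ∀ {k n} (j : Fin k) f (χ : Vec (Fin k) n) {x} → x ∈ class j f χ → ∃ λ v → f v ≡ x × lookupᵛ χ v ≡ j
  ∈-class⁻ j f (i ∷ χ) x∈ with j ≟ᶠ i
  ∈-class⁻ j f (i ∷ χ) (here refl) | yes refl = zero , refl , refl
  ∈-class⁻ j f (i ∷ χ) (there x∈)  | yes _ with v , p , q ← ∈-class⁻ j (f ∘ suc) χ x∈ = suc v , p , q
  ∈-class⁻ j f (i ∷ χ) x∈          | no _  with v , p , q ← ∈-class⁻ j (f ∘ suc) χ x∈ = suc v , p , q

  bump : ∀ {k} → Fin k → A → (Fin k → List A → ℤ) → Fin k → List A → ℤ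
  bump i u Φ j B = if does (j ≟ᶠ i) then Φ j (u ∷ B) else Φ j B

  -- The sum of ∏ⱼ Φ j (Bⱼ) over the maps U → Fin k, with fibres Bⱼ.
  ∑-fibres : ∀ k → List A → (Fin k → List A → ℤ) → ℤ
  ∑-fibres k []      Φ = ∏ᶠ k (λ j → Φ j [])
  ∑-fibres k (u ∷ U) Φ = ∑ᶠ k (λ i → ∑-fibres k U (bump i u Φ))

  -- Separating the fibre of the first colour reproduces the recursion that defines `N`.
  ∑-fibres-suc : ∀ k U Φ → ∑-fibres (suc k) U Φ ≡ ∑⊔ (λ B Q → Φ zero B * ∑-fibres k Q (Φ ∘ suc)) U
  ∑-fibres-suc k []      Φ = refl
  ∑-fibres-suc k (u ∷ U) Φ = cong₂ _+_ (∑-fibres-suc k U (bump zero u Φ)) (begin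
    ∑ᶠ k (λ i → ∑-fibres (suc k) U (bump (suc i) u Φ))
      ≡⟨ ∑ᶠ-cong k (λ i → ∑-fibres-suc k U (bump (suc i) u Φ)) ⟩
    ∑ᶠ k (λ i → ∑⊔ (λ B Q → Φ zero B * ∑-fibres k Q (bump i u (Φ ∘ suc))) U)
      ≡⟨ ∑ᶠ-∑⊔ k (λ i B Q → Φ zero B * ∑-fibres k Q (bump i u (Φ ∘ suc))) U ⟩
    ∑⊔ (λ B Q → ∑ᶠ k (λ i → Φ zero B * ∑-fibres k Q (bump i u (Φ ∘ suc)))) U
      ≡⟨ ∑⊔-cong U (λ {B} {Q} _ → ∑ᶠ-* k (Φ zero B) (λ i → ∑-fibres k Q (bump i u (Φ ∘ suc)))) ⟩
    ∑⊔ (λ B Q → Φ zero B * ∑-fibres k (u ∷ Q) (Φ ∘ suc)) U ∎)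

  ∑-cartesianProductWith : ∀ {B C D : Set} (F : D → ℤ) (g : B → C → D) xs ys →
    ∑ (map F (cartesianProductWith g xs ys)) ≡ ∑ (map (λ x → ∑ (map (λ y → F (g x y)) ys)) xs)
  ∑-cartesianProductWith F g []       ys = refl
  ∑-cartesianProductWith F g (x ∷ xs) ys = begin
    ∑ (map F (map (g x) ys ++ cartesianProductWith g xs ys))
      ≡⟨ cong ∑ (map-++ F (map (g x) ys) (cartesianProductWith g xs ys)) ⟩
    ∑ (map F (map (g x) ys) ++ map F (cartesianProductWith g xs ys))
      ≡⟨ ∑-++ (map F (map (g x) ys)) (map F (cartesianProductWith g xs ys)) ⟩
    ∑ (map F (map (g x) ys)) + ∑ (map F (cartesianProductWith g xs ys))
      ≡⟨ cong₂ _+_ (cong ∑ (sym (map-∘ ys))) (∑-cartesianProductWith F g xs ys) ⟩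
    ∑ (map (F ∘ g x) ys) + ∑ (map (λ x → ∑ (map (λ y → F (g x y)) ys)) xs) ∎

  ∑-colourings : ∀ k n (f : Fin n → A) Φ →
    ∑ (map (λ χ → ∏ᶠ k (λ j → Φ j (class j f χ))) (colourings k n)) ≡ ∑-fibres k (tabulate f) Φ
  ∑-colourings k zero    f Φ = ℤ.+-identityʳ _
  ∑-colourings k (suc n) f Φ = begin
    ∑ (map F (cartesianProductWith _∷_ (allFin k) (colourings k n)))
      ≡⟨ ∑-cartesianProductWith F _∷_ (allFin k) (colourings k n) ⟩
    ∑ (map (λ i → ∑ (map (λ χ → F (i ∷ χ)) (colourings k n))) (allFin k))
      ≡⟨ cong ∑ (map-tabulate id (λ i → ∑ (map (λ χ → F (i ∷ χ)) (colourings k n)))) ⟩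
    ∑ (tabulate (λ i → ∑ (map (λ χ → F (i ∷ χ)) (colourings k n))))
      ≡⟨ ∑-tabulate k (λ i → ∑ (map (λ χ → F (i ∷ χ)) (colourings k n))) ⟩
    ∑ᶠ k (λ i → ∑ (map (λ χ → F (i ∷ χ)) (colourings k n)))
      ≡⟨ ∑ᶠ-cong k (λ i → ≡-trans
           (cong ∑ (map-cong (λ χ → ∏ᶠ-cong k (λ j → float (does (j ≟ᶠ i)) j χ)) (colourings k n)))
           (∑-colourings k n (f ∘ suc) (bump i (f zero) Φ))) ⟩
    ∑-fibres k (tabulate f) Φ ∎
    where
    F : Vec (Fin k) (suc n) → ℤ
    F χ = ∏ᶠ k (λ j → Φ j (class j f χ))
    float : ∀ b j (χ : Vec (Fin k) n) →
            Φ j (if b then f zero ∷ class j (f ∘ suc) χ else class j (f ∘ suc) χ)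
            ≡ (if b then Φ j (f zero ∷ class j (f ∘ suc) χ) else Φ j (class j (f ∘ suc) χ))
    float true  j χ = refl
    float false j χ = refl

module _ {n : ℕ} (G : Graph n) where
  open Graph G

  adj : Fin n → Fin n → Bool
  adj u v = does (adj? u v)

  adj-sym : ∀ u v → adj u v ≡ adj v u
  adj-sym u v = does-⇔ (mk⇔ symm symm) (adj? u v) (adj? v u)

  adj-irrefl : ∀ v → adj v v ≡ false
  adj-irrefl v = dec-false (adj? v v) (irrefl refl)

  open StablePartitions adj adj-sym adj-irrefl

  indicator-proper : ∀ {k} (χ : Vec (Fin k) n) →
                     indicator (does (proper? G χ)) ≡ ∏ᶠ k (λ j → st (class j id χ))
  indicator-proper {k} χ = bits-≡ (indicator-bit (does (proper? G χ))) (∏ᶠ-bit k (λ j → st-bit (class j id χ))) to from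
    where
    nonadjacent : ∀ {u v} → ¬ Adj u v → nadj u v ≡ 1ℤ
    nonadjacent {u} {v} ¬uv = cong (indicator ∘ not) (dec-false (adj? u v) ¬uv)
    stable : ∀ B → (∀ {u v} → u ∈ B → v ∈ B → ¬ Adj u v) → st B ≡ 1ℤ
    stable []      _ = refl
    stable (v ∷ B) s = cong₂ _*_ (all-free B there) (stable B (λ u∈ v∈ → s (there u∈) (there v∈)))
      where
      all-free : ∀ C → (∀ {u} → u ∈ C → u ∈ v ∷ B) → free C v ≡ 1ℤ
      all-free []      _ = refl
      all-free (u ∷ C) ⊆ = cong₂ _*_ (nonadjacent (s (⊆ (here refl)) (here refl))) (all-free C (⊆ ∘ there))
    to : indicator (does (proper? G χ)) ≡ 1ℤ → ∏ᶠ k (λ j → st (class j id χ)) ≡ 1ℤ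
    to p = ∏ᶠ≡1⁺ k λ j → stable (class j id χ) λ u∈ v∈ uv → same-colour j u∈ v∈ uv
      where
      same-colour : ∀ j {u v} → u ∈ class j id χ → v ∈ class j id χ → ¬ Adj u v
      same-colour j u∈ v∈ uv
        with u , refl , χu ← ∈-class⁻ j id χ u∈
        with v , refl , χv ← ∈-class⁻ j id χ v∈
        = indicator≡1⇒ (proper? G χ) p u v uv (≡-trans χu (sym χv))
    from : ∏ᶠ k (λ j → st (class j id χ)) ≡ 1ℤ → indicator (does (proper? G χ)) ≡ 1ℤ
    from p = cong indicator (dec-true (proper? G χ) λ u v uv eq → 0≢1 (begin
      0ℤ        ≡⟨ cong (indicator ∘ not) (dec-true (adj? u v) uv) ⟨
      nadj u v  ≡⟨ ∏-∈ (λ w → nadj-bit w v) (st-free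
                     (∏ᶠ≡1⁻ k (λ j → st-bit (class j id χ)) p (lookupᵛ χ v))
                     (∈-class⁺ (lookupᵛ χ v) id χ v refl))
                     (∈-class⁺ (lookupᵛ χ v) id χ u eq) ⟩
      1ℤ        ∎))
      where
      0≢1 : 0ℤ ≢ 1ℤ
      0≢1 ()

  ∑-fibres-N : ∀ α U → ∑-fibres (length α) U (λ j B → δ (length B) (lookup α j) * st B) ≡ N U α
  ∑-fibres-N []      []      = refl
  ∑-fibres-N []      (_ ∷ _) = refl
  ∑-fibres-N (a ∷ α) U       = ≡-trans
    (∑-fibres-suc (length α) U (λ j B → δ (length B) (lookup (a ∷ α) j) * st B))
    (∑⊔-cong U (λ {B} {Q} _ → ≡-trans
      (cong (λ z → δ (length B) a * st B * z) (∑-fibres-N α Q))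
      (ℤ.*-assoc (δ (length B) a) (st B) (N Q α))))

  X-N : X G ≗ N (allFin n)
  X-N α = begin
    X G α
      ≡⟨ length-filter _ (colourings (length α) n) ⟩
    ∑ (map (λ χ → indicator (does (proper? G χ) ∧ does (≡-dec _≟_ (monomial χ) α))) (colourings (length α) n))
      ≡⟨ cong ∑ (map-cong factor (colourings (length α) n)) ⟩
    ∑ (map (λ χ → ∏ᶠ (length α) (λ j → Φ j (class j id χ))) (colourings (length α) n))
      ≡⟨ ∑-colourings (length α) n id Φ ⟩
    ∑-fibres (length α) (allFin n) Φ
      ≡⟨ ∑-fibres-N α (allFin n) ⟩
    N (allFin n) α ∎
    where
    Φ : Fin (length α) → List (Fin n) → ℤ
    Φ j B = δ (length B) (lookup α j) * st B
    factor : ∀ χ → indicator (does (proper? G χ) ∧ does (≡-dec _≟_ (monomial χ) α))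
                   ≡ ∏ᶠ (length α) (λ j → Φ j (class j id χ))
    factor χ = begin
      indicator (does (proper? G χ) ∧ does (≡-dec _≟_ (monomial χ) α))
        ≡⟨ indicator-∧ (does (proper? G χ)) (does (≡-dec _≟_ (monomial χ) α)) ⟩
      indicator (does (proper? G χ)) * indicator (does (≡-dec _≟_ (monomial χ) α))
        ≡⟨ cong₂ _*_ (indicator-proper χ) (≡-trans (indicator-≡-dec α (λ j → count (j ≟ᶠ_) χ))
             (∏ᶠ-cong (length α) (λ j → cong (λ m → δ m (lookup α j)) (sym (length-class j id χ))))) ⟩
      ∏ᶠ (length α) (λ j → st (class j id χ)) * ∏ᶠ (length α) (λ j → δ (length (class j id χ)) (lookup α j))
        ≡⟨ ℤ.*-comm (∏ᶠ (length α) (λ j → st (class j id χ))) _ ⟩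
      ∏ᶠ (length α) (λ j → δ (length (class j id χ)) (lookup α j)) * ∏ᶠ (length α) (λ j → st (class j id χ))
        ≡⟨ ∏ᶠ-* (length α) (λ j → δ (length (class j id χ)) (lookup α j)) (λ j → st (class j id χ)) ⟨
      ∏ᶠ (length α) (λ j → Φ j (class j id χ)) ∎

-- Reading off coefficients and positivity of hooks

∑-select : ∀ {A : Set} (f : A → ℤ) {x} xs → Unique xs → x ∈ xs →
           (∀ {y} → y ∈ xs → y ≢ x → f y ≡ 0ℤ) → ∑ (map f xs) ≡ f x
∑-select f {x} (y ∷ xs) (y∉ ∷ _) (here refl) f≡0 = ≡-trans
  (cong (λ z → f x + z) (others xs y∉ (λ z∈ → f≡0 (there z∈)))) (ℤ.+-identityʳ (f x))
  where
  others : ∀ zs → All (x ≢_) zs → (∀ {z} → z ∈ zs → z ≢ x → f z ≡ 0ℤ) → ∑ (map f zs) ≡ 0ℤ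
  others []       _          _   = refl
  others (z ∷ zs) (x≢z ∷ x∉) f≡0 =
    cong₂ _+_ (f≡0 (here refl) (x≢z ∘ sym)) (others zs x∉ (λ w∈ → f≡0 (there w∈)))
∑-select f {x} (y ∷ xs) (y∉ ∷ u) (there x∈) f≡0 = ≡-trans
  (cong₂ _+_ (f≡0 (here refl) (All.lookup y∉ x∈)) (∑-select f xs u x∈ (λ z∈ → f≡0 (there z∈))))
  (ℤ.+-identityˡ (f x))

sum-replicate-1 : ∀ d → sum (replicate d 1) ≡ d
sum-replicate-1 zero    = refl
sum-replicate-1 (suc d) = cong suc (sum-replicate-1 d)

extract : ∀ {n} (c : List ℕ → ℤ) (f : List ℕ → ℤ) {μ} → IsPartition μ → sum μ ≡ n →
          (∀ {ν} → IsPartition ν → ν ≢ μ → f ν ≡ 0ℤ) → f μ ≡ 1ℤ →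
          ∑ (map (λ ν → c ν * f ν) (partitions n)) ≡ c μ
extract {n} c f {μ} part sum≡n f≡0 f≡1 = begin
  ∑ (map (λ ν → c ν * f ν) (partitions n))
    ≡⟨ ∑-select (λ ν → c ν * f ν) (partitions n) (partitions-unique n)
         (Equivalence.from (∈-partitions {n}) (part , sum≡n))
         (λ {ν} ν∈ ν≢μ → ≡-trans
           (cong (λ z → c ν * z) (f≡0 (proj₁ (Equivalence.to (∈-partitions {n}) ν∈)) ν≢μ)) (ℤ.*-zeroʳ (c ν))) ⟩
  c μ * f μ
    ≡⟨ cong (λ z → c μ * z) f≡1 ⟩
  c μ * 1ℤ
    ≡⟨ ℤ.*-identityʳ (c μ) ⟩
  c μ ∎

column-positive : ∀ d → IsPartition (replicate d 1) → EPositive (replicate d 1)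
column-positive d part G c expansion = subst (0ℤ ≤_) (begin
  X G (d ∷ [])
    ≡⟨ expansion (d ∷ []) ⟩
  ∑ (map (λ ν → c ν * e[ ν ] (d ∷ [])) (partitions (sum (replicate d 1))))
    ≡⟨ extract c (λ ν → e[ ν ] (d ∷ [])) part refl (λ (_ , ν>0) ν≢ → e[]-single d ν>0 ν≢) (e[1^d]-single d) ⟩
  c (replicate d 1) ∎) (+≤+ z≤n)

hook-positive : ∀ k d → IsPartition (suc (suc k) ∷ replicate d 1) → EPositive (suc (suc k) ∷ replicate d 1)
hook-positive k d part G c expansion = subst (0ℤ ≤_) (begin
  P d (allFin n)
    ≡⟨ L-N (suc (suc k)) d (allFin n) |V| ⟨
  L (suc (suc k)) d (N (allFin n))
    ≡⟨ L-cong (suc (suc k)) d (X-N G) ⟨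
  L (suc (suc k)) d (X G)
    ≡⟨ L-cong (suc (suc k)) d expansion ⟩
  L (suc (suc k)) d (λ α → ∑ (map (λ ν → c ν * e[ ν ] α) (partitions n)))
    ≡⟨ L-∑ (suc (suc k)) d c e[_] (partitions n) ⟩
  ∑ (map (λ ν → c ν * L (suc (suc k)) d e[ ν ]) (partitions n))
    ≡⟨ extract c (λ ν → L (suc (suc k)) d e[ ν ]) part refl (L-e[≢hook] k d) (L-e[hook] k d) ⟩
  c (suc (suc k) ∷ replicate d 1) ∎) (P-nonneg d k (allFin n) |V|)
  where
  open StablePartitions (adj G) (adj-sym G) (adj-irrefl G)
  n = sum (suc (suc k) ∷ replicate d 1)
  |V| : length (allFin n) ≡ suc (suc k) +ⁿ d
  |V| = ≡-trans (length-tabulate {n = n} id) (cong (suc (suc k) +ⁿ_) (sum-replicate-1 d))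

-- Formal e-expansions of power sums and stars

-- The formal expansion of (-1)^j ∑ x_v^(j+1) e_i(other variables), as the sum of `φ ν` over index
-- lists weighted by the coefficient of e_ν. The base is ∑ x_v e_i(others) = (i+1) e_(i+1); the
-- step, as in Newton's identities, uses x_v e_i(others) = e_(i+1) - e_(i+1)(others).
κ : ℕ → ℕ → (List ℕ → ℤ) → ℤ
κ i zero    φ = pos (suc i) * φ (suc i ∷ [])
κ i (suc j) φ = κ (suc i) j φ - κ 0 j (φ ∘ (suc i ∷_))

-- The same for (-1)^w ∑ x_v^(w+1) (e_1 - x_v)^m, one factor e_1 - x_v at a time. At w = 0, x_v is
-- the colour of the centre of a star, which its m leaves must avoid.
ρ : ℕ → ℕ → (List ℕ → ℤ) → ℤ
ρ zero    w φ = κ 0 w φ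
ρ (suc m) w φ = ρ m w (φ ∘ (1 ∷_)) + ρ m (suc w) φ

κ-cong : ∀ i j {φ ψ} → (∀ ν → All (0 <ⁿ_) ν → sum ν ≡ suc (i +ⁿ j) → φ ν ≡ ψ ν) → κ i j φ ≡ κ i j ψ
κ-cong i zero    φ≡ψ = cong (λ z → pos (suc i) * z) (φ≡ψ (suc i ∷ []) (s≤s z≤n ∷ []) refl)
κ-cong i (suc j) φ≡ψ = cong₂ _-_
  (κ-cong (suc i) j (λ ν ν>0 |ν| → φ≡ψ ν ν>0 (≡-trans |ν| (cong suc (sym (ℕ.+-suc i j))))))
  (κ-cong 0 j (λ ν ν>0 |ν| → φ≡ψ (suc i ∷ ν) (s≤s z≤n ∷ ν>0) (cong (suc i +ⁿ_) |ν|)))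

ρ-cong : ∀ m w {φ ψ} → (∀ ν → All (0 <ⁿ_) ν → sum ν ≡ suc (m +ⁿ w) → φ ν ≡ ψ ν) → ρ m w φ ≡ ρ m w ψ
ρ-cong zero    w φ≡ψ = κ-cong 0 w φ≡ψ
ρ-cong (suc m) w φ≡ψ = cong₂ _+_
  (ρ-cong m w (λ ν ν>0 |ν| → φ≡ψ (1 ∷ ν) (s≤s z≤n ∷ ν>0) (cong suc |ν|)))
  (ρ-cong m (suc w) (λ ν ν>0 |ν| → φ≡ψ ν ν>0 (≡-trans |ν| (cong suc (ℕ.+-suc m w)))))

κ-linear : ∀ i j x φ ψ → κ i j (λ ν → x * φ ν + ψ ν) ≡ x * κ i j φ + κ i j ψ
κ-linear i zero    x φ ψ = rearrange (pos (suc i)) x (φ (suc i ∷ [])) (ψ (suc i ∷ []))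
  where
  rearrange : ∀ p x a b → p * (x * a + b) ≡ x * (p * a) + p * b
  rearrange = solve-∀
κ-linear i (suc j) x φ ψ = ≡-trans
  (cong₂ _-_ (κ-linear (suc i) j x φ ψ) (κ-linear 0 j x (φ ∘ (suc i ∷_)) (ψ ∘ (suc i ∷_))))
  (rearrange x (κ (suc i) j φ) (κ (suc i) j ψ) (κ 0 j (φ ∘ (suc i ∷_))) (κ 0 j (ψ ∘ (suc i ∷_))))
  where
  rearrange : ∀ x a b c d → (x * a + b) - (x * c + d) ≡ x * (a - c) + (b - d)
  rearrange = solve-∀

ρ-linear : ∀ m w x φ ψ → ρ m w (λ ν → x * φ ν + ψ ν) ≡ x * ρ m w φ + ρ m w ψ
ρ-linear zero    w x φ ψ = κ-linear 0 w x φ ψ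
ρ-linear (suc m) w x φ ψ = ≡-trans
  (cong₂ _+_ (ρ-linear m w x (φ ∘ (1 ∷_)) (ψ ∘ (1 ∷_))) (ρ-linear m (suc w) x φ ψ))
  (rearrange x (ρ m w (φ ∘ (1 ∷_))) (ρ m w (ψ ∘ (1 ∷_))) (ρ m (suc w) φ) (ρ m (suc w) ψ))
  where
  rearrange : ∀ x a b c d → (x * a + b) + (x * c + d) ≡ x * (a + c) + (b + d)
  rearrange = solve-∀

κ-0 : ∀ i j {φ} → (∀ x ν → φ (x ∷ ν) ≡ 0ℤ) → κ i j φ ≡ 0ℤ
κ-0 i zero    φ≡0 = ≡-trans (cong (λ z → pos (suc i) * z) (φ≡0 (suc i) [])) (ℤ.*-zeroʳ (pos (suc i)))
κ-0 i (suc j) φ≡0 = cong₂ _-_ (κ-0 (suc i) j φ≡0) (κ-0 0 j (λ x ν → φ≡0 (suc i) (x ∷ ν)))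

ρ-0 : ∀ m w {φ} → (∀ ν → φ ν ≡ 0ℤ) → ρ m w φ ≡ 0ℤ
ρ-0 zero    w φ≡0 = κ-0 0 w (λ x ν → φ≡0 (x ∷ ν))
ρ-0 (suc m) w φ≡0 = cong₂ _+_ (ρ-0 m w (φ≡0 ∘ (1 ∷_))) (ρ-0 m (suc w) φ≡0)

ρ-∑ : ∀ {a} {A : Set a} m w (c : A → ℤ) (f : A → List ℕ → ℤ) xs →
      ρ m w (λ ν → ∑ (map (λ x → f x ν * c x) xs)) ≡ ∑ (map (λ x → ρ m w (f x) * c x) xs)
ρ-∑ m w c f []       = ρ-0 m w (λ _ → refl)
ρ-∑ m w c f (x ∷ xs) = begin
  ρ m w (λ ν → f x ν * c x + ∑ (map (λ x → f x ν * c x) xs))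
    ≡⟨ ρ-cong m w (λ ν _ _ → cong (_+ ∑ (map (λ x → f x ν * c x) xs)) (ℤ.*-comm (f x ν) (c x))) ⟩
  ρ m w (λ ν → c x * f x ν + ∑ (map (λ x → f x ν * c x) xs))
    ≡⟨ ρ-linear m w (c x) (f x) (λ ν → ∑ (map (λ x → f x ν * c x) xs)) ⟩
  c x * ρ m w (f x) + ρ m w (λ ν → ∑ (map (λ x → f x ν * c x) xs))
    ≡⟨ cong₂ _+_ (ℤ.*-comm (c x) (ρ m w (f x))) (ρ-∑ m w c f xs) ⟩
  ρ m w (f x) * c x + ∑ (map (λ x → ρ m w (f x) * c x) xs) ∎

private
  κ-single : ∀ i j {φ} → (∀ x y ν → φ (x ∷ y ∷ ν) ≡ 0ℤ) →
             κ i j φ ≡ pos (suc (i +ⁿ j)) * φ (suc (i +ⁿ j) ∷ [])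
  κ-single i zero    φ≡0 rewrite ℕ.+-identityʳ i = refl
  κ-single i (suc j) {φ} φ≡0 rewrite ℕ.+-suc i j = ≡-trans
    (cong₂ _-_ (κ-single (suc i) j φ≡0) (κ-0 0 j (φ≡0 (suc i)))) (ℤ.+-identityʳ _)

  pos-nonneg : ∀ n {x} → 0ℤ ≤ x → 0ℤ ≤ pos n * x
  pos-nonneg n = *-nonneg {pos n} (+≤+ z≤n)

  minus-≤ : ∀ {x y} → 0ℤ ≤ y → x - y ≤ x
  minus-≤ {x} {y} y≥0 = subst (x - y ≤_) (ℤ.+-identityʳ x) (ℤ.+-monoʳ-≤ x (ℤ.neg-mono-≤ y≥0))

module _ {φ : List ℕ → ℤ}
  (φ₁ : ∀ x → φ (x ∷ []) ≡ 0ℤ) (φ₂ : ∀ x y → 0ℤ ≤ φ (x ∷ y ∷ [])) (φ₃ : ∀ x y z ν → φ (x ∷ y ∷ z ∷ ν) ≡ 0ℤ)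
  where

  private
    κ-suc : ∀ i j → κ i (suc j) φ ≡ κ (suc i) j φ - pos (suc j) * φ (suc i ∷ suc j ∷ [])
    κ-suc i j = cong (λ z → κ (suc i) j φ - z) (κ-single 0 j (φ₃ (suc i)))

  -- With `φ` concentrated on lists of length two, each step subtracts a nonnegative multiple of one
  -- value of `φ`, and the base is 0.
  κ-nonpos : ∀ i j → κ i j φ ≤ 0ℤ
  κ-nonpos i zero    = ℤ.≤-reflexive (≡-trans (cong (λ z → pos (suc i) * z) (φ₁ (suc i))) (ℤ.*-zeroʳ (pos (suc i))))
  κ-nonpos i (suc j) = subst (_≤ 0ℤ) (sym (κ-suc i j))
    (ℤ.≤-trans (minus-≤ (pos-nonneg (suc j) (φ₂ (suc i) (suc j)))) (κ-nonpos (suc i) j))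

  -- After `d` steps the recursion reaches the first index `suc x` and subtracts `suc y`, which is
  -- positive.
  κ-negative : ∀ x y → φ (suc x ∷ suc y ∷ []) ≡ 1ℤ → ∀ i d → i +ⁿ d ≡ x → κ i (d +ⁿ suc y) φ < 0ℤ
  κ-negative x y φ≡1 i zero eq rewrite ≡-trans (sym (ℕ.+-identityʳ i)) eq | κ-suc x y | φ≡1 =
    subst (_< 0ℤ) (cong (λ z → κ (suc x) y φ - z) (sym (ℤ.*-identityʳ (pos (suc y)))))
      (ℤ.<-≤-trans (subst (κ (suc x) y φ - pos (suc y) <_) (ℤ.+-identityʳ _)
        (ℤ.+-monoʳ-< (κ (suc x) y φ) -<+)) (κ-nonpos (suc x) y))
  κ-negative x y φ≡1 i (suc d) eq = subst (_< 0ℤ) (sym (κ-suc i (d +ⁿ suc y)))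
    (ℤ.≤-<-trans (minus-≤ (pos-nonneg (suc (d +ⁿ suc y)) (φ₂ (suc i) (suc (d +ⁿ suc y)))))
      (κ-negative x y φ≡1 (suc i) d (≡-trans (sym (ℕ.+-suc i d)) eq)))

  -- Lists starting with 1 do not count, so of (e_1 - x_v)^m only (-x_v)^m matters: what remains is
  -- (-1)^m times the power sum of degree m + 1.
  ρ-negative : (∀ ν → φ (1 ∷ ν) ≡ 0ℤ) → ∀ x y → φ (suc x ∷ suc y ∷ []) ≡ 1ℤ → ρ (x +ⁿ suc y) 0 φ < 0ℤ
  ρ-negative φ1 x y φ≡1 = subst (_< 0ℤ) (sym (≡-trans (ρ-κ (x +ⁿ suc y) 0) (cong (λ n → κ 0 n φ) (ℕ.+-identityʳ (x +ⁿ suc y)))))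
    (κ-negative x y φ≡1 0 x refl)
    where
    ρ-κ : ∀ m w → ρ m w φ ≡ κ 0 (m +ⁿ w) φ
    ρ-κ zero    w = refl
    ρ-κ (suc m) w = ≡-trans (cong₂ _+_ (ρ-0 m w φ1) (ρ-κ m (suc w)))
      (≡-trans (ℤ.+-identityˡ (κ 0 (m +ⁿ suc w) φ)) (cong (λ n → κ 0 n φ) (ℕ.+-suc m w)))

-- Series of stars, complete graphs and disjoint unions

E-0 : ∀ m → E m (λ _ → 0ℤ) ≗ λ _ → 0ℤ
E-0 zero    α           = refl
E-0 (suc m) []          = refl
E-0 (suc m) (zero  ∷ α) = E-0 (suc m) α
E-0 (suc m) (suc i ∷ α) = cong₂ _+_ (E-0 (suc m) α) (E-0 m α)

E-minus : ∀ m f g → E m (λ α → f α - g α) ≗ λ α → E m f α - E m g α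
E-minus m f g α = begin
  E m (λ α → f α - g α) α          ≡⟨ E-cong m (λ β → rearrange (f β) (g β)) α ⟩
  E m (λ α → - 1ℤ * g α + f α) α   ≡⟨ E-linear m (- 1ℤ) g f α ⟩
  - 1ℤ * E m g α + E m f α         ≡⟨ rearrange (E m f α) (E m g α) ⟨
  E m f α - E m g α                ∎
  where
  rearrange : ∀ x y → x - y ≡ - 1ℤ * y + x
  rearrange = solve-∀

E-∑⊔ : ∀ {A : Set} m (Φ : List A → List A → Series) U α →
       E m (λ α → ∑⊔ (λ B Q → Φ B Q α) U) α ≡ ∑⊔ (λ B Q → E m (Φ B Q) α) U
E-∑⊔ m Φ []      α = refl
E-∑⊔ m Φ (v ∷ U) α = ≡-trans
  (E-+ m (λ α → ∑⊔ (λ B Q → Φ (v ∷ B) Q α) U) (λ α → ∑⊔ (λ B Q → Φ B (v ∷ Q) α) U) α)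
  (cong₂ _+_ (E-∑⊔ m (λ B Q → Φ (v ∷ B) Q) U α) (E-∑⊔ m (λ B Q → Φ B (v ∷ Q)) U α))

κ-E : ∀ i j m (F : List ℕ → Series) α → κ i j (λ ν → E m (F ν) α) ≡ E m (λ α → κ i j (λ ν → F ν α)) α
κ-E i zero    m F α = sym (E-* m (pos (suc i)) (F (suc i ∷ [])) α)
κ-E i (suc j) m F α = ≡-trans
  (cong₂ _-_ (κ-E (suc i) j m F α) (κ-E 0 j m (F ∘ (suc i ∷_)) α))
  (sym (E-minus m (λ α → κ (suc i) j (λ ν → F ν α)) (λ α → κ 0 j (λ ν → F (suc i ∷ ν) α)) α))

ρ-E : ∀ m w n (F : List ℕ → Series) α → ρ m w (λ ν → E n (F ν) α) ≡ E n (λ α → ρ m w (λ ν → F ν α)) α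
ρ-E zero    w n F α = κ-E 0 w n F α
ρ-E (suc m) w n F α = ≡-trans
  (cong₂ _+_ (ρ-E m w n (F ∘ (1 ∷_)) α) (ρ-E m (suc w) n F α))
  (sym (E-+ n (λ α → ρ m w (λ ν → F (1 ∷ ν) α)) (λ α → ρ m (suc w) (λ ν → F ν α)) α))

-- (-1)^j K i j = ∑ x_v^(j+1) e_i(the other variables), summed over all variables x_v.
K : ℕ → ℕ → Series
K i zero    α = pos (suc i) * E (suc i) one α
K i (suc j) α = K (suc i) j α - E (suc i) (K 0 j) α

κ-e[] : ∀ i j α → κ i j (λ ν → e[ ν ] α) ≡ K i j α
κ-e[] i zero    α = cong (λ z → pos (suc i) * z) (e[]-∷ (suc i) [] α)
κ-e[] i (suc j) α = cong₂ _-_ (κ-e[] (suc i) j α) (begin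
  κ 0 j (λ ν → e[ suc i ∷ ν ] α)               ≡⟨ κ-cong 0 j (λ ν _ _ → e[]-∷ (suc i) ν α) ⟩
  κ 0 j (λ ν → E (suc i) e[ ν ] α)             ≡⟨ κ-E 0 j (suc i) e[_] α ⟩
  E (suc i) (λ α → κ 0 j (λ ν → e[ ν ] α)) α   ≡⟨ E-cong (suc i) (κ-e[] 0 j) α ⟩
  E (suc i) (K 0 j) α                          ∎)

-- (-1)^w S m w = ∑ x_v^(w+1) (e_1 - x_v)^m, so S m 0 is the star with m leaves.
S : ℕ → ℕ → Series
S zero    w α = K 0 w α
S (suc m) w α = E 1 (S m w) α + S m (suc w) α

ρ-e[] : ∀ m w α → ρ m w (λ ν → e[ ν ] α) ≡ S m w α
ρ-e[] zero    w α = κ-e[] 0 w α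
ρ-e[] (suc m) w α = cong₂ _+_ (begin
  ρ m w (λ ν → e[ 1 ∷ ν ] α)           ≡⟨ ρ-cong m w (λ ν _ _ → e[]-∷ 1 ν α) ⟩
  ρ m w (λ ν → E 1 e[ ν ] α)           ≡⟨ ρ-E m w 1 e[_] α ⟩
  E 1 (λ α → ρ m w (λ ν → e[ ν ] α)) α ≡⟨ E-cong 1 (ρ-e[] m w) α ⟩
  E 1 (S m w) α                        ∎) (ρ-e[] m (suc w) α)

K-[] : ∀ i j → K i j [] ≡ 0ℤ
K-[] i zero    = ℤ.*-zeroʳ (pos (suc i))
K-[] i (suc j) = cong (_- 0ℤ) (K-[] (suc i) j)

S-[] : ∀ m w → S m w [] ≡ 0ℤ
S-[] zero    w = K-[] 0 w
S-[] (suc m) w = cong (λ z → 0ℤ + z) (S-[] m (suc w))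

∂K-zero : ∀ i j → ∂ 0 (K i j) ≗ K i j
∂K-zero i zero    α = refl
∂K-zero i (suc j) α = cong₂ _-_ (∂K-zero (suc i) j α) (E-cong (suc i) (∂K-zero 0 j) α)

K⁻ : ℕ → ℕ → Series
K⁻ zero    j α = 0ℤ
K⁻ (suc i) j α = K i j α

-- If x_v is another variable, the first one comes from e_i, so its exponent is 1 and `i` drops by
-- one. If x_v is the first variable, its exponent is j + 1 and e_i of the others remains.
∂K-suc : ∀ i j a α → K i j (suc a ∷ α) ≡ δ 0 a * K⁻ i j α + sign j * δ j a * E i one α
∂K-suc i zero zero α = ≡-trans (cong (λ z → pos (suc i) * (z + E i one α)) (E-0 (suc i) α)) (lower i)
  where
  rearrange : ∀ p x → (1ℤ + p) * (0ℤ + x) ≡ 1ℤ * (p * x) + 1ℤ * 1ℤ * x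
  rearrange = solve-∀
  base : ∀ x → 1ℤ * (0ℤ + x) ≡ 1ℤ * 0ℤ + 1ℤ * 1ℤ * x
  base = solve-∀
  lower : ∀ i → pos (suc i) * (0ℤ + E i one α) ≡ 1ℤ * K⁻ i 0 α + 1ℤ * 1ℤ * E i one α
  lower zero    = base (one α)
  lower (suc i) = rearrange (pos (suc i)) (E (suc i) one α)
∂K-suc i zero (suc a) α = ≡-trans
  (cong₂ (λ y z → pos (suc i) * (y + z)) (E-0 (suc i) α) (E-0 i α))
  (vanish (pos (suc i)) (E i one α))
  where
  vanish : ∀ p x → p * (0ℤ + 0ℤ) ≡ 0ℤ + 0ℤ * x
  vanish = solve-∀
∂K-suc i (suc j) a α = ≡-trans
  (cong₂ _-_ (∂K-suc (suc i) j a α) (cong (_+ E i (∂ a (K 0 j)) α) (E-p-suc (suc i) a)))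
  (split a)
  where
  p-suc : ∀ a → ∂ (suc a) (K 0 j) ≗ λ α → sign j * δ j a * one α
  p-suc a α = ≡-trans (∂K-suc 0 j a α)
    (≡-trans (cong (_+ sign j * δ j a * one α) (ℤ.*-zeroʳ (δ 0 a))) (ℤ.+-identityˡ _))
  E-p-suc : ∀ m a → E m (∂ (suc a) (K 0 j)) α ≡ sign j * δ j a * E m one α
  E-p-suc m a = ≡-trans (E-cong m (p-suc a) α) (E-* m (sign j * δ j a) one α)
  x₁ = E (suc i) one α
  y₁ = E i one α
  split : ∀ a → (δ 0 a * K i j α + sign j * δ j a * x₁) - (sign j * δ j a * x₁ + E i (∂ a (K 0 j)) α)
          ≡ δ 0 a * K⁻ i (suc j) α + - sign j * δ (suc j) a * y₁
  split zero = ≡-trans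
    (cong (λ z → (1ℤ * K i j α + sign j * δ j 0 * x₁) - (sign j * δ j 0 * x₁ + z)) (E-cong i (∂K-zero 0 j) α))
    (≡-trans (cancel (K i j α) (sign j * δ j 0 * x₁) (E i (K 0 j) α) (sign j) y₁)
      (cong (λ z → 1ℤ * z + - sign j * 0ℤ * y₁) (lower i)))
    where
    cancel : ∀ k x y s z → (1ℤ * k + x) - (x + y) ≡ 1ℤ * (k - y) + - s * 0ℤ * z
    cancel = solve-∀
    lower : ∀ i → K i j α - E i (K 0 j) α ≡ K⁻ i (suc j) α
    lower zero    = ℤ.+-inverseʳ (K 0 j α)
    lower (suc i) = refl
  split (suc a) = ≡-trans
    (cong (λ z → (0ℤ + sign j * δ j (suc a) * x₁) - (sign j * δ j (suc a) * x₁ + z)) (E-p-suc i a))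
    (cancel (sign j * δ j (suc a) * x₁) (sign j) (δ j a) y₁)
    where
    cancel : ∀ x s d y → (0ℤ + x) - (x + s * d * y) ≡ 0ℤ + - s * d * y
    cancel = solve-∀

e₁^ : ℕ → Series
e₁^ zero    = one
e₁^ (suc m) = E 1 (e₁^ m)

module _ {A : Set} where

  -- The list only provides its length: binomial coefficients are written as sums over sublists to
  -- match the recursion of `N`.
  ∂-e₁^ : ∀ (U : List A) i α → e₁^ (length U) (i ∷ α) ≡ ∑⊔ (λ B Q → δ (length B) i * e₁^ (length Q) α) U
  ∂-e₁^ []      zero    α = sym (ℤ.*-identityˡ (one α))
  ∂-e₁^ []      (suc i) α = refl
  ∂-e₁^ (v ∷ U) i       α = ≡-trans (leibniz i) (ℤ.+-comm _ (∑⊔ (λ B Q → δ (suc (length B)) i * e₁^ (length Q) α) U))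
    where
    E-∂ : ∀ i → E 1 (∂ i (e₁^ (length U))) α ≡ ∑⊔ (λ B Q → δ (length B) i * e₁^ (suc (length Q)) α) U
    E-∂ i = begin
      E 1 (∂ i (e₁^ (length U))) α
        ≡⟨ E-cong 1 (∂-e₁^ U i) α ⟩
      E 1 (λ α → ∑⊔ (λ B Q → δ (length B) i * e₁^ (length Q) α) U) α
        ≡⟨ E-∑⊔ 1 (λ B Q α → δ (length B) i * e₁^ (length Q) α) U α ⟩
      ∑⊔ (λ B Q → E 1 (λ α → δ (length B) i * e₁^ (length Q) α) α) U
        ≡⟨ ∑⊔-cong U (λ {B} {Q} _ → E-* 1 (δ (length B) i) (e₁^ (length Q)) α) ⟩
      ∑⊔ (λ B Q → δ (length B) i * e₁^ (suc (length Q)) α) U ∎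
    leibniz : ∀ i → e₁^ (suc (length U)) (i ∷ α)
              ≡ ∑⊔ (λ B Q → δ (length B) i * e₁^ (suc (length Q)) α) U
              + ∑⊔ (λ B Q → δ (suc (length B)) i * e₁^ (length Q) α) U
    leibniz zero    = ≡-trans (E-∂ 0) (sym (≡-trans
      (cong (λ z → ∑⊔ (λ B Q → δ (length B) 0 * e₁^ (suc (length Q)) α) U + z) (∑⊔-0 U (λ _ → refl)))
      (ℤ.+-identityʳ _)))
    leibniz (suc i) = cong₂ _+_ (E-∂ (suc i)) (∂-e₁^ U i α)

  -- Either x_v is the first variable, which e_1 - x_v then lacks, or `i` of the factors e_1 - x_v
  -- supply it.
  ∂-S : ∀ (U : List A) w i α → S (length U) w (i ∷ α)
        ≡ sign w * δ (suc w) i * e₁^ (length U) α + ∑⊔ (λ B Q → δ (length B) i * S (length Q) w α) U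
  ∂-S [] w zero    α = ≡-trans (∂K-zero 0 w α) (base (sign w) (one α) (K 0 w α))
    where
    base : ∀ s x k → k ≡ s * 0ℤ * x + 1ℤ * k
    base = solve-∀
  ∂-S [] w (suc i) α = ≡-trans (∂K-suc 0 w i α) (base (δ 0 i) (sign w * δ w i * one α))
    where
    base : ∀ d x → d * 0ℤ + x ≡ x + 0ℤ
    base = solve-∀
  ∂-S (v ∷ U) w i α = ≡-trans
    (cong₂ _+_ (leibniz i) (∂-S U (suc w) i α))
    (≡-trans
      (rearrange (sign w) (δ (suc w) i) (δ (suc (suc w)) i) (e₁^ (suc (length U)) α) (e₁^ (length U) α)
        (∑⊔ (λ B Q → δ (length B) i * E 1 (S (length Q) w) α) U)
        (∑⊔ (λ B Q → δ (suc (length B)) i * S (length Q) w α) U)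
        (∑⊔ (λ B Q → δ (length B) i * S (length Q) (suc w) α) U))
      (cong (λ z → sign w * δ (suc w) i * e₁^ (suc (length U)) α
                   + (∑⊔ (λ B Q → δ (suc (length B)) i * S (length Q) w α) U + z))
        (≡-trans
          (sym (∑⊔-+ (λ B Q → δ (length B) i * E 1 (S (length Q) w) α) (λ B Q → δ (length B) i * S (length Q) (suc w) α) U))
          (∑⊔-cong U (λ {B} {Q} _ → sym (ℤ.*-distribˡ-+ (δ (length B) i) (E 1 (S (length Q) w) α) (S (length Q) (suc w) α)))))))
    where
    rearrange : ∀ s d d′ x y p q r →
      ((s * d * x + p) + (s * d′ * y + q)) + (- s * d′ * y + r) ≡ s * d * x + (q + (p + r))
    rearrange = solve-∀
    E-∂ : ∀ i → E 1 (∂ i (S (length U) w)) α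
          ≡ sign w * δ (suc w) i * e₁^ (suc (length U)) α + ∑⊔ (λ B Q → δ (length B) i * E 1 (S (length Q) w) α) U
    E-∂ i = begin
      E 1 (∂ i (S (length U) w)) α
        ≡⟨ E-cong 1 (∂-S U w i) α ⟩
      E 1 (λ α → sign w * δ (suc w) i * e₁^ (length U) α + ∑⊔ (λ B Q → δ (length B) i * S (length Q) w α) U) α
        ≡⟨ E-linear 1 (sign w * δ (suc w) i) (e₁^ (length U)) (λ α → ∑⊔ (λ B Q → δ (length B) i * S (length Q) w α) U) α ⟩
      sign w * δ (suc w) i * e₁^ (suc (length U)) α + E 1 (λ α → ∑⊔ (λ B Q → δ (length B) i * S (length Q) w α) U) α
        ≡⟨ cong (λ z → sign w * δ (suc w) i * e₁^ (suc (length U)) α + z) (≡-trans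
             (E-∑⊔ 1 (λ B Q α → δ (length B) i * S (length Q) w α) U α)
             (∑⊔-cong U (λ {B} {Q} _ → E-* 1 (δ (length B) i) (S (length Q) w) α))) ⟩
      sign w * δ (suc w) i * e₁^ (suc (length U)) α + ∑⊔ (λ B Q → δ (length B) i * E 1 (S (length Q) w) α) U ∎
    leibniz : ∀ i → E 1 (S (length U) w) (i ∷ α)
              ≡ (sign w * δ (suc w) i * e₁^ (suc (length U)) α + ∑⊔ (λ B Q → δ (length B) i * E 1 (S (length Q) w) α) U)
              + (sign w * δ (suc (suc w)) i * e₁^ (length U) α + ∑⊔ (λ B Q → δ (suc (length B)) i * S (length Q) w α) U)
    leibniz zero    = ≡-trans (E-∂ 0) (≡-trans (pad _ (sign w) (e₁^ (length U) α))
      (cong (λ z → (sign w * 0ℤ * e₁^ (suc (length U)) α + ∑⊔ (λ B Q → δ (length B) 0 * E 1 (S (length Q) w) α) U)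
                   + (sign w * 0ℤ * e₁^ (length U) α + z)) (sym (∑⊔-0 U (λ _ → refl)))))
      where
      pad : ∀ x s y → x ≡ x + (s * 0ℤ * y + 0ℤ)
      pad = solve-∀
    leibniz (suc i) = cong₂ _+_ (E-∂ (suc i)) (∂-S U w i α)

  All-interleavingˡ : ∀ {P : A → Set} {B Q U} → Interleaving B Q U → All P U → All P B
  All-interleavingˡ []        _        = []
  All-interleavingˡ (consˡ i) (p ∷ ps) = p ∷ All-interleavingˡ i ps
  All-interleavingˡ (consʳ i) (p ∷ ps) = All-interleavingˡ i ps

  All-interleavingʳ : ∀ {P : A → Set} {B Q U} → Interleaving B Q U → All P U → All P Q
  All-interleavingʳ []        _        = []
  All-interleavingʳ (consˡ i) (p ∷ ps) = All-interleavingʳ i ps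
  All-interleavingʳ (consʳ i) (p ∷ ps) = p ∷ All-interleavingʳ i ps

  AllPairs-interleavingˡ : ∀ {R : A → A → Set} {B Q U} → Interleaving B Q U → AllPairs R U → AllPairs R B
  AllPairs-interleavingˡ []        _        = []
  AllPairs-interleavingˡ (consˡ i) (p ∷ ps) = All-interleavingˡ i p ∷ AllPairs-interleavingˡ i ps
  AllPairs-interleavingˡ (consʳ i) (p ∷ ps) = AllPairs-interleavingˡ i ps

  AllPairs-interleavingʳ : ∀ {R : A → A → Set} {B Q U} → Interleaving B Q U → AllPairs R U → AllPairs R Q
  AllPairs-interleavingʳ []        _        = []
  AllPairs-interleavingʳ (consˡ i) (p ∷ ps) = AllPairs-interleavingʳ i ps
  AllPairs-interleavingʳ (consʳ i) (p ∷ ps) = All-interleavingʳ i p ∷ AllPairs-interleavingʳ i ps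

  ∑⊔-++ : ∀ (Φ : List A → List A → ℤ) U V →
          ∑⊔ Φ (U ++ V) ≡ ∑⊔ (λ B Q → ∑⊔ (λ B′ Q′ → Φ (B ++ B′) (Q ++ Q′)) V) U
  ∑⊔-++ Φ []      V = refl
  ∑⊔-++ Φ (u ∷ U) V = cong₂ _+_ (∑⊔-++ (λ B Q → Φ (u ∷ B) Q) U V) (∑⊔-++ (λ B Q → Φ B (u ∷ Q)) U V)

  ∑⊔-δ₁ : ∀ x (U : List A) → ∑⊔ (λ B Q → δ (length B) 1 * x) U ≡ pos (length U) * x
  ∑⊔-δ₁ x []      = refl
  ∑⊔-δ₁ x (u ∷ U) = ≡-trans
    (cong₂ _+_ (∑⊔-[] {Φ = λ B _ → δ (length B) 0 * x} U (λ _ → refl)) (∑⊔-δ₁ x U))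
    (sym (ℤ.*-distribʳ-+ x 1ℤ (pos (length U))))

module _ {A : Set} (adj : A → A → Bool) (adj-sym : ∀ u v → adj u v ≡ adj v u) (adj-irrefl : ∀ v → adj v v ≡ false) where

  open StablePartitions adj adj-sym adj-irrefl

  module _ {Leaf : A → Set} (leaves-independent : ∀ {u v} → Leaf u → Leaf v → nadj u v ≡ 1ℤ) where

    independent-free : ∀ {B v} → Leaf v → All Leaf B → free B v ≡ 1ℤ
    independent-free v []       = refl
    independent-free v (u ∷ us) = cong₂ _*_ (leaves-independent u v) (independent-free v us)

    independent-st : ∀ {B} → All Leaf B → st B ≡ 1ℤ
    independent-st []       = refl
    independent-st (v ∷ vs) = cong₂ _*_ (independent-free v vs) (independent-st vs)

    N-independent : ∀ α {U} → All Leaf U → N U α ≡ e₁^ (length U) α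
    N-independent []      {[]}    _ = refl
    N-independent []      {_ ∷ _} _ = refl
    N-independent (i ∷ α) {U} leaves = ≡-trans
      (∑⊔-cong U (λ {B} {Q} s → cong (λ z → δ (length B) i * z) (≡-trans
        (cong₂ _*_ (independent-st (All-interleavingˡ s leaves)) (N-independent α (All-interleavingʳ s leaves)))
        (ℤ.*-identityˡ (e₁^ (length Q) α)))))
      (sym (∂-e₁^ U i α))

    N-star : ∀ {c} → (∀ {v} → Leaf v → nadj v c ≡ 0ℤ) → ∀ α {U} → All Leaf U → N (c ∷ U) α ≡ S (length U) 0 α
    N-star c-adj []      {U} _ = sym (S-[] (length U) 0)
    N-star {c} c-adj (i ∷ α) {U} leaves = begin
      ∑⊔ (λ B Q → δ (suc (length B)) i * (free B c * st B * N Q α)) U + ∑⊔ (λ B Q → δ (length B) i * (st B * N (c ∷ Q) α)) U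
        ≡⟨ cong₂ _+_
             (∑⊔-[] {Φ = λ B Q → δ (suc (length B)) i * (free B c * st B * N Q α)} U centre-alone)
             (∑⊔-cong U (λ {B} {Q} s → cong (λ z → δ (length B) i * z) (≡-trans
               (cong₂ _*_ (independent-st (All-interleavingˡ s leaves)) (N-star c-adj α (All-interleavingʳ s leaves)))
               (ℤ.*-identityˡ (S (length Q) 0 α))))) ⟩
      δ 1 i * (1ℤ * 1ℤ * N U α) + ∑⊔ (λ B Q → δ (length B) i * S (length Q) 0 α) U
        ≡⟨ cong (_+ ∑⊔ (λ B Q → δ (length B) i * S (length Q) 0 α) U)
             (≡-trans (rearrange (δ 1 i) (N U α)) (cong (λ z → 1ℤ * δ 1 i * z) (N-independent α leaves))) ⟩
      1ℤ * δ 1 i * e₁^ (length U) α + ∑⊔ (λ B Q → δ (length B) i * S (length Q) 0 α) U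
        ≡⟨ ∂-S U 0 i α ⟨
      S (length U) 0 (i ∷ α) ∎
      where
      rearrange : ∀ d n → d * (1ℤ * 1ℤ * n) ≡ 1ℤ * d * n
      rearrange = solve-∀
      centre-alone : ∀ {b B Q} → Interleaving (b ∷ B) Q U →
                     δ (suc (suc (length B))) i * (nadj b c * free B c * (free B b * st B) * N Q α) ≡ 0ℤ
      centre-alone {b} {B} {Q} s with b-leaf ∷ _ ← All-interleavingˡ s leaves = ≡-trans
        (cong (λ z → δ (suc (suc (length B))) i * (z * free B c * (free B b * st B) * N Q α)) (c-adj b-leaf))
        (ℤ.*-zeroʳ (δ (suc (suc (length B))) i))

  module _ {Inner Outer : A → Set} (separated : ∀ {u v} → Inner u → Outer v → nadj v u ≡ 1ℤ) where

    separated-free : ∀ {B u} → Inner u → All Outer B → free B u ≡ 1ℤ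
    separated-free u []       = refl
    separated-free u (v ∷ vs) = cong₂ _*_ (separated u v) (separated-free u vs)

    -- A stable class meets the clique in at most one vertex. If it meets it, there are |C| choices,
    -- which is how the factorial builds up.
    N-clique : ∀ α {C U} → AllPairs (λ u v → nadj v u ≡ 0ℤ) C → All Inner C → All Outer U →
               N (C ++ U) α ≡ pos (length C !) * E (length C) (N U) α
    N-clique []      {[]}    {U} _ _ _ = sym (ℤ.*-identityˡ (ε U))
    N-clique []      {c ∷ C}     _ _ _ = sym (ℤ.*-zeroʳ (pos (suc (length C) !)))
    N-clique (i ∷ α) {C} {U} clique inner outer = begin
      N (C ++ U) (i ∷ α)
        ≡⟨ ∑⊔-++ (λ B Q → δ (length B) i * (st B * N Q α)) C U ⟩
      ∑⊔ (λ B Q → ∑⊔ (Φ B Q) U) C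
        ≡⟨ ∑⊔-cong C part ⟩
      ∑⊔ (λ B Q → δ (length B) 0 * x + δ (length B) 1 * y) C
        ≡⟨ ∑⊔-+ (λ B Q → δ (length B) 0 * x) (λ B Q → δ (length B) 1 * y) C ⟩
      ∑⊔ (λ B Q → δ (length B) 0 * x) C + ∑⊔ (λ B Q → δ (length B) 1 * y) C
        ≡⟨ cong₂ _+_ (∑⊔-[] {Φ = λ B _ → δ (length B) 0 * x} C (λ _ → refl)) (∑⊔-δ₁ y C) ⟩
      1ℤ * x + pos (length C) * y
        ≡⟨ leibniz (length C) i ⟩
      pos (length C !) * E (length C) (N U) (i ∷ α) ∎
      where
      Φ : List A → List A → List A → List A → ℤ
      Φ B Q B′ Q′ = δ (length (B ++ B′)) i * (st (B ++ B′) * N (Q ++ Q′) α)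
      ∂⁻N : ℕ → Series
      -- A clique vertex takes one place in the first class; a class of size 0 has no room for it.
      ∂⁻N zero    _ = 0ℤ
      ∂⁻N (suc i) = ∂ i (N U)
      x = pos (length C !) * E (length C) (∂ i (N U)) α
      -- For an empty clique the value of `ℕ.pred` is immaterial, since `y` gets multiplied by |C| =
      -- 0.
      y = pos (ℕ.pred (length C) !) * E (ℕ.pred (length C)) (∂⁻N i) α
      leibniz : ∀ m i → 1ℤ * (pos (m !) * E m (∂ i (N U)) α) + pos m * (pos (ℕ.pred m !) * E (ℕ.pred m) (∂⁻N i) α)
                ≡ pos (m !) * E m (N U) (i ∷ α)
      leibniz zero    i       = base (∂ i (N U) α) (∂⁻N i α)
        where
        base : ∀ n z → 1ℤ * (1ℤ * n) + 0ℤ * (1ℤ * z) ≡ 1ℤ * n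
        base = solve-∀
      leibniz (suc m) zero    = ≡-trans
        (cong (λ z → 1ℤ * (pos (suc m !) * E (suc m) (∂ 0 (N U)) α) + pos (suc m) * (pos (m !) * z)) (E-0 m α))
        (base (pos (suc m !) * E (suc m) (∂ 0 (N U)) α) (pos (suc m)) (pos (m !)))
        where
        base : ∀ x p q → 1ℤ * x + p * (q * 0ℤ) ≡ x
        base = solve-∀
      leibniz (suc m) (suc i) = ≡-trans
        (rearrange (pos (suc m !)) (pos (suc m)) (pos (m !)) (E (suc m) (∂ (suc i) (N U)) α) (E m (∂ i (N U)) α))
        (≡-trans (cong (λ z → pos (suc m !) * E (suc m) (∂ (suc i) (N U)) α + z * E m (∂ i (N U)) α) (sym (ℤ.pos-* (suc m) (m !))))
          (sym (ℤ.*-distribˡ-+ (pos (suc m !)) (E (suc m) (∂ (suc i) (N U)) α) (E m (∂ i (N U)) α))))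
        where
        rearrange : ∀ f p q e e′ → 1ℤ * (f * e) + p * (q * e′) ≡ f * e + (p * q) * e′
        rearrange = solve-∀
      remaining : ∀ {Q} → AllPairs (λ u v → nadj v u ≡ 0ℤ) Q → All Inner Q → (f : List A → ℤ) (g : Series) →
                  (∀ α → ∑⊔ (λ B′ Q′ → f B′ * N Q′ α) U ≡ g α) →
                  ∑⊔ (λ B′ Q′ → f B′ * N (Q ++ Q′) α) U ≡ pos (length Q !) * E (length Q) g α
      remaining {Q} clique inner f g eq = begin
        ∑⊔ (λ B′ Q′ → f B′ * N (Q ++ Q′) α) U
          ≡⟨ ∑⊔-cong U (λ {B′} {Q′} s → ≡-trans
               (cong (λ z → f B′ * z) (N-clique α clique inner (All-interleavingʳ s outer)))
               (≡-trans (*-rotate (f B′) (pos (length Q !)) (E (length Q) (N Q′) α))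
                 (cong (λ z → pos (length Q !) * z) (sym (E-* (length Q) (f B′) (N Q′) α))))) ⟩
        ∑⊔ (λ B′ Q′ → pos (length Q !) * E (length Q) (λ α → f B′ * N Q′ α) α) U
          ≡⟨ ∑⊔-* (pos (length Q !)) (λ B′ Q′ → E (length Q) (λ α → f B′ * N Q′ α) α) U ⟩
        pos (length Q !) * ∑⊔ (λ B′ Q′ → E (length Q) (λ α → f B′ * N Q′ α) α) U
          ≡⟨ cong (λ z → pos (length Q !) * z) (≡-trans
               (sym (E-∑⊔ (length Q) (λ B′ Q′ α → f B′ * N Q′ α) U α)) (E-cong (length Q) eq α)) ⟩
        pos (length Q !) * E (length Q) g α ∎
      part : ∀ {B Q} → Interleaving B Q C → ∑⊔ (Φ B Q) U ≡ δ (length B) 0 * x + δ (length B) 1 * y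
      part {[]} {Q} s = begin
        ∑⊔ (λ B′ Q′ → δ (length B′) i * (st B′ * N (Q ++ Q′) α)) U
          ≡⟨ ∑⊔-cong U (λ {B′} {Q′} _ → sym (ℤ.*-assoc (δ (length B′) i) (st B′) (N (Q ++ Q′) α))) ⟩
        ∑⊔ (λ B′ Q′ → δ (length B′) i * st B′ * N (Q ++ Q′) α) U
          ≡⟨ remaining (AllPairs-interleavingʳ s clique) (All-interleavingʳ s inner)
               (λ B′ → δ (length B′) i * st B′) (∂ i (N U))
               (λ α → ∑⊔-cong U (λ {B′} {Q′} _ → ℤ.*-assoc (δ (length B′) i) (st B′) (N Q′ α))) ⟩
        pos (length Q !) * E (length Q) (∂ i (N U)) α
          ≡⟨ cong (λ n → pos (n !) * E n (∂ i (N U)) α) (sym (interleave-length s)) ⟩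
        x
          ≡⟨ pad x y ⟩
        1ℤ * x + 0ℤ * y ∎
        where
        pad : ∀ x y → x ≡ 1ℤ * x + 0ℤ * y
        pad = solve-∀
      part {b ∷ []} {Q} s with b-inner ∷ _ ← All-interleavingˡ s inner = begin
        ∑⊔ (λ B′ Q′ → δ (suc (length B′)) i * (free B′ b * st B′ * N (Q ++ Q′) α)) U
          ≡⟨ ∑⊔-cong U (λ {B′} {Q′} s′ → ≡-trans
               (cong (λ z → δ (suc (length B′)) i * (z * st B′ * N (Q ++ Q′) α))
                 (separated-free b-inner (All-interleavingˡ s′ outer)))
               (rearrange (δ (suc (length B′)) i) (st B′) (N (Q ++ Q′) α))) ⟩
        ∑⊔ (λ B′ Q′ → δ (suc (length B′)) i * st B′ * N (Q ++ Q′) α) U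
          ≡⟨ remaining (AllPairs-interleavingʳ s clique) (All-interleavingʳ s inner)
               (λ B′ → δ (suc (length B′)) i * st B′) (∂⁻N i) (lower i) ⟩
        pos (length Q !) * E (length Q) (∂⁻N i) α
          ≡⟨ cong (λ n → pos (ℕ.pred n !) * E (ℕ.pred n) (∂⁻N i) α) (sym (interleave-length s)) ⟩
        y
          ≡⟨ pad x y ⟩
        0ℤ * x + 1ℤ * y ∎
        where
        rearrange : ∀ d s n → d * (1ℤ * s * n) ≡ d * s * n
        rearrange = solve-∀
        pad : ∀ x y → y ≡ 0ℤ * x + 1ℤ * y
        pad = solve-∀
        lower : ∀ i α → ∑⊔ (λ B′ Q′ → δ (suc (length B′)) i * st B′ * N Q′ α) U ≡ ∂⁻N i α
        lower zero    α = ∑⊔-0 U (λ _ → refl)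
        lower (suc i) α = ∑⊔-cong U (λ {B′} {Q′} _ → ℤ.*-assoc (δ (length B′) i) (st B′) (N Q′ α))
      part {b ∷ b′ ∷ B} {Q} s with (b′b ∷ _) ∷ _ ← AllPairs-interleavingˡ s clique = ∑⊔-0 U λ {B′} {Q′} _ → ≡-trans
        (cong (λ z → δ (suc (suc (length (B ++ B′)))) i * (z * free (B ++ B′) b * st (b′ ∷ B ++ B′) * N (Q ++ Q′) α)) b′b)
        (ℤ.*-zeroʳ (δ (suc (suc (length (B ++ B′)))) i))

∑⊔-map : ∀ {A B : Set} (g : A → B) Φ U → ∑⊔ Φ (map g U) ≡ ∑⊔ (λ C Q → Φ (map g C) (map g Q)) U
∑⊔-map g Φ []      = refl
∑⊔-map g Φ (u ∷ U) = cong₂ _+_ (∑⊔-map g (λ C Q → Φ (g u ∷ C) Q) U) (∑⊔-map g (λ C Q → Φ C (g u ∷ Q)) U)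

module _ {m n} (G : Graph m) (H : Graph n) (g : Fin m → Fin n) (g-adj : ∀ u v → adj H (g u) (g v) ≡ adj G u v) where
  private
    module G = StablePartitions (adj G) (adj-sym G) (adj-irrefl G)
    module H = StablePartitions (adj H) (adj-sym H) (adj-irrefl H)

    free-map : ∀ B v → H.free (map g B) (g v) ≡ G.free B v
    free-map []      v = refl
    free-map (u ∷ B) v = cong₂ _*_ (cong (indicator ∘ not) (g-adj u v)) (free-map B v)

    st-map : ∀ B → H.st (map g B) ≡ G.st B
    st-map []      = refl
    st-map (v ∷ B) = cong₂ _*_ (free-map B v) (st-map B)

  N-map : ∀ α U → H.N (map g U) α ≡ G.N U α
  N-map []      []      = refl
  N-map []      (_ ∷ _) = refl
  N-map (i ∷ α) U       = ≡-trans
    (∑⊔-map g (λ B Q → δ (length B) i * (H.st B * H.N Q α)) U)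
    (∑⊔-cong U (λ {B} {Q} _ → cong₂ _*_ (cong (λ k → δ k i) (length-map g B)) (cong₂ _*_ (st-map B) (N-map α Q))))

star : ∀ m → Graph (suc m)
star m = record { Adj = Adj ; adj? = adj? ; symm = λ {u} {v} → symm u v ; irrefl = λ { {u} refl → irrefl u } }
  where
  Adj : Fin (suc m) → Fin (suc m) → Set
  Adj zero    zero    = ⊥
  Adj zero    (suc _) = ⊤
  Adj (suc _) zero    = ⊤
  Adj (suc _) (suc _) = ⊥
  adj? : ∀ u v → Dec (Adj u v)
  adj? zero    zero    = no λ ()
  adj? zero    (suc _) = yes tt
  adj? (suc _) zero    = yes tt
  adj? (suc _) (suc _) = no λ ()
  symm : ∀ u v → Adj u v → Adj v u
  symm zero    (suc _) _ = tt
  symm (suc _) zero    _ = tt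
  irrefl : ∀ u → ¬ Adj u u
  irrefl zero    ()
  irrefl (suc _) ()

X-star : ∀ m α → X (star m) α ≡ ρ m 0 (λ ν → e[ ν ] α)
X-star m α = begin
  X (star m) α
    ≡⟨ X-N (star m) α ⟩
  N (zero ∷ tabulate suc) α
    ≡⟨ N-star (adj (star m)) (adj-sym (star m)) (adj-irrefl (star m)) {λ v → ∃ λ i → v ≡ suc i}
         (λ { (_ , refl) (_ , refl) → refl }) (λ { (_ , refl) → refl }) α (Allₚ.tabulate⁺ (λ i → i , refl)) ⟩
  S (length (tabulate {n = m} suc)) 0 α
    ≡⟨ cong (λ k → S k 0 α) (length-tabulate {n = m} suc) ⟩
  S m 0 α
    ≡⟨ ρ-e[] m 0 α ⟨
  ρ m 0 (λ ν → e[ ν ] α) ∎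
  where open StablePartitions (adj (star m)) (adj-sym (star m)) (adj-irrefl (star m))

K_⊔_ : ∀ m {n} → Graph n → Graph (m +ⁿ n)
K_⊔_ m {n} G = record
  { Adj = λ u v → Adj (splitAt m u) (splitAt m v) ; adj? = λ u v → adj⊎? (splitAt m u) (splitAt m v)
  ; symm = λ {u} {v} → symm (splitAt m u) (splitAt m v) ; irrefl = λ { {u} refl → irrefl (splitAt m u) } }
  where
  Adj : Fin m ⊎ Fin n → Fin m ⊎ Fin n → Set
  Adj (inj₁ i) (inj₁ j) = i ≢ j
  Adj (inj₁ _) (inj₂ _) = ⊥
  Adj (inj₂ _) (inj₁ _) = ⊥
  Adj (inj₂ u) (inj₂ v) = Graph.Adj G u v
  adj⊎? : ∀ u v → Dec (Adj u v)
  adj⊎? (inj₁ i) (inj₁ j) = ¬? (i ≟ᶠ j)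
  adj⊎? (inj₁ _) (inj₂ _) = no λ ()
  adj⊎? (inj₂ _) (inj₁ _) = no λ ()
  adj⊎? (inj₂ u) (inj₂ v) = Graph.adj? G u v
  symm : ∀ u v → Adj u v → Adj v u
  symm (inj₁ _) (inj₁ _) i≢j = i≢j ∘ sym
  symm (inj₂ _) (inj₂ _) uv  = Graph.symm G uv
  irrefl : ∀ u → ¬ Adj u u
  irrefl (inj₁ _) i≢i = i≢i refl
  irrefl (inj₂ _) uu  = Graph.irrefl G refl uu

tabulate-+ : ∀ {A : Set} m {n} (f : Fin (m +ⁿ n) → A) →
             tabulate f ≡ tabulate (λ i → f (i ↑ˡ n)) ++ tabulate (λ j → f (m ↑ʳ j))
tabulate-+ zero    f = refl
tabulate-+ (suc m) f = cong (f zero ∷_) (tabulate-+ m (f ∘ suc))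

X-K⊔ : ∀ m {n} (G : Graph n) α → X (K m ⊔ G) α ≡ pos (m !) * E m (X G) α
X-K⊔ m {n} G α = begin
  X H α
    ≡⟨ X-N H α ⟩
  HN (allFin (m +ⁿ n)) α
    ≡⟨ cong (λ V → HN V α) (tabulate-+ m id) ⟩
  HN (tabulate (_↑ˡ n) ++ tabulate (m ↑ʳ_)) α
    ≡⟨ N-clique (adj H) (adj-sym H) (adj-irrefl H)
         {λ u → ∃ λ i → u ≡ i ↑ˡ n} {λ v → ∃ λ j → v ≡ m ↑ʳ j}
         (λ { (i , refl) (j , refl) → cong (indicator ∘ not) (outer-inner j i) }) α
         (AllPairsₚ.tabulate⁺ (λ {i} {j} i≢j → cong (indicator ∘ not) (inner-inner j i (i≢j ∘ sym))))
         (Allₚ.tabulate⁺ (λ i → i , refl)) (Allₚ.tabulate⁺ (λ j → j , refl)) ⟩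
  pos (length (tabulate {n = m} (_↑ˡ n)) !) * E (length (tabulate {n = m} (_↑ˡ n))) (HN (tabulate (m ↑ʳ_))) α
    ≡⟨ cong (λ k → pos (k !) * E k (HN (tabulate (m ↑ʳ_))) α) (length-tabulate {n = m} (_↑ˡ n)) ⟩
  pos (m !) * E m (HN (tabulate (m ↑ʳ_))) α
    ≡⟨ cong (λ z → pos (m !) * z) (E-cong m outer α) ⟩
  pos (m !) * E m (X G) α ∎
  where
  H = K m ⊔ G
  open StablePartitions (adj H) (adj-sym H) (adj-irrefl H) using () renaming (N to HN)
  open StablePartitions (adj G) (adj-sym G) (adj-irrefl G) using (N)
  inner-inner : ∀ i j → i ≢ j → adj H (i ↑ˡ n) (j ↑ˡ n) ≡ true
  inner-inner i j i≢j rewrite splitAt-↑ˡ m i n | splitAt-↑ˡ m j n | dec-false (i ≟ᶠ j) i≢j = refl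
  outer-inner : ∀ i j → adj H (m ↑ʳ i) (j ↑ˡ n) ≡ false
  outer-inner i j rewrite splitAt-↑ʳ m n i | splitAt-↑ˡ m j n = refl
  outer-outer : ∀ u v → adj H (m ↑ʳ u) (m ↑ʳ v) ≡ adj G u v
  outer-outer u v rewrite splitAt-↑ʳ m n u | splitAt-↑ʳ m n v = refl
  outer : ∀ α → HN (tabulate (m ↑ʳ_)) α ≡ X G α
  outer α = begin
    HN (tabulate (m ↑ʳ_)) α       ≡⟨ cong (λ V → HN V α) (map-tabulate {n = n} id (m ↑ʳ_)) ⟨
    HN (map (m ↑ʳ_) (allFin n)) α ≡⟨ N-map G H (m ↑ʳ_) outer-outer α (allFin n) ⟩
    N (allFin n) α                ≡⟨ X-N G α ⟨
    X G α                         ∎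

-- The number of vertices is a `foldr` so that it unfolds definitionally with each added complete
-- graph.
⨆K : ∀ μ {n} → Graph n → Graph (foldr _+ⁿ_ n μ)
⨆K []      G = G
⨆K (m ∷ μ) G = K m ⊔ (⨆K μ G)

factorials : List ℕ → ℕ
factorials []      = 1
factorials (m ∷ μ) = m ! *ⁿ factorials μ

0<factorials : ∀ μ → 0 <ⁿ factorials μ
0<factorials []      = s≤s z≤n
0<factorials (m ∷ μ) = ℕ.*-mono-≤ (ℕ.1≤n! m) (0<factorials μ)

X-⨆K-star : ∀ μ m α → X (⨆K μ (star m)) α ≡ pos (factorials μ) * ρ m 0 (λ ν → e[ μ ++ ν ] α)
X-⨆K-star []      m α = ≡-trans (X-star m α) (sym (ℤ.*-identityˡ _))
X-⨆K-star (k ∷ μ) m α = begin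
  X (K k ⊔ ⨆K μ (star m)) α
    ≡⟨ X-K⊔ k (⨆K μ (star m)) α ⟩
  pos (k !) * E k (X (⨆K μ (star m))) α
    ≡⟨ cong (λ z → pos (k !) * z) (≡-trans (E-cong k (X-⨆K-star μ m) α)
         (E-* k (pos (factorials μ)) (λ α → ρ m 0 (λ ν → e[ μ ++ ν ] α)) α)) ⟩
  pos (k !) * (pos (factorials μ) * E k (λ α → ρ m 0 (λ ν → e[ μ ++ ν ] α)) α)
    ≡⟨ ≡-trans (sym (ℤ.*-assoc (pos (k !)) (pos (factorials μ)) _))
         (cong₂ _*_ (sym (ℤ.pos-* (k !) (factorials μ))) (sym (ρ-E m 0 k (λ ν → e[ μ ++ ν ]) α))) ⟩
  pos (factorials (k ∷ μ)) * ρ m 0 (λ ν → E k e[ μ ++ ν ] α)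
    ≡⟨ cong (λ z → pos (factorials (k ∷ μ)) * z) (ρ-cong m 0 (λ ν _ _ → sym (e[]-∷ k (μ ++ ν) α))) ⟩
  pos (factorials (k ∷ μ)) * ρ m 0 (λ ν → e[ k ∷ μ ++ ν ] α) ∎

-- Negative coefficients for partitions with two parts larger than 1

foldr-+ : ∀ n μ → foldr _+ⁿ_ n μ ≡ sum μ +ⁿ n
foldr-+ n []      = refl
foldr-+ n (m ∷ μ) = ≡-trans (cong (m +ⁿ_) (foldr-+ n μ)) (sym (ℕ.+-assoc m (sum μ) n))

∑-* : ∀ {A : Set} x (f : A → ℤ) xs → ∑ (map (λ y → x * f y) xs) ≡ x * ∑ (map f xs)
∑-* x f []       = sym (ℤ.*-zeroʳ x)
∑-* x f (y ∷ xs) = ≡-trans (cong (λ z → x * f y + z) (∑-* x f xs)) (sym (ℤ.*-distribˡ-+ x (f y) (∑ (map f xs))))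

sorted-unique : ∀ {μ ν} → Linked _≥ⁿ_ μ → Linked _≥ⁿ_ ν → μ ↭ ν → μ ≡ ν
sorted-unique μ↘ ν↘ p =
  Pointwise-≡⇒≡ (↗↭↗⇒≋ (DecTotalOrder.totalOrder ≥-decTotalOrder) μ↘ ν↘ (↭⇒↭ₛ p))

-- The coefficient of e_μ in e_ν for a partition μ; the index lists produced by `ρ` are not sorted.
sortedTo : List ℕ → List ℕ → ℤ
sortedTo ν μ = indicator (does (≡-dec _≟_ (sort ν) μ))

sortedTo-bit : ∀ ν μ → Bit (sortedTo ν μ)
sortedTo-bit ν μ = indicator-bit (does (≡-dec _≟_ (sort ν) μ))

sortedTo-≡ : ∀ {ν μ} → sort ν ≡ μ → sortedTo ν μ ≡ 1ℤ
sortedTo-≡ {ν} {μ} eq = cong indicator (dec-true (≡-dec _≟_ (sort ν) μ) eq)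

sortedTo-≢ : ∀ {ν μ} → sort ν ≢ μ → sortedTo ν μ ≡ 0ℤ
sortedTo-≢ {ν} {μ} neq = cong indicator (dec-false (≡-dec _≟_ (sort ν) μ) neq)

drop-++ : ∀ (xs : List ℕ) {ys zs} → xs ++ ys ↭ xs ++ zs → ys ↭ zs
drop-++ []       p = p
drop-++ (x ∷ xs) p = drop-++ xs (drop-∷ p)

module _ (a b : ℕ) (λs : List ℕ) (part : IsPartition (suc (suc a) ∷ suc (suc b) ∷ λs)) where
  private
    μ : List ℕ
    μ = suc (suc a) ∷ suc (suc b) ∷ λs

    -- The number of leaves: with its centre the star has as many vertices as the two leading parts
    -- together.
    m : ℕ
    m = suc a +ⁿ suc (suc b)

    φ : List ℕ → List ℕ → ℤ
    φ μ′ ν = sortedTo (λs ++ ν) μ′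

    φ-≡0 : ∀ {ν} → ¬ (ν ↭ suc (suc a) ∷ suc (suc b) ∷ []) → φ μ ν ≡ 0ℤ
    φ-≡0 {ν} ¬p = sortedTo-≢ λ eq → ¬p (drop-++ λs
      (↭-trans (subst (λs ++ ν ↭_) eq (↭-sym (sort-↭ (λs ++ ν)))) (++-comm (suc (suc a) ∷ suc (suc b) ∷ []) λs)))

    φ-≡1 : φ μ (suc (suc a) ∷ suc (suc b) ∷ []) ≡ 1ℤ
    φ-≡1 = sortedTo-≡ (sorted-unique (sort-↗ _) (proj₁ part)
      (↭-trans (sort-↭ _) (++-comm λs (suc (suc a) ∷ suc (suc b) ∷ []))))

    no-parts-1 : ∀ {ν} → ¬ (1 ∷ ν ↭ suc (suc a) ∷ suc (suc b) ∷ [])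
    no-parts-1 p with ∈-resp-↭ p (here refl)
    ... | here ()
    ... | there (here ())
    ... | there (there ())

  graph : Graph (foldr _+ⁿ_ (suc m) λs)
  graph = ⨆K λs (star m)

  -- The functional of `X-⨆K-star`, evaluated at the indicator of one partition in place of the
  -- series `e[_]`.
  coefficient : List ℕ → ℤ
  coefficient μ′ = pos (factorials λs) * ρ m 0 (φ μ′)

  coefficient-negative : coefficient μ < 0ℤ
  coefficient-negative = negative (0<factorials λs) (ρ-negative
    (λ x → φ-≡0 (λ p → absurd₁ (↭-length p)))
    (λ x y → bit-nonneg (sortedTo-bit (λs ++ x ∷ y ∷ []) μ))
    (λ x y z ν → φ-≡0 (λ p → absurd₃ (↭-length p)))
    (λ ν → φ-≡0 no-parts-1) (suc a) (suc b) φ-≡1)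
    where
    absurd₁ : 1 ≢ 2
    absurd₁ ()
    absurd₃ : ∀ {n} → suc (suc (suc n)) ≢ 2
    absurd₃ ()
    negative : ∀ {n x} → 0 <ⁿ n → x < 0ℤ → pos n * x < 0ℤ
    negative {suc n} {x} _ x<0 = subst (pos (suc n) * x <_) (ℤ.*-zeroʳ (pos (suc n))) (ℤ.*-monoˡ-<-pos (pos (suc n)) x<0)

  expansion : IsExpansion graph coefficient
  expansion α = begin
    X graph α
      ≡⟨ X-⨆K-star λs m α ⟩
    pos (factorials λs) * ρ m 0 (λ ν → e[ λs ++ ν ] α)
      ≡⟨ cong (λ z → pos (factorials λs) * z) (ρ-cong m 0 (λ ν ν>0 |ν| → sym (expand ν ν>0 |ν|))) ⟩
    pos (factorials λs) * ρ m 0 (λ ν → ∑ (map (λ μ′ → φ μ′ ν * e[ μ′ ] α) (partitions n)))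
      ≡⟨ cong (λ z → pos (factorials λs) * z) (ρ-∑ m 0 (λ μ′ → e[ μ′ ] α) φ (partitions n)) ⟩
    pos (factorials λs) * ∑ (map (λ μ′ → ρ m 0 (φ μ′) * e[ μ′ ] α) (partitions n))
      ≡⟨ ∑-* (pos (factorials λs)) (λ μ′ → ρ m 0 (φ μ′) * e[ μ′ ] α) (partitions n) ⟨
    ∑ (map (λ μ′ → pos (factorials λs) * (ρ m 0 (φ μ′) * e[ μ′ ] α)) (partitions n))
      ≡⟨ cong ∑ (map-cong (λ μ′ → sym (ℤ.*-assoc (pos (factorials λs)) (ρ m 0 (φ μ′)) (e[ μ′ ] α))) (partitions n)) ⟩
    ∑ (map (λ μ′ → coefficient μ′ * e[ μ′ ] α) (partitions n)) ∎
    where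
    n = foldr _+ⁿ_ (suc m) λs
    expand : ∀ ν → All (0 <ⁿ_) ν → sum ν ≡ suc (m +ⁿ 0) →
             ∑ (map (λ μ′ → φ μ′ ν * e[ μ′ ] α) (partitions n)) ≡ e[ λs ++ ν ] α
    expand ν ν>0 |ν| = begin
      ∑ (map (λ μ′ → φ μ′ ν * e[ μ′ ] α) (partitions n))
        ≡⟨ ∑-select (λ μ′ → φ μ′ ν * e[ μ′ ] α) (partitions n) (partitions-unique n)
             (Equivalence.from (∈-partitions {n}) ((sort-↗ (λs ++ ν) , sorted>0) , sum-sorted))
             (λ {μ′} _ μ′≢ → cong (_* e[ μ′ ] α) (sortedTo-≢ {λs ++ ν} (μ′≢ ∘ sym))) ⟩
      φ (sort (λs ++ ν)) ν * e[ sort (λs ++ ν) ] α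
        ≡⟨ cong₂ _*_ (sortedTo-≡ {λs ++ ν} refl) (e[]-↭ (sort-↭ (λs ++ ν)) α) ⟩
      1ℤ * e[ λs ++ ν ] α
        ≡⟨ ℤ.*-identityˡ (e[ λs ++ ν ] α) ⟩
      e[ λs ++ ν ] α ∎
      where
      λs>0 : All (0 <ⁿ_) λs
      λs>0 with _ ∷ _ ∷ ps ← proj₂ part = ps
      sorted>0 : All (0 <ⁿ_) (sort (λs ++ ν))
      sorted>0 = All-resp-↭ (↭-sym (sort-↭ (λs ++ ν))) (Allₚ.++⁺ λs>0 ν>0)
      sum-sorted : sum (sort (λs ++ ν)) ≡ n
      sum-sorted = begin
        sum (sort (λs ++ ν))     ≡⟨ sum-↭ (sort-↭ (λs ++ ν)) ⟩
        sum (λs ++ ν)            ≡⟨ sum-++ λs ν ⟩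
        sum λs +ⁿ sum ν          ≡⟨ cong (sum λs +ⁿ_) (≡-trans |ν| (cong suc (ℕ.+-identityʳ m))) ⟩
        sum λs +ⁿ suc m          ≡⟨ foldr-+ (suc m) λs ⟨
        n                        ∎

  -- `EPositive` ranges over all expansions, so a single one with a negative value at `μ` refutes
  -- it.
  not-positive : ¬ EPositive μ
  not-positive positive = ℤ.<⇒≱ coefficient-negative (apply graph size coefficient expansion)
    where
    size : foldr _+ⁿ_ (suc m) λs ≡ sum μ
    size = begin
      foldr _+ⁿ_ (suc m) λs                            ≡⟨ foldr-+ (suc m) λs ⟩
      sum λs +ⁿ (suc (suc a) +ⁿ suc (suc b))           ≡⟨ ℕ.+-comm (sum λs) _ ⟩
      (suc (suc a) +ⁿ suc (suc b)) +ⁿ sum λs           ≡⟨ ℕ.+-assoc (suc (suc a)) (suc (suc b)) (sum λs) ⟩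
      sum μ                                            ∎
    -- The two expressions for the number of vertices agree only propositionally; generalising over
    -- `n` lets `refl` identify them.
    apply : ∀ {n} (G : Graph n) → n ≡ sum μ → ∀ c → IsExpansion G c → 0ℤ ≤ c μ
    apply G refl c = positive G c

-- Classification of partitions into columns, hooks and the rest

data Shape : List ℕ → Set where
  column  : ∀ d → Shape (replicate d 1)
  hook    : ∀ k d → Shape (suc (suc k) ∷ replicate d 1)
  nonhook : ∀ a b μ → Shape (suc (suc a) ∷ suc (suc b) ∷ μ)

column-shape : ∀ {μ} → Linked _≥ⁿ_ (1 ∷ μ) → All (0 <ⁿ_) μ → ∃ λ d → μ ≡ replicate d 1
column-shape {[]}              _            _         = 0 , refl
column-shape {suc zero ∷ μ}    (_ ∷ dec)    (_ ∷ μ>0) with d , refl ← column-shape dec μ>0 = suc d , refl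
column-shape {suc (suc _) ∷ μ} (s≤s () ∷ _) _

shape : ∀ {μ} → IsPartition μ → Shape μ
shape {[]}                            _                 = column 0
shape {zero ∷ _}                      (_ , () ∷ _)
shape {suc zero ∷ μ}                  (dec , _ ∷ μ>0)   with d , refl ← column-shape dec μ>0 = column (suc d)
shape {suc (suc k) ∷ []}              _                 = hook k 0
shape {suc (suc k) ∷ zero ∷ _}        (_ , _ ∷ () ∷ _)
shape {suc (suc k) ∷ suc zero ∷ μ}    (_ ∷ dec , _ ∷ _ ∷ μ>0) with d , refl ← column-shape dec μ>0 = hook k (suc d)
shape {suc (suc a) ∷ suc (suc b) ∷ μ} _                 = nonhook a b μ

filter-ones : ∀ d → filter (1 ℕ.<?_) (replicate d 1) ≡ []
filter-ones zero    = refl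
filter-ones (suc d) = filter-ones d

theorem1p1 : (μ : List ℕ) → IsPartition μ → EPositive μ ⇔ IsHook μ
theorem1p1 μ part = by-shape (shape part) part
  where
  by-shape : ∀ {μ} → Shape μ → IsPartition μ → EPositive μ ⇔ IsHook μ
  by-shape (column d) part = mk⇔
    (λ _ → subst (λ xs → length xs ≤ⁿ 1) (sym (filter-ones d)) z≤n)
    (λ _ → column-positive d part)
  by-shape (hook k d) part = mk⇔
    (λ _ → s≤s (subst (λ xs → length xs ≤ⁿ 0) (sym (filter-ones d)) z≤n))
    (λ _ → hook-positive k d part)
  by-shape (nonhook a b μ) part = mk⇔
    (λ positive → ⊥-elim (not-positive a b μ part positive))
    (λ { (s≤s ()) })
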